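{- There exists $\gamma>0$ such that for any $p=p(n)<1.1/n$ (with $p\in[0,1]$), the random graph $G\sim G(n,p)$ satisfies the following with high probability (i.e. with probability tending to $1$ as $n\to\infty$): for every subset $V'\subseteq[n]$ of size $|V'|\ge\gamma\log n$, the induced subgraph $G[V']$ is not globally rigid in $\mathbb{R}$.
   Context: $G(n,p)$ is the Erdős–Rényi random graph on the vertex set $[n]=\{1,\dots,n\}$, in which each pair of vertices is an edge independently with probability $p$. $\log$ denotes the natural logarithm. Global rigidity in $\mathbb{R}$ (injective version): a simple graph $H=(V,E)$ is globally rigid in $\mathbb{R}$ if for every two injective functions $f,g:V\to\mathbb{R}$ satisfying $|f(x)-f(y)|=|g(x)-g(y)|$ for every edge $xy\in E$, we also have $|f(x)-f(y)|=|g(x)-g(y)|$ for every pair $x,y\in V$. -}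

module Defs where

open import Data.Bool using (Bool; true; false; T; if_then_else_)
open import Data.Fin as Fin using (Fin)
open import Data.Fin.Subset using (Subset; _∈_)
open import Data.Integer as ℤ using (+_)
import Data.Integer.Properties as ℤₚ
open import Data.List using (List; []; _∷_; _++_; map; foldr; filter; allFin; cartesianProduct)
open import Data.List.Membership.Propositional using () renaming (_∈_ to _∈ₗ_)
open import Data.Nat as ℕ using (ℕ; zero; suc)
import Data.Nat.Properties as ℕₚ
open import Data.Product using (Σ-syntax; ∃; ∃-syntax; _×_; _,_; proj₁; proj₂)
open import Data.Rational as ℚ using (ℚ; 0ℚ; 1ℚ; ½)
import Data.Rational.Properties as ℚₚ
open import Data.Rational.Solver using (module +-*-Solver)
import Data.Rational.Unnormalised as ℚᵘ
import Data.Rational.Unnormalised.Properties as ℚᵘₚ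
open import Data.Sum using (_⊎_; inj₁; inj₂; swap)
open import Function using (_∘_)
open import Function.Definitions using (Injective)
open import Relation.Binary.Definitions using (Symmetric)
open import Relation.Binary.PropositionalEquality
  using (_≡_; _≢_; refl; sym; trans; cong; cong₂; subst; subst₂)
open import Relation.Nullary using (¬_)

------------------------------------------------------------------------
-- Rational estimates

private
  open +-*-Solver

  ½*-pos : ∀ {ε} → 0ℚ ℚ.< ε → 0ℚ ℚ.< ½ ℚ.* ε
  ½*-pos {ε} 0<ε =
    ℚₚ.positive⁻¹ _ {{ℚₚ.pos*pos⇒pos ½ ε {{ℚ.positive 0<ε}}}}

  halves : ∀ ε → ½ ℚ.* ε ℚ.+ ½ ℚ.* ε ≡ ε
  halves = solve 1 (λ e → con ½ :* e :+ con ½ :* e := e) refl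

  ∣-∣-≤ : ∀ {x y} → x ℚ.≤ y → ℚ.- x ℚ.≤ y → ℚ.∣ x ∣ ℚ.≤ y
  ∣-∣-≤ {x} {y} x≤y -x≤y with ℚₚ.∣p∣≡p∨∣p∣≡-p x
  ... | inj₁ e = subst (ℚ._≤ y) (sym e) x≤y
  ... | inj₂ e = subst (ℚ._≤ y) (sym e) -x≤y

  ∣-∣-swap : ∀ x y → ℚ.∣ x ℚ.- y ∣ ≡ ℚ.∣ y ℚ.- x ∣
  ∣-∣-swap x y = trans
    (cong ℚ.∣_∣ (solve 2 (λ x y → x :- y := :- (y :- x)) refl x y))
    (ℚₚ.∣-p∣≡∣p∣ (y ℚ.- x))

  ∣x∣-∣y∣≤∣x-y∣ : ∀ x y → ℚ.∣ x ∣ ℚ.- ℚ.∣ y ∣ ℚ.≤ ℚ.∣ x ℚ.- y ∣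
  ∣x∣-∣y∣≤∣x-y∣ x y = begin
    ℚ.∣ x ∣ ℚ.- ℚ.∣ y ∣
      ≡⟨ cong (λ z → ℚ.∣ z ∣ ℚ.- ℚ.∣ y ∣) (solve 2 (λ x y → x := (x :- y) :+ y) refl x y) ⟩
    ℚ.∣ (x ℚ.- y) ℚ.+ y ∣ ℚ.- ℚ.∣ y ∣
      ≤⟨ ℚₚ.+-monoˡ-≤ (ℚ.- ℚ.∣ y ∣) (ℚₚ.∣p+q∣≤∣p∣+∣q∣ (x ℚ.- y) y) ⟩
    (ℚ.∣ x ℚ.- y ∣ ℚ.+ ℚ.∣ y ∣) ℚ.- ℚ.∣ y ∣
      ≡⟨ solve 2 (λ a b → (a :+ b) :- b := a) refl ℚ.∣ x ℚ.- y ∣ ℚ.∣ y ∣ ⟩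
    ℚ.∣ x ℚ.- y ∣ ∎
    where open ℚₚ.≤-Reasoning

  ∣∣x∣-∣y∣∣≤∣x-y∣ : ∀ x y → ℚ.∣ ℚ.∣ x ∣ ℚ.- ℚ.∣ y ∣ ∣ ℚ.≤ ℚ.∣ x ℚ.- y ∣
  ∣∣x∣-∣y∣∣≤∣x-y∣ x y = ∣-∣-≤ (∣x∣-∣y∣≤∣x-y∣ x y)
    (subst₂ ℚ._≤_
      (solve 2 (λ a b → b :- a := :- (a :- b)) refl ℚ.∣ x ∣ ℚ.∣ y ∣)
      (∣-∣-swap y x)
      (∣x∣-∣y∣≤∣x-y∣ y x))

------------------------------------------------------------------------
-- Real numbers: Cauchy sequences of rationals, with the equality _≃_

record ℝ : Set where
  constructor mkℝ
  field
    seq    : ℕ → ℚ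
    cauchy : ∀ ε → 0ℚ ℚ.< ε → ∃[ N ] (∀ m n → N ℕ.≤ m → N ℕ.≤ n →
             ℚ.∣ seq m ℚ.- seq n ∣ ℚ.< ε)
open ℝ public

infix 4 _≃_ _≤_ _<_
infixl 6 _+_ _-_
infixl 7 _*_
infix 8 -_

_≃_ : ℝ → ℝ → Set
x ≃ y = ∀ ε → 0ℚ ℚ.< ε → ∃[ N ] (∀ n → N ℕ.≤ n →
        ℚ.∣ seq x n ℚ.- seq y n ∣ ℚ.≤ ε)

_≤_ : ℝ → ℝ → Set
x ≤ y = ∀ ε → 0ℚ ℚ.< ε → ∃[ N ] (∀ n → N ℕ.≤ n →
        seq x n ℚ.≤ seq y n ℚ.+ ε)

_<_ : ℝ → ℝ → Set
x < y = ∃[ ε ] (0ℚ ℚ.< ε × ∃[ N ] (∀ n → N ℕ.≤ n →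
        seq x n ℚ.+ ε ℚ.≤ seq y n))

fromℚ : ℚ → ℝ
fromℚ q = mkℝ (λ _ → q)
  (λ ε 0<ε → 0 , λ _ _ _ _ → subst (ℚ._< ε) (sym (cong ℚ.∣_∣ (ℚₚ.+-inverseʳ q))) 0<ε)

fromℕ : ℕ → ℝ
fromℕ n = fromℚ (+ n ℚ./ 1)

0ℝ 1ℝ : ℝ
0ℝ = fromℚ 0ℚ
1ℝ = fromℚ 1ℚ

_+_ : ℝ → ℝ → ℝ
x + y = mkℝ (λ n → seq x n ℚ.+ seq y n) λ ε 0<ε →
  let (M , p) = cauchy x (½ ℚ.* ε) (½*-pos 0<ε)
      (N , q) = cauchy y (½ ℚ.* ε) (½*-pos 0<ε)
  in M ℕ.⊔ N , λ m n l k →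
    let a = seq x m ; b = seq x n ; c = seq y m ; d = seq y n
    in begin-strict
      ℚ.∣ (a ℚ.+ c) ℚ.- (b ℚ.+ d) ∣
        ≡⟨ cong ℚ.∣_∣ (solve 4 (λ a b c d → (a :+ c) :- (b :+ d) := (a :- b) :+ (c :- d)) refl a b c d) ⟩
      ℚ.∣ (a ℚ.- b) ℚ.+ (c ℚ.- d) ∣
        ≤⟨ ℚₚ.∣p+q∣≤∣p∣+∣q∣ (a ℚ.- b) (c ℚ.- d) ⟩
      ℚ.∣ a ℚ.- b ∣ ℚ.+ ℚ.∣ c ℚ.- d ∣
        <⟨ ℚₚ.+-mono-< (p m n (ℕₚ.≤-trans (ℕₚ.m≤m⊔n M N) l) (ℕₚ.≤-trans (ℕₚ.m≤m⊔n M N) k))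
                       (q m n (ℕₚ.≤-trans (ℕₚ.m≤n⊔m M N) l) (ℕₚ.≤-trans (ℕₚ.m≤n⊔m M N) k)) ⟩
      ½ ℚ.* ε ℚ.+ ½ ℚ.* ε
        ≡⟨ halves ε ⟩
      ε ∎
  where open ℚₚ.≤-Reasoning

-_ : ℝ → ℝ
- x = mkℝ (λ n → ℚ.- seq x n) λ ε 0<ε →
  let (N , p) = cauchy x ε 0<ε
  in N , λ m n l k → subst (ℚ._< ε)
    (cong ℚ.∣_∣ (solve 2 (λ a b → a :- b := (:- b) :- (:- a)) refl (seq x n) (seq x m)))
    (p n m k l)

_-_ : ℝ → ℝ → ℝ
x - y = x + (- y)

∣_∣ : ℝ → ℝ
∣ x ∣ = mkℝ (λ n → ℚ.∣ seq x n ∣) λ ε 0<ε →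
  let (N , p) = cauchy x ε 0<ε
  in N , λ m n l k → ℚₚ.≤-<-trans (∣∣x∣-∣y∣∣≤∣x-y∣ (seq x m) (seq x n)) (p m n l k)

private
  eventually-bounded : ∀ x → ∃[ K ] ∃[ N ] (0ℚ ℚ.< K × (∀ n → N ℕ.≤ n → ℚ.∣ seq x n ∣ ℚ.≤ K))
  eventually-bounded x with cauchy x 1ℚ (ℚₚ.positive⁻¹ 1ℚ)
  ... | N , p = 1ℚ ℚ.+ ℚ.∣ seq x N ∣ , N , 0<K , λ n l → begin
      ℚ.∣ seq x n ∣
        ≡⟨ solve 2 (λ a b → a := (a :- b) :+ b) refl ℚ.∣ seq x n ∣ ℚ.∣ seq x N ∣ ⟩
      (ℚ.∣ seq x n ∣ ℚ.- ℚ.∣ seq x N ∣) ℚ.+ ℚ.∣ seq x N ∣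
        ≤⟨ ℚₚ.+-monoˡ-≤ ℚ.∣ seq x N ∣ (∣x∣-∣y∣≤∣x-y∣ (seq x n) (seq x N)) ⟩
      ℚ.∣ seq x n ℚ.- seq x N ∣ ℚ.+ ℚ.∣ seq x N ∣
        ≤⟨ ℚₚ.+-monoˡ-≤ ℚ.∣ seq x N ∣ (ℚₚ.<⇒≤ (p n N l ℕₚ.≤-refl)) ⟩
      1ℚ ℚ.+ ℚ.∣ seq x N ∣ ∎
    where
    open ℚₚ.≤-Reasoning
    0<K : 0ℚ ℚ.< 1ℚ ℚ.+ ℚ.∣ seq x N ∣
    0<K = ℚₚ.+-mono-<-≤ {0ℚ} {1ℚ} {0ℚ} (ℚₚ.positive⁻¹ 1ℚ) (ℚₚ.0≤∣p∣ (seq x N))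

  divide : ∀ {K ε} → 0ℚ ℚ.< K → 0ℚ ℚ.< ε → ∃[ δ ] (0ℚ ℚ.< δ × K ℚ.* δ ≡ ε)
  divide {K} {ε} 0<K 0<ε = 1/K ℚ.* ε
    , ℚₚ.positive⁻¹ _ {{ℚₚ.pos*pos⇒pos 1/K {{ℚₚ.1/pos⇒pos K}} ε {{ℚ.positive 0<ε}}}}
    , trans (sym (ℚₚ.*-assoc K 1/K ε))
        (trans (cong (ℚ._* ε) (ℚₚ.*-inverseʳ K)) (ℚₚ.*-identityˡ ε))
    where
    instance
      K⁺ : ℚ.Positive K
      K⁺ = ℚ.positive 0<K
      K≢0 : ℚ.NonZero K
      K≢0 = ℚₚ.pos⇒nonZero K
    1/K = ℚ.1/ K

  product-< : ∀ {a K b δ} → ℚ.∣ a ∣ ℚ.≤ K → 0ℚ ℚ.< K → ℚ.∣ b ∣ ℚ.< δ → ℚ.∣ a ℚ.* b ∣ ℚ.< K ℚ.* δ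
  product-< {a} {K} {b} {δ} ∣a∣≤K 0<K ∣b∣<δ = begin-strict
    ℚ.∣ a ℚ.* b ∣         ≡⟨ ℚₚ.∣p*q∣≡∣p∣*∣q∣ a b ⟩
    ℚ.∣ a ∣ ℚ.* ℚ.∣ b ∣   ≤⟨ ℚₚ.*-monoʳ-≤-nonNeg ℚ.∣ b ∣ {{ℚₚ.∣-∣-nonNeg b}} ∣a∣≤K ⟩
    K ℚ.* ℚ.∣ b ∣         <⟨ ℚₚ.*-monoʳ-<-pos K {{ℚ.positive 0<K}} ∣b∣<δ ⟩
    K ℚ.* δ               ∎
    where open ℚₚ.≤-Reasoning

_*_ : ℝ → ℝ → ℝ
x * y = mkℝ (λ n → seq x n ℚ.* seq y n) λ ε 0<ε →
  let (K , A , 0<K , x≤K) = eventually-bounded x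
      (L , B , 0<L , y≤L) = eventually-bounded y
      (δ , 0<δ , Kδ) = divide 0<K (½*-pos 0<ε)
      (η , 0<η , Lη) = divide 0<L (½*-pos 0<ε)
      (M , p) = cauchy y δ 0<δ
      (N , q) = cauchy x η 0<η
  in (A ℕ.⊔ B) ℕ.⊔ (M ℕ.⊔ N) , λ m n l k →
    let a = seq x m ; b = seq x n ; c = seq y m ; d = seq y n
        A⊔B≤ = ℕₚ.m≤m⊔n (A ℕ.⊔ B) (M ℕ.⊔ N)
        M⊔N≤ = ℕₚ.m≤n⊔m (A ℕ.⊔ B) (M ℕ.⊔ N)
        A≤ = ℕₚ.≤-trans (ℕₚ.m≤m⊔n A B) A⊔B≤
        B≤ = ℕₚ.≤-trans (ℕₚ.m≤n⊔m A B) A⊔B≤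
        M≤ = ℕₚ.≤-trans (ℕₚ.m≤m⊔n M N) M⊔N≤
        N≤ = ℕₚ.≤-trans (ℕₚ.m≤n⊔m M N) M⊔N≤
    in begin-strict
      ℚ.∣ a ℚ.* c ℚ.- b ℚ.* d ∣
        ≡⟨ cong ℚ.∣_∣ (solve 4 (λ a b c d → a :* c :- b :* d := a :* (c :- d) :+ d :* (a :- b)) refl a b c d) ⟩
      ℚ.∣ a ℚ.* (c ℚ.- d) ℚ.+ d ℚ.* (a ℚ.- b) ∣
        ≤⟨ ℚₚ.∣p+q∣≤∣p∣+∣q∣ (a ℚ.* (c ℚ.- d)) (d ℚ.* (a ℚ.- b)) ⟩
      ℚ.∣ a ℚ.* (c ℚ.- d) ∣ ℚ.+ ℚ.∣ d ℚ.* (a ℚ.- b) ∣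
        <⟨ ℚₚ.+-mono-<
             (product-< {a} {K} {c ℚ.- d} (x≤K m (ℕₚ.≤-trans A≤ l)) 0<K (p m n (ℕₚ.≤-trans M≤ l) (ℕₚ.≤-trans M≤ k)))
             (product-< {d} {L} {a ℚ.- b} (y≤L n (ℕₚ.≤-trans B≤ k)) 0<L (q m n (ℕₚ.≤-trans N≤ l) (ℕₚ.≤-trans N≤ k))) ⟩
      K ℚ.* δ ℚ.+ L ℚ.* η
        ≡⟨ cong₂ ℚ._+_ Kδ Lη ⟩
      ½ ℚ.* ε ℚ.+ ½ ℚ.* ε
        ≡⟨ halves ε ⟩
      ε ∎
  where open ℚₚ.≤-Reasoning

------------------------------------------------------------------------
-- The natural logarithm of a natural number

recip : ℕ → ℚ
recip m = + 1 ℚ./ suc m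

_^_ : ℚ → ℕ → ℚ
q ^ zero  = 1ℚ
q ^ suc m = q ℚ.* q ^ m

mercator : ℚ → ℕ → ℚ
mercator r zero    = 0ℚ
mercator r (suc m) = mercator r m ℚ.+ recip m ℚ.* r ^ suc m

private
  toℚᵘ-/ : ∀ i m → ℚ.toℚᵘ (i ℚ./ suc m) ℚᵘ.≃ ℚᵘ.mkℚᵘ i m
  toℚᵘ-/ i m = ℚₚ.toℚᵘ-fromℚᵘ (ℚᵘ.mkℚᵘ i m)

  recip-anti : ∀ {M m} → M ℕ.≤ m → recip m ℚ.≤ recip M
  recip-anti {M} {m} M≤m = ℚₚ.toℚᵘ-cancel-≤
    (ℚᵘₚ.≤-respˡ-≃ (ℚᵘₚ.≃-sym (toℚᵘ-/ (+ 1) m))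
      (ℚᵘₚ.≤-respʳ-≃ (ℚᵘₚ.≃-sym (toℚᵘ-/ (+ 1) M))
        (ℚᵘ.*≤* (ℤ.+≤+ (ℕₚ.+-monoˡ-≤ 0 (ℕ.s≤s M≤m))))))

  0≤recip : ∀ m → 0ℚ ℚ.≤ recip m
  0≤recip m = ℚₚ.nonNegative⁻¹ (recip m) {{ℚₚ.normalize-nonNeg 1 (suc m)}}

  archimedean : ∀ k ε → 0ℚ ℚ.< ε → ∃[ M ] (+ suc k ℚ./ 1) ℚ.* recip M ℚ.< ε
  archimedean k ε@(ℚ.mkℚ (+ suc a) b-1 _) _ = M , ℚₚ.toℚᵘ-cancel-<
      (ℚᵘₚ.<-respˡ-≃ (ℚᵘₚ.≃-sym (ℚᵘₚ.≃-trans
          (ℚₚ.toℚᵘ-homo-* (+ suc k ℚ./ 1) (recip M))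
          (ℚᵘₚ.*-cong (toℚᵘ-/ (+ suc k) 0) (toℚᵘ-/ (+ 1) M))))
        (ℚᵘ.*<* (subst₂ ℤ._<_ (ℤₚ.pos-* (suc k ℕ.* 1) (suc b-1))
                              (ℤₚ.pos-* (suc a) (1 ℕ.* suc M))
                              (ℤ.+<+ bound))))
    where
    M = suc k ℕ.* suc b-1
    bound : suc k ℕ.* 1 ℕ.* suc b-1 ℕ.< suc a ℕ.* (1 ℕ.* suc M)
    bound = begin-strict
      suc k ℕ.* 1 ℕ.* suc b-1  ≡⟨ cong (ℕ._* suc b-1) (ℕₚ.*-identityʳ (suc k)) ⟩
      M                        <⟨ ℕₚ.n<1+n M ⟩
      suc M                    ≡⟨ sym (ℕₚ.*-identityˡ (suc M)) ⟩
      1 ℕ.* suc M              ≤⟨ ℕₚ.m≤n*m (1 ℕ.* suc M) (suc a) ⟩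
      suc a ℕ.* (1 ℕ.* suc M)  ∎
      where open ℕₚ.≤-Reasoning
  archimedean k (ℚ.mkℚ (+ 0) _ _)      0<ε with ℚₚ.drop-*<* 0<ε
  ... | ℤ.+<+ ()
  archimedean k (ℚ.mkℚ ℤ.-[1+ _ ] _ _) 0<ε with ℚₚ.drop-*<* 0<ε
  ... | ()

  within : ∀ {s β x y} → s ℚ.≤ x → x ℚ.≤ s ℚ.+ β → s ℚ.≤ y → y ℚ.≤ s ℚ.+ β → ℚ.∣ x ℚ.- y ∣ ℚ.≤ β
  within {s} {β} {x} {y} s≤x x≤ s≤y y≤ = ∣-∣-≤ (difference x≤ s≤y)
    (subst (ℚ._≤ β) (solve 2 (λ x y → y :- x := :- (x :- y)) refl x y) (difference y≤ s≤x))
    where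
    difference : ∀ {u v} → u ℚ.≤ s ℚ.+ β → s ℚ.≤ v → u ℚ.- v ℚ.≤ β
    difference {u} {v} u≤ s≤v = subst (u ℚ.- v ℚ.≤_)
      (solve 2 (λ s β → (s :+ β) :- s := β) refl s β)
      (ℚₚ.+-mono-≤ u≤ (ℚₚ.neg-antimono-≤ s≤v))

module _ (k : ℕ) where
  private
    ν r : ℚ
    ν = + suc k ℚ./ 1
    r = 1ℚ ℚ.- recip k

    S : ℕ → ℚ
    S = mercator r

    ν*recip : ν ℚ.* recip k ≡ 1ℚ
    ν*recip = ℚₚ.toℚᵘ-injective (ℚᵘₚ.≃-trans
      (ℚₚ.toℚᵘ-homo-* ν (recip k))
      (ℚᵘₚ.≃-trans (ℚᵘₚ.*-cong (toℚᵘ-/ (+ suc k) 0) (toℚᵘ-/ (+ 1) k))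
        (ℚᵘ.*≡* (cong +_ (trans (ℕₚ.*-identityʳ (suc k ℕ.* 1))
          (trans (ℕₚ.*-comm (suc k) 1) (sym (ℕₚ.*-identityˡ (1 ℕ.* suc k)))))))))

    0≤r : 0ℚ ℚ.≤ r
    0≤r = subst (ℚ._≤ r) (ℚₚ.+-inverseʳ (recip 0))
            (ℚₚ.+-monoʳ-≤ 1ℚ (ℚₚ.neg-antimono-≤ (recip-anti {0} {k} ℕ.z≤n)))

    r≤1 : r ℚ.≤ 1ℚ
    r≤1 = subst (r ℚ.≤_) (ℚₚ.+-identityʳ 1ℚ)
            (ℚₚ.+-monoʳ-≤ 1ℚ (ℚₚ.neg-antimono-≤ (0≤recip k)))

    instance
      r⁺ : ℚ.NonNegative r
      r⁺ = ℚ.nonNegative 0≤r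

    r^-nonNeg : ∀ m → ℚ.NonNegative (r ^ m)
    r^-nonNeg zero    = _
    r^-nonNeg (suc m) = ℚₚ.nonNeg*nonNeg⇒nonNeg r (r ^ m) {{r^-nonNeg m}}

    r^≤1 : ∀ m → r ^ m ℚ.≤ 1ℚ
    r^≤1 zero    = ℚₚ.≤-refl
    r^≤1 (suc m) = ℚₚ.≤-trans (ℚₚ.*-monoˡ-≤-nonNeg r (r^≤1 m))
                     (subst (ℚ._≤ 1ℚ) (sym (ℚₚ.*-identityʳ r)) r≤1)

    S-step : ∀ m → S m ℚ.≤ S (suc m)
    S-step m = subst (ℚ._≤ S (suc m)) (ℚₚ.+-identityʳ (S m))
      (ℚₚ.+-monoʳ-≤ (S m) (ℚₚ.nonNegative⁻¹ _
        {{ℚₚ.nonNeg*nonNeg⇒nonNeg (recip m) {{ℚ.nonNegative (0≤recip m)}} (r ^ suc m) {{r^-nonNeg (suc m)}}}}))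

    S-mono : ∀ M d → S M ℚ.≤ S (d ℕ.+ M)
    S-mono M zero    = ℚₚ.≤-refl
    S-mono M (suc d) = ℚₚ.≤-trans (S-mono M d) (S-step (d ℕ.+ M))

    -- Bounds the tail of the series after the M-th term, if M ≤ m.
    tail : ℕ → ℕ → ℚ
    tail M m = ν ℚ.* recip M ℚ.* r ^ suc m

    S+tail-step : ∀ M m → M ℕ.≤ m → S (suc m) ℚ.+ tail M (suc m) ℚ.≤ S m ℚ.+ tail M m
    S+tail-step M m M≤m = begin
      (S m ℚ.+ recip m ℚ.* r ^ suc m) ℚ.+ tail M (suc m)
        ≤⟨ ℚₚ.+-monoˡ-≤ (tail M (suc m)) (ℚₚ.+-monoʳ-≤ (S m)
             (ℚₚ.*-monoʳ-≤-nonNeg (r ^ suc m) {{r^-nonNeg (suc m)}} (recip-anti M≤m))) ⟩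
      (S m ℚ.+ recip M ℚ.* r ^ suc m) ℚ.+ tail M (suc m)
        ≡⟨ cong (λ z → (S m ℚ.+ z) ℚ.+ tail M (suc m))
             (trans (sym (ℚₚ.*-identityˡ _)) (cong (ℚ._* (recip M ℚ.* r ^ suc m)) (sym ν*recip))) ⟩
      (S m ℚ.+ ν ℚ.* recip k ℚ.* (recip M ℚ.* r ^ suc m)) ℚ.+ tail M (suc m)
        ≡⟨ solve 5 (λ s n i c q →
             (s :+ n :* i :* (c :* q)) :+ n :* c :* ((con 1ℚ :- i) :* q) := s :+ n :* c :* q)
             refl (S m) ν (recip k) (recip M) (r ^ suc m) ⟩
      S m ℚ.+ tail M m ∎
      where open ℚₚ.≤-Reasoning

    S+tail-anti : ∀ M d → S (d ℕ.+ M) ℚ.+ tail M (d ℕ.+ M) ℚ.≤ S M ℚ.+ tail M M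
    S+tail-anti M zero    = ℚₚ.≤-refl
    S+tail-anti M (suc d) = ℚₚ.≤-trans (S+tail-step M (d ℕ.+ M) (ℕₚ.m≤n+m M d)) (S+tail-anti M d)

    ν*recip-nonNeg : ∀ M → ℚ.NonNegative (ν ℚ.* recip M)
    ν*recip-nonNeg M = ℚₚ.nonNeg*nonNeg⇒nonNeg ν {{ℚₚ.normalize-nonNeg (suc k) 1}}
                         (recip M) {{ℚ.nonNegative (0≤recip M)}}

    S-upper : ∀ M d → S (d ℕ.+ M) ℚ.≤ S M ℚ.+ ν ℚ.* recip M
    S-upper M d = begin
      S (d ℕ.+ M)
        ≡⟨ sym (ℚₚ.+-identityʳ _) ⟩
      S (d ℕ.+ M) ℚ.+ 0ℚ
        ≤⟨ ℚₚ.+-monoʳ-≤ (S (d ℕ.+ M)) (ℚₚ.nonNegative⁻¹ _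
             {{ℚₚ.nonNeg*nonNeg⇒nonNeg (ν ℚ.* recip M) {{ν*recip-nonNeg M}} (r ^ suc (d ℕ.+ M)) {{r^-nonNeg (suc (d ℕ.+ M))}}}}) ⟩
      S (d ℕ.+ M) ℚ.+ tail M (d ℕ.+ M)
        ≤⟨ S+tail-anti M d ⟩
      S M ℚ.+ tail M M
        ≤⟨ ℚₚ.+-monoʳ-≤ (S M) (ℚₚ.*-monoˡ-≤-nonNeg (ν ℚ.* recip M) {{ν*recip-nonNeg M}} (r^≤1 (suc M))) ⟩
      S M ℚ.+ ν ℚ.* recip M ℚ.* 1ℚ
        ≡⟨ cong (S M ℚ.+_) (ℚₚ.*-identityʳ _) ⟩
      S M ℚ.+ ν ℚ.* recip M ∎
      where open ℚₚ.≤-Reasoning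

    lower : ∀ {M m} → M ℕ.≤ m → S M ℚ.≤ S m
    lower {M} {m} M≤m = subst (λ i → S M ℚ.≤ S i) (ℕₚ.m∸n+n≡m M≤m) (S-mono M (m ℕ.∸ M))

    upper : ∀ {M m} → M ℕ.≤ m → S m ℚ.≤ S M ℚ.+ ν ℚ.* recip M
    upper {M} {m} M≤m = subst (λ i → S i ℚ.≤ S M ℚ.+ ν ℚ.* recip M) (ℕₚ.m∸n+n≡m M≤m) (S-upper M (m ℕ.∸ M))

  -- log (k + 1) = - log (1 - r) = Σ_{j ≥ 1} r^j / j  with  r = 1 - 1 / (k + 1).
  log-suc : ℝ
  log-suc = mkℝ (mercator (1ℚ ℚ.- recip k)) λ ε 0<ε →
    let (M , p) = archimedean k ε 0<ε
    in M , λ m n M≤m M≤n →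
      ℚₚ.≤-<-trans (within {S M} (lower M≤m) (upper M≤m) (lower M≤n) (upper M≤n)) p

-- The value at 0 is a convention.
log : ℕ → ℝ
log zero    = 0ℝ
log (suc k) = log-suc k

------------------------------------------------------------------------
-- Graphs and global rigidity

record SimpleGraph (V : Set) : Set₁ where
  field
    Adj       : V → V → Set
    symmetric : Symmetric Adj
    loopless  : ∀ {x} → ¬ Adj x x
open SimpleGraph public

_[_] : ∀ {n} → SimpleGraph (Fin n) → (V′ : Subset n) → SimpleGraph (∃[ x ] x ∈ V′)
G [ V′ ] = record
  { Adj       = λ x y → Adj G (proj₁ x) (proj₁ y)
  ; symmetric = symmetric G
  ; loopless  = loopless G
  }

GloballyRigid : ∀ {V} → SimpleGraph V → Set
GloballyRigid {V} H =
  ∀ (f g : V → ℝ) → Injective _≡_ _≃_ f → Injective _≡_ _≃_ g →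
  (∀ x y → Adj H x y → ∣ f x - f y ∣ ≃ ∣ g x - g y ∣) →
  (∀ x y → ∣ f x - f y ∣ ≃ ∣ g x - g y ∣)

------------------------------------------------------------------------
-- Finite probability distributions

-- Outcomes with their weights.
Dist : Set → Set
Dist A = List (A × ℝ)

ℙ : ∀ {A} → Dist A → (A → Bool) → ℝ
ℙ μ E = foldr (λ (a , w) s → (if E a then w else 0ℝ) + s) 0ℝ μ

_⟶_ : (ℕ → ℝ) → ℝ → Set
x ⟶ l = ∀ ε → 0ℝ < ε → ∃[ N ] (∀ n → N ℕ.≤ n → ∣ x n - l ∣ < ε)

-- A property of outcomes need not be decidable constructively, so "P holds with
-- probability tending to 1" asks for decidable events E n, contained in P n, whose
-- probabilities tend to 1.  When P is decidable, one may take E n to be P n itself.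
WithHighProbability : {A : ℕ → Set} → (∀ n → Dist (A n)) → (∀ n → A n → Set) → Set
WithHighProbability {A} μ P =
  Σ[ E ∈ (∀ n → A n → Bool) ]
    (∀ n a → T (E n a) → P n a) × (λ n → ℙ (μ n) (E n)) ⟶ 1ℝ

-- Each element of the list is kept independently with probability p.
randomSublist : {A : Set} → ℝ → List A → Dist (List A)
randomSublist p []       = ([] , 1ℝ) ∷ []
randomSublist p (x ∷ xs) =
  map (λ (s , w) → x ∷ s , p * w) μ ++ map (λ (s , w) → s , (1ℝ - p) * w) μ
  where μ = randomSublist p xs

EdgeList : ℕ → Set
EdgeList n = List (Fin n × Fin n)

pairs : ∀ n → EdgeList n
pairs n = filter (λ (i , j) → i Fin.<? j) (cartesianProduct (allFin n) (allFin n))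

graph : ∀ {n} → EdgeList n → SimpleGraph (Fin n)
graph es = record
  { Adj       = λ i j → i ≢ j × ((i , j) ∈ₗ es ⊎ (j , i) ∈ₗ es)
  ; symmetric = λ (i≢j , e) → i≢j ∘ sym , swap e
  ; loopless  = λ (i≢i , _) → i≢i refl
  }

-- The distribution of the edge set of the random graph G(n , p).
𝔾 : ∀ n → ℝ → Dist (EdgeList n)
𝔾 n p = randomSublist p (pairs n)

-- If (π, σ) separates the vertices of H, every edge of H preserves π or σ, and some two vertices differ in
-- both, then 5π + σ and 5π - σ show that H is not globally rigid.  Hence in a globally rigid G[V′] with at
-- least 4 vertices all degrees are at least 2, and both neighbours of a vertex of degree 2 have degree at
-- least 3.  The vertices of degree at least 3 form a nonempty set, a core, each vertex of which lies on at
-- least 3 links; a link is an edge inside the core or a path of length 2 through a vertex outside it.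
-- Since log n ≥ 1/2 for n ≥ 2, it suffices to take γ = 8 and to show that w.h.p. there is no core.
--
-- The expected number of cores is o(1) for p = 1.1/n.  For cores of size r, the ordered sequences of s links
-- are counted by the words of length 2s over the core in which every letter occurs at least 3 times.  This
-- leads to the sum over s of y^s s! [t^(2s)] (e^t - 1 - t - t²/2)^r, where y/2 is the probability of a link:
-- the functional u^s ↦ y^s s! (an exponential variable u = t²) applied to an r-th power.  Majorising
-- e^t - 1 - t - t²/2 by a u e^(b u), which this functional integrates in closed form, gives the bound
-- (a y)^r r! / (1 - b r y)^(r + 1).  With a fixed pair (a, b) this beats the number of sets of size r when r is
-- linear in n; with a = 1/k, b = k² and k large, it makes the contribution of the smaller r at most O(1/k).

module Submission where

open import Data.Bool using (Bool; true; false; if_then_else_; _∨_; T)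
import Data.Bool.Properties as Boolₚ
open import Data.Empty using (⊥; ⊥-elim)
open import Data.Fin as Fin using (Fin; toℕ)
import Data.Fin.Properties as Finₚ
import Data.Integer as ℤ
import Data.Integer.Properties as ℤₚ
open import Data.List using (List; []; _∷_; _++_; map; length; filter; allFin; cartesianProduct)
import Data.List.Properties as Listₚ
open import Data.List.Relation.Unary.All as All using (All; []; _∷_)
import Data.List.Relation.Unary.All.Properties as Allₚ
open import Data.List.Relation.Unary.AllPairs as AllPairs using ([]; _∷_; AllPairs)
import Data.List.Relation.Unary.AllPairs.Properties as AllPairsₚ
open import Data.List.Relation.Unary.Unique.Propositional using (Unique)
import Data.List.Relation.Unary.Unique.Propositional.Properties as Uniqueₚ
open import Data.Nat as ℕ using (ℕ; zero; suc)
import Data.Nat.Properties as ℕₚ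
import Data.Nat.Solver as ℕ-Solver
open import Data.Product using (∃-syntax; _×_; _,_; proj₁; proj₂)
open import Data.Product.Properties using (≡-dec)
open import Data.Rational as ℚ using (ℚ; 0ℚ; ½; 1ℚ)
import Data.Rational.Properties as ℚₚ
import Data.Rational.Unnormalised as ℚᵘ
import Data.Rational.Unnormalised.Properties as ℚᵘₚ
open import Data.Sum using (inj₁; inj₂; _⊎_)
import Defs
open import Function using (_∘_)
open import Relation.Binary.Definitions using (DecidableEquality; tri<; tri≈; tri>)
open import Relation.Binary.PropositionalEquality hiding ([_])
open import Relation.Nullary using (yes; no; contradiction; ¬_; does; Dec; ¬?; _×-dec_; isYes; toWitness)
open import Relation.Unary using (Decidable)

-- Since 1.1 exceeds 1, the graph has w.h.p. a 2-core of linear size, so minimum degree 2 alone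
-- excludes nothing; a first moment can only exploit the further condition that no two vertices of
-- degree 2 are adjacent. Even so it is delicate for linear sizes. Besides n^r one needs a gain 1 -
-- 1/n per pair when counting the sets of size r, and a gain 1 - q per pair from absent edges, q =
-- 1.1/n. At size ρ n these are worth about e^(1.05 ρ) per core vertex, and (a, b) = (0.19, 0.34) is
-- tuned to win by a factor 49/50 per vertex for every ρ in [0, 1]. With any fixed pair the bound
-- for a given r tends to a positive constant as n grows, which is why a has to be sent to 0 for the
-- smaller cores. Probabilities are Cauchy sequences here, and the approximations of p may leave
-- [0, 1]. The estimate is therefore made for rational p and carried over to real p by Lipschitz
-- continuity for fixed n; the decidable event witnessing the claim is that a rational overcount of
-- the cores is below 1.

module Rationals where

  open import Defs using (recip; _^_) public
  open import Data.Rational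
  open import Data.Rational.Properties
  open import Data.Rational.Solver using (module +-*-Solver)
  open +-*-Solver using (solve; con; _:+_; _:*_; _:-_; :-_; _:=_)

  infixr 5 _+⁰_
  infixr 6 _*⁰_

  _+⁰_ : ∀ {p q} → 0ℚ ≤ p → 0ℚ ≤ q → 0ℚ ≤ p + q
  _+⁰_ = +-mono-≤

  _*⁰_ : ∀ {p q} → 0ℚ ≤ p → 0ℚ ≤ q → 0ℚ ≤ p * q
  _*⁰_ {p} {q} 0≤p 0≤q = nonNegative⁻¹ _
    {{nonNeg*nonNeg⇒nonNeg p {{nonNegative 0≤p}} q {{nonNegative 0≤q}}}}

  0≤0 : 0ℚ ≤ 0ℚ
  0≤0 = ≤-refl

  0≤1 : 0ℚ ≤ 1ℚ
  0≤1 = nonNegative⁻¹ 1ℚ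

  0≤½ : 0ℚ ≤ ½
  0≤½ = nonNegative⁻¹ ½

  square-nonNeg : ∀ p → 0ℚ ≤ p * p
  square-nonNeg p with ≤-total 0ℚ p
  ... | inj₁ 0≤p = 0≤p *⁰ 0≤p
  ... | inj₂ p≤0 = subst (0ℚ ≤_)
    (solve 1 (λ p → (:- p) :* (:- p) := p :* p) refl p)
    (neg-antimono-≤ p≤0 *⁰ neg-antimono-≤ p≤0)

  -- The form of most estimates below: the ring solver confirms an identity that exhibits the slack
  -- `s`, and the slack is visibly nonnegative.
  ≤-by : ∀ {p q s} → q ≡ p + s → 0ℚ ≤ s → p ≤ q
  ≤-by {p} {q} {s} q≡p+s 0≤s = subst₂ _≤_ (+-identityʳ p) (sym q≡p+s) (+-monoʳ-≤ p 0≤s)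

  0≤- : ∀ {p q} → p ≤ q → 0ℚ ≤ q - p
  0≤- {p} {q} p≤q = subst (_≤ q - p) (+-inverseʳ p) (+-monoˡ-≤ (- p) p≤q)

  0≤-⇒≤ : ∀ {p q} → 0ℚ ≤ q - p → p ≤ q
  0≤-⇒≤ {p} {q} = ≤-by (solve 2 (λ p q → q := p :+ (q :- p)) refl p q)

  *-monoˡ : ∀ {r p q} → 0ℚ ≤ r → p ≤ q → r * p ≤ r * q
  *-monoˡ {r} 0≤r = *-monoˡ-≤-nonNeg r {{nonNegative 0≤r}}

  *-monoʳ : ∀ {r p q} → 0ℚ ≤ r → p ≤ q → p * r ≤ q * r
  *-monoʳ {r} 0≤r = *-monoʳ-≤-nonNeg r {{nonNegative 0≤r}}

  *-mono : ∀ {p q r s} → 0ℚ ≤ p → 0ℚ ≤ s → p ≤ q → r ≤ s → p * r ≤ q * s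
  *-mono 0≤p 0≤s p≤q r≤s = ≤-trans (*-monoˡ 0≤p r≤s) (*-monoʳ 0≤s p≤q)

  -- Inverses usually enter as a factor `i` with an equation `i * j ≡ 1ℚ`, so that the solver can
  -- treat them as ordinary variables.
  ≤-divide : ∀ {i j p q} → 0ℚ ≤ i → i * j ≡ 1ℚ → j * p ≤ q → p ≤ i * q
  ≤-divide {i} {j} {p} {q} 0≤i ij≡1 jp≤q = subst (_≤ i * q)
    (trans (sym (*-assoc i j p)) (trans (cong (_* p) ij≡1) (*-identityˡ p)))
    (*-monoˡ 0≤i jp≤q)

  ι : ℕ → ℚ
  ι n = ℤ.+ n / 1

  toℚᵘ-/ : ∀ i m → toℚᵘ (i / suc m) ℚᵘ.≃ ℚᵘ.mkℚᵘ i m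
  toℚᵘ-/ i m = toℚᵘ-fromℚᵘ (ℚᵘ.mkℚᵘ i m)

  /-≡ : ∀ {i m p} → ℚᵘ.mkℚᵘ i m ℚᵘ.≃ toℚᵘ p → i / suc m ≡ p
  /-≡ {i} {m} e = toℚᵘ-injective (ℚᵘₚ.≃-trans (toℚᵘ-/ i m) e)

  ι-+ : ∀ m n → ι (m ℕ.+ n) ≡ ι m + ι n
  ι-+ m n = /-≡ {ℤ.+ (m ℕ.+ n)} {0} (ℚᵘₚ.≃-sym (ℚᵘₚ.≃-trans (toℚᵘ-homo-+ (ι m) (ι n))
    (ℚᵘₚ.≃-trans (ℚᵘₚ.+-cong (toℚᵘ-/ (ℤ.+ m) 0) (toℚᵘ-/ (ℤ.+ n) 0))
      (ℚᵘ.*≡* (cong (ℤ._* ℤ.+ 1) (cong₂ ℤ._+_ (ℤₚ.*-identityʳ (ℤ.+ m)) (ℤₚ.*-identityʳ (ℤ.+ n))))))))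

  ι-suc : ∀ n → ι (suc n) ≡ 1ℚ + ι n
  ι-suc = ι-+ 1

  ι-* : ∀ m n → ι (m ℕ.* n) ≡ ι m * ι n
  ι-* zero    n = sym (*-zeroˡ (ι n))
  ι-* (suc m) n = begin
    ι (n ℕ.+ m ℕ.* n)     ≡⟨ ι-+ n (m ℕ.* n) ⟩
    ι n + ι (m ℕ.* n)     ≡⟨ cong (ι n +_) (ι-* m n) ⟩
    ι n + ι m * ι n       ≡⟨ solve 2 (λ m n → n :+ m :* n := (con 1ℚ :+ m) :* n) refl (ι m) (ι n) ⟩
    (1ℚ + ι m) * ι n      ≡⟨ cong (_* ι n) (sym (ι-suc m)) ⟩
    ι (suc m) * ι n       ∎
    where open ≡-Reasoning

  0≤ι : ∀ n → 0ℚ ≤ ι n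
  0≤ι n = nonNegative⁻¹ _ {{normalize-nonNeg n 1}}

  ι-mono : ∀ {m n} → m ℕ.≤ n → ι m ≤ ι n
  ι-mono {m} {n} m≤n = subst (λ k → ι m ≤ ι k) (ℕₚ.m+[n∸m]≡n m≤n)
    (≤-by (ι-+ m (n ℕ.∸ m)) (0≤ι (n ℕ.∸ m)))

  0≤recip : ∀ m → 0ℚ ≤ recip m
  0≤recip m = nonNegative⁻¹ _ {{normalize-nonNeg 1 (suc m)}}

  ι*recip : ∀ m → ι (suc m) * recip m ≡ 1ℚ
  ι*recip m = toℚᵘ-injective (ℚᵘₚ.≃-trans
    (toℚᵘ-homo-* (ι (suc m)) (recip m))
    (ℚᵘₚ.≃-trans (ℚᵘₚ.*-cong (toℚᵘ-/ (ℤ.+ suc m) 0) (toℚᵘ-/ (ℤ.+ 1) m))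
      (ℚᵘ.*≡* (cong ℤ.+_ (trans (ℕₚ.*-identityʳ (suc m ℕ.* 1))
        (trans (ℕₚ.*-comm (suc m) 1) (sym (ℕₚ.*-identityˡ (1 ℕ.* suc m)))))))))

  recip*ι : ∀ m → recip m * ι (suc m) ≡ 1ℚ
  recip*ι m = trans (*-comm (recip m) _) (ι*recip m)

  0≤^ : ∀ {p} n → 0ℚ ≤ p → 0ℚ ≤ p ^ n
  0≤^ zero    0≤p = 0≤1
  0≤^ (suc n) 0≤p = 0≤p *⁰ 0≤^ n 0≤p

  ^-mono : ∀ {p q} n → 0ℚ ≤ p → p ≤ q → p ^ n ≤ q ^ n
  ^-mono zero    0≤p p≤q = ≤-refl
  ^-mono (suc n) 0≤p p≤q = *-mono 0≤p (0≤^ n (≤-trans 0≤p p≤q)) p≤q (^-mono n 0≤p p≤q)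

  ^-*-distrib : ∀ p q n → (p * q) ^ n ≡ p ^ n * q ^ n
  ^-*-distrib p q zero    = refl
  ^-*-distrib p q (suc n) = trans (cong (p * q *_) (^-*-distrib p q n))
    (solve 4 (λ p q a b → p :* q :* (a :* b) := p :* a :* (q :* b)) refl p q (p ^ n) (q ^ n))

  ^-+ : ∀ p m n → p ^ (m ℕ.+ n) ≡ p ^ m * p ^ n
  ^-+ p zero    n = sym (*-identityˡ _)
  ^-+ p (suc m) n = trans (cong (p *_) (^-+ p m n)) (sym (*-assoc p (p ^ m) (p ^ n)))

  ^-≤1 : ∀ {p} n → 0ℚ ≤ p → p ≤ 1ℚ → p ^ n ≤ 1ℚ
  ^-≤1 zero    0≤p p≤1 = ≤-refl
  ^-≤1 (suc n) 0≤p p≤1 = ≤-trans (*-mono 0≤p 0≤1 p≤1 (^-≤1 n 0≤p p≤1)) (≤-reflexive (*-identityˡ 1ℚ))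

  1^ : ∀ n → 1ℚ ^ n ≡ 1ℚ
  1^ zero    = refl
  1^ (suc n) = trans (*-identityˡ _) (1^ n)

  -- Finite sums

  ∑ : {A : Set} → List A → (A → ℚ) → ℚ
  ∑ []       f = 0ℚ
  ∑ (x ∷ xs) f = f x + ∑ xs f

  module _ {A : Set} where

    ∑-cong : ∀ xs {f g : A → ℚ} → (∀ x → f x ≡ g x) → ∑ xs f ≡ ∑ xs g
    ∑-cong []       f≗g = refl
    ∑-cong (x ∷ xs) f≗g = cong₂ _+_ (f≗g x) (∑-cong xs f≗g)

    ∑-mono : ∀ xs {f g : A → ℚ} → (∀ x → f x ≤ g x) → ∑ xs f ≤ ∑ xs g
    ∑-mono []       f≤g = ≤-refl
    ∑-mono (x ∷ xs) f≤g = +-mono-≤ (f≤g x) (∑-mono xs f≤g)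

    0≤∑ : ∀ xs {f : A → ℚ} → (∀ x → 0ℚ ≤ f x) → 0ℚ ≤ ∑ xs f
    0≤∑ []       0≤f = 0≤0
    0≤∑ (x ∷ xs) 0≤f = 0≤f x +⁰ 0≤∑ xs 0≤f

    ∑-+ : ∀ xs (f g : A → ℚ) → ∑ xs (λ x → f x + g x) ≡ ∑ xs f + ∑ xs g
    ∑-+ []       f g = refl
    ∑-+ (x ∷ xs) f g = trans (cong (f x + g x +_) (∑-+ xs f g))
      (solve 4 (λ a b c d → a :+ b :+ (c :+ d) := a :+ c :+ (b :+ d)) refl (f x) (g x) (∑ xs f) (∑ xs g))

    ∑-*ˡ : ∀ xs c (f : A → ℚ) → ∑ xs (λ x → c * f x) ≡ c * ∑ xs f
    ∑-*ˡ []       c f = sym (*-zeroʳ c)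
    ∑-*ˡ (x ∷ xs) c f = trans (cong (c * f x +_) (∑-*ˡ xs c f)) (sym (*-distribˡ-+ c (f x) (∑ xs f)))

    ∑-0 : ∀ xs → ∑ {A} xs (λ _ → 0ℚ) ≡ 0ℚ
    ∑-0 []       = refl
    ∑-0 (x ∷ xs) = trans (+-identityˡ _) (∑-0 xs)

    ∑-++ : ∀ xs ys (f : A → ℚ) → ∑ (xs ++ ys) f ≡ ∑ xs f + ∑ ys f
    ∑-++ []       ys f = sym (+-identityˡ _)
    ∑-++ (x ∷ xs) ys f = trans (cong (f x +_) (∑-++ xs ys f)) (sym (+-assoc (f x) _ _))

  ∑-map : ∀ {A B : Set} (h : A → B) xs (f : B → ℚ) → ∑ (map h xs) f ≡ ∑ xs (f ∘ h)
  ∑-map h []       f = refl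
  ∑-map h (x ∷ xs) f = cong (f (h x) +_) (∑-map h xs f)

  ∑-swap : ∀ {A B : Set} (xs : List A) (ys : List B) (f : A → B → ℚ) →
    ∑ xs (λ x → ∑ ys (f x)) ≡ ∑ ys (λ y → ∑ xs (λ x → f x y))
  ∑-swap []       ys f = sym (∑-0 ys)
  ∑-swap (x ∷ xs) ys f = trans (cong (∑ ys (f x) +_) (∑-swap xs ys f)) (sym (∑-+ ys (f x) _))

  ∑< : ℕ → (ℕ → ℚ) → ℚ
  ∑< zero    f = 0ℚ
  ∑< (suc n) f = f 0 + ∑< n (f ∘ suc)

  ∑<-cong : ∀ n {f g} → (∀ i → f i ≡ g i) → ∑< n f ≡ ∑< n g
  ∑<-cong zero    f≗g = refl
  ∑<-cong (suc n) f≗g = cong₂ _+_ (f≗g 0) (∑<-cong n (f≗g ∘ suc))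

  ∑<-mono : ∀ n {f g} → (∀ i → f i ≤ g i) → ∑< n f ≤ ∑< n g
  ∑<-mono zero    f≤g = ≤-refl
  ∑<-mono (suc n) f≤g = +-mono-≤ (f≤g 0) (∑<-mono n (f≤g ∘ suc))

  0≤∑< : ∀ n {f} → (∀ i → 0ℚ ≤ f i) → 0ℚ ≤ ∑< n f
  0≤∑< zero    0≤f = 0≤0
  0≤∑< (suc n) 0≤f = 0≤f 0 +⁰ 0≤∑< n (0≤f ∘ suc)

  ∑<-+ : ∀ n f g → ∑< n (λ i → f i + g i) ≡ ∑< n f + ∑< n g
  ∑<-+ zero    f g = refl
  ∑<-+ (suc n) f g = trans (cong (f 0 + g 0 +_) (∑<-+ n (f ∘ suc) (g ∘ suc)))
    (solve 4 (λ a b c d → a :+ b :+ (c :+ d) := a :+ c :+ (b :+ d)) refl (f 0) (g 0) (∑< n (f ∘ suc)) (∑< n (g ∘ suc)))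

  ∑<-*ˡ : ∀ n c f → ∑< n (λ i → c * f i) ≡ c * ∑< n f
  ∑<-*ˡ zero    c f = sym (*-zeroʳ c)
  ∑<-*ˡ (suc n) c f = trans (cong (c * f 0 +_) (∑<-*ˡ n c (f ∘ suc))) (sym (*-distribˡ-+ c (f 0) (∑< n (f ∘ suc))))

  ∑<-last : ∀ n f → ∑< (suc n) f ≡ ∑< n f + f n
  ∑<-last zero    f = +-comm (f 0) 0ℚ
  ∑<-last (suc n) f = trans (cong (f 0 +_) (∑<-last n (f ∘ suc))) (sym (+-assoc (f 0) _ _))

  ∑<-widen : ∀ n f → (∀ i → 0ℚ ≤ f i) → ∑< n f ≤ ∑< (suc n) f
  ∑<-widen n f 0≤f = ≤-by (∑<-last n f) (0≤f n)

-- Factorials and the series of m! / (1 - x)^(m + 1)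

module FactorialSeries where

  open Rationals
  open import Data.Rational
  open import Data.Rational.Properties
  open import Data.Rational.Solver using (module +-*-Solver)
  open +-*-Solver using (solve; con; _:+_; _:*_; _:-_; :-_; _:=_)

  fac : ℕ → ℚ
  fac zero    = 1ℚ
  fac (suc n) = ι (suc n) * fac n

  1/fac : ℕ → ℚ
  1/fac zero    = 1ℚ
  1/fac (suc n) = recip n * 1/fac n

  0≤fac : ∀ n → 0ℚ ≤ fac n
  0≤fac zero    = 0≤1
  0≤fac (suc n) = 0≤ι (suc n) *⁰ 0≤fac n

  0≤1/fac : ∀ n → 0ℚ ≤ 1/fac n
  0≤1/fac zero    = 0≤1
  0≤1/fac (suc n) = 0≤recip n *⁰ 0≤1/fac n

  ι*1/fac : ∀ n → ι (suc n) * 1/fac (suc n) ≡ 1/fac n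
  ι*1/fac n = trans (sym (*-assoc (ι (suc n)) (recip n) (1/fac n)))
    (trans (cong (_* 1/fac n) (ι*recip n)) (*-identityˡ _))

  fac*1/fac : ∀ n → fac n * 1/fac n ≡ 1ℚ
  fac*1/fac zero    = refl
  fac*1/fac (suc n) = begin
    ι (suc n) * fac n * (recip n * 1/fac n)
      ≡⟨ solve 4 (λ i f r g → i :* f :* (r :* g) := (i :* r) :* (f :* g)) refl (ι (suc n)) (fac n) (recip n) (1/fac n) ⟩
    (ι (suc n) * recip n) * (fac n * 1/fac n)
      ≡⟨ cong₂ _*_ (ι*recip n) (fac*1/fac n) ⟩
    1ℚ * 1ℚ
      ∎
    where open ≡-Reasoning

  recip-anti : ∀ {m n} → m ℕ.≤ n → recip n ≤ recip m
  recip-anti {m} {n} m≤n = subst₂ _≤_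
    (trans (cong (recip n *_) (ι*recip m)) (*-identityʳ _))
    (trans (cong (recip n *_) (*-comm (ι (suc n)) (recip m)))
      (trans (solve 3 (λ a b c → a :* (b :* c) := b :* (c :* a)) refl (recip n) (recip m) (ι (suc n)))
        (trans (cong (recip m *_) (ι*recip n)) (*-identityʳ _))))
    (*-monoˡ (0≤recip n) (*-monoʳ (0≤recip m) (ι-mono (ℕ.s≤s m≤n))))

  -- The series Σᵢ ((i + m)! / i!) xⁱ = m! / (1 - x)^(m + 1)

  rising : ℕ → ℕ → ℚ
  rising m i = fac (i ℕ.+ m) * 1/fac i

  0≤rising : ∀ m i → 0ℚ ≤ rising m i
  0≤rising m i = 0≤fac (i ℕ.+ m) *⁰ 0≤1/fac i

  -- The top factor i + m + 2 splits as (i + 1) + (m + 1). For the generating functions this says (1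
  -- - x) S (m + 1) = (m + 1) S m.
  rising-pascal : ∀ m i → rising (suc m) (suc i) ≡ rising (suc m) i + ι (suc m) * rising m (suc i)
  rising-pascal m i = begin
    fac (suc (i ℕ.+ suc m)) * 1/fac (suc i)
      ≡⟨ cong (λ k → fac (suc k) * 1/fac (suc i)) (ℕₚ.+-suc i m) ⟩
    ι (suc (suc (i ℕ.+ m))) * fac (suc (i ℕ.+ m)) * 1/fac (suc i)
      ≡⟨ cong (λ k → k * fac (suc (i ℕ.+ m)) * 1/fac (suc i))
           (trans (cong ι (cong suc (sym (ℕₚ.+-suc i m)))) (ι-+ (suc i) (suc m))) ⟩
    (ι (suc i) + ι (suc m)) * fac (suc (i ℕ.+ m)) * 1/fac (suc i)
      ≡⟨ solve 4 (λ i m f g → (i :+ m) :* f :* g := f :* (i :* g) :+ m :* (f :* g)) refl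
           (ι (suc i)) (ι (suc m)) (fac (suc (i ℕ.+ m))) (1/fac (suc i)) ⟩
    fac (suc (i ℕ.+ m)) * (ι (suc i) * 1/fac (suc i)) + ι (suc m) * rising m (suc i)
      ≡⟨ cong (_+ ι (suc m) * rising m (suc i)) (cong₂ _*_ (cong fac (sym (ℕₚ.+-suc i m))) (ι*1/fac i)) ⟩
    rising (suc m) i + ι (suc m) * rising m (suc i)
      ∎
    where open ≡-Reasoning

  rising-zero : ∀ m → rising (suc m) 0 ≡ ι (suc m) * rising m 0
  rising-zero m = *-assoc (ι (suc m)) (fac m) 1ℚ

  module GeometricSeries {x j : ℚ} (0≤x : 0ℚ ≤ x) (0≤j : 0ℚ ≤ j) (j*[1-x] : j * (1ℚ - x) ≡ 1ℚ) where

    -- Multiplication by x shifts a partial sum by one place, and the shifted sum is at most the sum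
    -- itself. Each recurrence thus has the same partial sum `s` on both sides, and `j` = 1/(1 - x)
    -- solves for it.
    absorb : ∀ {s t} → s ≤ t + x * s → s ≤ j * t
    absorb {s} {t} s≤t+xs = ≤-divide 0≤j j*[1-x] (0≤-⇒≤ (subst (0ℚ ≤_)
      (solve 3 (λ s t x → t :+ x :* s :- s := t :- (con 1ℚ :- x) :* s) refl s t x) (0≤- s≤t+xs)))

    private
      term : ℕ → ℕ → ℚ
      term m i = rising m i * x ^ i

      0≤term : ∀ m i → 0ℚ ≤ term m i
      0≤term m i = 0≤rising m i *⁰ 0≤^ i 0≤x

      recurrence : ∀ m I → ∑< I (term (suc m)) ≤ ι (suc m) * ∑< I (term m) + x * ∑< I (term (suc m))
      recurrence m zero    = ≤-reflexive (solve 2 (λ i x → con 0ℚ := i :* con 0ℚ :+ x :* con 0ℚ) refl (ι (suc m)) x)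
      recurrence m (suc I) = begin
        term (suc m) 0 + ∑< I (term (suc m) ∘ suc)
          ≡⟨ cong₂ _+_ (trans (cong (_* 1ℚ) (rising-zero m)) (*-assoc (ι (suc m)) (rising m 0) 1ℚ))
               (trans (∑<-cong I step) (trans (∑<-+ I _ _) (cong₂ _+_ (∑<-*ˡ I (ι (suc m)) _) (∑<-*ˡ I x _)))) ⟩
        ι (suc m) * term m 0 + (ι (suc m) * ∑< I (term m ∘ suc) + x * ∑< I (term (suc m)))
          ≡⟨ solve 4 (λ c a b d → c :* a :+ (c :* b :+ d) := c :* (a :+ b) :+ d) refl
               (ι (suc m)) (term m 0) (∑< I (term m ∘ suc)) (x * ∑< I (term (suc m))) ⟩
        ι (suc m) * ∑< (suc I) (term m) + x * ∑< I (term (suc m))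
          ≤⟨ +-monoʳ-≤ (ι (suc m) * ∑< (suc I) (term m)) (*-monoˡ 0≤x (∑<-widen I (term (suc m)) (0≤term (suc m)))) ⟩
        ι (suc m) * ∑< (suc I) (term m) + x * ∑< (suc I) (term (suc m))
          ∎
        where
        open ≤-Reasoning
        step : ∀ i → term (suc m) (suc i) ≡ ι (suc m) * term m (suc i) + x * term (suc m) i
        step i = trans (cong (_* x ^ suc i) (rising-pascal m i))
          (solve 5 (λ r c r′ x p → (r :+ c :* r′) :* (x :* p) := c :* (r′ :* (x :* p)) :+ x :* (r :* p)) refl
            (rising (suc m) i) (ι (suc m)) (rising m (suc i)) x (x ^ i))

      geometric : ∀ I → ∑< I (term 0) ≤ 1ℚ + x * ∑< I (term 0)
      geometric zero    = ≤-by {s = 1ℚ} (solve 1 (λ x → con 1ℚ :+ x :* con 0ℚ := con 0ℚ :+ con 1ℚ) refl x) 0≤1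
      geometric (suc I) = +-mono-≤ (≤-refl {1ℚ}) (≤-trans
        (≤-reflexive (trans (∑<-cong I step) (∑<-*ˡ I x _)))
        (*-monoˡ 0≤x (∑<-widen I (term 0) (0≤term 0))))
        where
        one : ∀ i → rising 0 i ≡ 1ℚ
        one i = trans (cong (λ k → fac k * 1/fac i) (ℕₚ.+-identityʳ i)) (fac*1/fac i)
        step : ∀ i → term 0 (suc i) ≡ x * term 0 i
        step i = trans (cong (_* x ^ suc i) (trans (one (suc i)) (sym (one i))))
          (solve 3 (λ r x p → r :* (x :* p) := x :* (r :* p)) refl (rising 0 i) x (x ^ i))

    rising-series : ∀ m I → ∑< I (λ i → rising m i * x ^ i) ≤ fac m * j ^ suc m
    rising-series zero    I = ≤-trans (absorb (geometric I)) (≤-reflexive (sym (*-identityˡ (j * 1ℚ))))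
    rising-series (suc m) I = begin
      ∑< I (term (suc m))
        ≤⟨ absorb (recurrence m I) ⟩
      j * (ι (suc m) * ∑< I (term m))
        ≤⟨ *-monoˡ 0≤j (*-monoˡ (0≤ι (suc m)) (rising-series m I)) ⟩
      j * (ι (suc m) * (fac m * j ^ suc m))
        ≡⟨ solve 4 (λ j i f p → j :* (i :* (f :* p)) := i :* f :* (j :* p)) refl j (ι (suc m)) (fac m) (j ^ suc m) ⟩
      fac (suc m) * j ^ suc (suc m)
        ∎
      where open ≤-Reasoning

-- A majorant a u e^(b u), u = t², for e^t - 1 - t - t²/2

module EvenSeries where

  open Rationals
  open FactorialSeries
  open import Data.Rational
  open import Data.Rational.Properties
  open import Data.Rational.Solver using (module +-*-Solver)
  open +-*-Solver using (solve; con; _:+_; _:*_; _:-_; :-_; _:=_)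

  double : ℕ → ℕ
  double zero    = zero
  double (suc n) = suc (suc (double n))

  -- The values of a linear functional on 1, t, t², ..., with `ν` on the even and `ω` on the odd
  -- powers.
  interleave : (ℕ → ℚ) → (ℕ → ℚ) → ℕ → ℚ
  interleave ν ω zero          = ν 0
  interleave ν ω (suc zero)    = ω 0
  interleave ν ω (suc (suc j)) = interleave (ν ∘ suc) (ω ∘ suc) j

  -- The coefficients of e^t - 1 - t - t²/2.
  expTail₃ : ℕ → ℚ
  expTail₃ (suc (suc (suc j))) = 1/fac (suc (suc (suc j)))
  expTail₃ _                   = 0ℚ

  0≤expTail₃ : ∀ j → 0ℚ ≤ expTail₃ j
  0≤expTail₃ zero                = 0≤0
  0≤expTail₃ (suc zero)          = 0≤0
  0≤expTail₃ (suc (suc zero))    = 0≤0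
  0≤expTail₃ (suc (suc (suc j))) = 0≤1/fac (suc (suc (suc j)))

  module EvenMajorant
    {α β a b m δ : ℚ} (0≤α : 0ℚ ≤ α) (0≤β : 0ℚ ≤ β) (0≤a : 0ℚ ≤ a) (0≤b : 0ℚ ≤ b) (0≤δ : 0ℚ ≤ δ)
    where

    -- The coefficient of u^(k + 1) in a u e^(b u).
    B : ℕ → ℚ
    B k = a * (b ^ k * 1/fac k)

    0≤B : ∀ k → 0ℚ ≤ B k
    0≤B k = 0≤a *⁰ 0≤^ k 0≤b *⁰ 0≤1/fac k

    -- For odd n, what t^(n + 1) collects once every odd power t^(2i + 1) is replaced by (α t^(2i) +
    -- β t^(2i + 2))/2: the upper half of t^n, its own term and the lower half of t^(n + 2).
    coefficient : ℕ → ℚ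
    coefficient n = ½ * β * 1/fac n + 1/fac (suc n) + ½ * α * 1/fac (suc (suc n))

    -- The value of n! times `coefficient n` at n = 7, the largest one for n ≥ 7.
    κ : ℚ
    κ = ½ * β + recip 7 + ½ * α * (recip 8 * recip 7)

    coefficient≤κ : ∀ {n} → 7 ℕ.≤ n → coefficient n ≤ κ * 1/fac n
    coefficient≤κ {n} 7≤n = begin
      ½ * β * f + recip n * f + ½ * α * (recip (suc n) * (recip n * f))
        ≡⟨ solve 5 (λ x y r r′ f → x :* f :+ r :* f :+ y :* (r′ :* (r :* f)) := (x :+ r :+ y :* (r′ :* r)) :* f) refl
             (½ * β) (½ * α) (recip n) (recip (suc n)) f ⟩
      (½ * β + recip n + ½ * α * (recip (suc n) * recip n)) * f
        ≤⟨ *-monoʳ (0≤1/fac n) (+-mono-≤ (+-monoʳ-≤ (½ * β) (recip-anti 7≤n))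
             (*-monoˡ (0≤½ *⁰ 0≤α) (*-mono (0≤recip (suc n)) (0≤recip 7) (recip-anti (ℕ.s≤s 7≤n)) (recip-anti 7≤n)))) ⟩
      κ * f
        ∎
      where
      open ≤-Reasoning
      f = 1/fac n

    module _ (recip8≤b : recip 8 ≤ b) where

      -- The left side gains the factor 1/((n + 1)(n + 2)) and the right side b/(k + 1). The former
      -- is smaller, as 1/(n + 2) ≤ 1/9 ≤ b and k ≤ n.
      κ-step : ∀ {n k} → 7 ℕ.≤ n → k ℕ.≤ n → κ * 1/fac n ≤ B k → κ * 1/fac (suc (suc n)) ≤ B (suc k)
      κ-step {n} {k} 7≤n k≤n κ≤B = begin
        κ * (recip (suc n) * (recip n * f))
          ≡⟨ solve 4 (λ κ r r′ f → κ :* (r′ :* (r :* f)) := r′ :* r :* (κ :* f)) refl κ (recip n) (recip (suc n)) f ⟩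
        recip (suc n) * recip n * (κ * f)
          ≤⟨ *-mono (0≤recip (suc n) *⁰ 0≤recip n) (0≤B k)
               (*-mono (0≤recip (suc n)) (0≤recip k) (≤-trans (recip-anti (ℕ.s≤s 7≤n)) recip8≤b) (recip-anti k≤n)) κ≤B ⟩
        b * recip k * B k
          ≡⟨ solve 5 (λ b r a p f → b :* r :* (a :* (p :* f)) := a :* (b :* p :* (r :* f))) refl b (recip k) a (b ^ k) (1/fac k) ⟩
        B (suc k)
          ∎
        where
        open ≤-Reasoning
        f = 1/fac n

      -- The first summand is the upper half of the preceding odd power t^n, still owed to t^(n +
      -- 1). Carrying it along is what lets the induction on `K` close.
      tail : ∀ K {n k} (ν ω : ℕ → ℚ) → 7 ℕ.≤ n → k ℕ.≤ n → κ * 1/fac n ≤ B k → (∀ i → 0ℚ ≤ ν i) →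
        (∀ i → ω i ≤ ½ * (α * ν i + β * ν (suc i))) →
        ½ * β * 1/fac n * ν 0 + ∑< (double K) (λ j → 1/fac (j ℕ.+ suc n) * interleave ν ω j)
          ≤ ∑< (suc K) (λ i → B (i ℕ.+ k) * ν i)
      tail zero {n} {k} ν ω 7≤n k≤n κ≤B 0≤ν ω≤ = +-mono-≤ (*-monoʳ (0≤ν 0) (begin
        ½ * β * 1/fac n
          ≤⟨ ≤-by {s = recip 7 * 1/fac n + ½ * α * (recip 8 * recip 7) * 1/fac n}
               (solve 4 (λ x r y f → (x :+ r :+ y) :* f := x :* f :+ (r :* f :+ y :* f)) refl
                 (½ * β) (recip 7) (½ * α * (recip 8 * recip 7)) (1/fac n))
               (0≤recip 7 *⁰ 0≤1/fac n +⁰ ((0≤½ *⁰ 0≤α) *⁰ 0≤recip 8 *⁰ 0≤recip 7) *⁰ 0≤1/fac n) ⟩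
        κ * 1/fac n
          ≤⟨ κ≤B ⟩
        B k
          ∎)) (≤-refl {0ℚ})
        where open ≤-Reasoning
      tail (suc K) {n} {k} ν ω 7≤n k≤n κ≤B 0≤ν ω≤ = begin
        ½ * β * f * ν 0 + (f₁ * ν 0 + (f₂ * ω 0 + rest))
          ≤⟨ +-monoʳ-≤ (½ * β * f * ν 0) (+-monoʳ-≤ (f₁ * ν 0) (+-monoˡ-≤ rest (*-monoˡ (0≤1/fac (suc (suc n))) (ω≤ 0)))) ⟩
        ½ * β * f * ν 0 + (f₁ * ν 0 + (f₂ * (½ * (α * ν 0 + β * ν 1)) + rest))
          ≡⟨ solve 9 (λ h a b f f₁ f₂ u v r →
               h :* b :* f :* u :+ (f₁ :* u :+ (f₂ :* (h :* (a :* u :+ b :* v)) :+ r)) :=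
               (h :* b :* f :+ f₁ :+ h :* a :* f₂) :* u :+ (h :* b :* f₂ :* v :+ r)) refl
               ½ α β f f₁ f₂ (ν 0) (ν 1) rest ⟩
        coefficient n * ν 0 + (½ * β * f₂ * ν 1 + rest)
          ≤⟨ +-mono-≤ (*-monoʳ (0≤ν 0) (≤-trans (coefficient≤κ 7≤n) κ≤B)) (+-monoʳ-≤ (½ * β * f₂ * ν 1) (≤-reflexive reindex)) ⟩
        B k * ν 0 + (½ * β * f₂ * ν 1 + ∑< (double K) (λ j → 1/fac (j ℕ.+ suc (suc (suc n))) * interleave (ν ∘ suc) (ω ∘ suc) j))
          ≤⟨ +-monoʳ-≤ (B k * ν 0) (tail K (ν ∘ suc) (ω ∘ suc)
               (ℕₚ.≤-trans 7≤n (ℕₚ.m≤n+m n 2)) (ℕₚ.≤-trans (ℕ.s≤s k≤n) (ℕₚ.n≤1+n (suc n)))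
               (κ-step 7≤n k≤n κ≤B) (0≤ν ∘ suc) (ω≤ ∘ suc)) ⟩
        B k * ν 0 + ∑< (suc K) (λ i → B (i ℕ.+ suc k) * ν (suc i))
          ≡⟨ cong (λ z → B k * ν 0 + z) (∑<-cong (suc K) λ i → cong (λ z → B z * ν (suc i)) (ℕₚ.+-suc i k)) ⟩
        ∑< (suc (suc K)) (λ i → B (i ℕ.+ k) * ν i)
          ∎
        where
        open ≤-Reasoning
        f  = 1/fac n
        f₁ = 1/fac (suc n)
        f₂ = 1/fac (suc (suc n))
        rest = ∑< (double K) (λ j → 1/fac (suc (suc j) ℕ.+ suc n) * interleave (ν ∘ suc) (ω ∘ suc) j)
        reindex : rest ≡ ∑< (double K) (λ j → 1/fac (j ℕ.+ suc (suc (suc n))) * interleave (ν ∘ suc) (ω ∘ suc) j)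
        reindex = ∑<-cong (double K) λ j → cong (λ z → 1/fac z * interleave (ν ∘ suc) (ω ∘ suc) j)
          (sym (trans (ℕₚ.+-suc j (suc (suc n))) (cong suc (ℕₚ.+-suc j (suc n)))))

      module _
        -- `c₀`, `c₁` and `c₂` compare the coefficients of u, u² and u³ after δ u (m - u)² = δ (m² u
        -- - 2 m u² + u³) has been added on the left; `c₃` starts the induction of `tail` at u⁴.
        (c₀ : ½ * α * 1/fac 3 + δ * (m * m) ≤ B 0)
        (c₁ : coefficient 3 ≤ B 1 + (m + m) * δ)
        (c₂ : coefficient 5 + δ ≤ B 2)
        (c₃ : κ * 1/fac 7 ≤ B 3)
        where

        -- Each odd power is averaged between its neighbours.  The majorant of the
        -- resulting even series holds only up to a multiple of the square (m - u)².
        majorant : ∀ K (ν ω : ℕ → ℚ) → (∀ i → 0ℚ ≤ ν i) →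
          (∀ i → ω i ≤ ½ * (α * ν i + β * ν (suc i))) →
          (m + m) * ν 2 ≤ m * m * ν 1 + ν 3 →
          ∑< (double (4 ℕ.+ K)) (λ j → expTail₃ j * interleave ν ω j) ≤ ∑< (4 ℕ.+ K) (λ k → B k * ν (suc k))
        majorant K ν ω 0≤ν ω≤ square = begin
          0ℚ * ν 0 + (0ℚ * ω 0 + (0ℚ * ν 1 + (f₃ * ω 1 + (f₄ * ν 2 + (f₅ * ω 2 + (f₆ * ν 3 + (f₇ * ω 3 + rest)))))))
            ≡⟨ solve 9 (λ x y z p q r s t u →
                 con 0ℚ :* x :+ (con 0ℚ :* y :+ (con 0ℚ :* z :+ (p :+ (q :+ (r :+ (s :+ (t :+ u))))))) :=
                 p :+ r :+ t :+ (q :+ s :+ u)) refl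
                 (ν 0) (ω 0) (ν 1) (f₃ * ω 1) (f₄ * ν 2) (f₅ * ω 2) (f₆ * ν 3) (f₇ * ω 3) rest ⟩
          f₃ * ω 1 + f₅ * ω 2 + f₇ * ω 3 + (f₄ * ν 2 + f₆ * ν 3 + rest)
            ≤⟨ +-monoˡ-≤ (f₄ * ν 2 + f₆ * ν 3 + rest) (+-mono-≤ (+-mono-≤
                 (*-monoˡ (0≤1/fac 3) (ω≤ 1)) (*-monoˡ (0≤1/fac 5) (ω≤ 2))) (*-monoˡ (0≤1/fac 7) (ω≤ 3))) ⟩
          f₃ * odd 1 + f₅ * odd 2 + f₇ * odd 3 + (f₄ * ν 2 + f₆ * ν 3 + rest)
            ≡⟨ solve 13 (λ h a b f₃ f₄ f₅ f₆ f₇ n₁ n₂ n₃ n₄ r →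
                 f₃ :* (h :* (a :* n₁ :+ b :* n₂)) :+ f₅ :* (h :* (a :* n₂ :+ b :* n₃)) :+ f₇ :* (h :* (a :* n₃ :+ b :* n₄))
                   :+ (f₄ :* n₂ :+ f₆ :* n₃ :+ r) :=
                 h :* a :* f₃ :* n₁ :+ (h :* b :* f₃ :+ f₄ :+ h :* a :* f₅) :* n₂
                   :+ (h :* b :* f₅ :+ f₆ :+ h :* a :* f₇) :* n₃ :+ (h :* b :* f₇ :* n₄ :+ r)) refl
                 ½ α β f₃ f₄ f₅ f₆ f₇ (ν 1) (ν 2) (ν 3) (ν 4) rest ⟩
          ½ * α * f₃ * ν 1 + coefficient 3 * ν 2 + coefficient 5 * ν 3 + (½ * β * f₇ * ν 4 + rest)
            ≤⟨ +-mono-≤ {low} {high} (0≤-⇒≤ (subst (0ℚ ≤_) regroup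
                   (0≤- c₀ *⁰ 0≤ν 1 +⁰ 0≤- c₁ *⁰ 0≤ν 2 +⁰ 0≤- c₂ *⁰ 0≤ν 3 +⁰ 0≤δ *⁰ 0≤- square)))
                 (≤-trans (≤-reflexive (cong (λ z → ½ * β * f₇ * ν 4 + z) reindex))
                   (tail K (λ i → ν (4 ℕ.+ i)) (λ i → ω (4 ℕ.+ i)) ℕₚ.≤-refl (ℕₚ.m≤m+n 3 4) c₃ (λ i → 0≤ν (4 ℕ.+ i)) (λ i → ω≤ (4 ℕ.+ i)))) ⟩
          (B 0 * ν 1 + B 1 * ν 2 + B 2 * ν 3) + ∑< (suc K) (λ i → B (i ℕ.+ 3) * ν (4 ℕ.+ i))
            ≡⟨ trans (solve 4 (λ x y z u → x :+ y :+ z :+ u := x :+ (y :+ (z :+ u))) refl (B 0 * ν 1) (B 1 * ν 2) (B 2 * ν 3) _)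
                 (cong (λ z → B 0 * ν 1 + (B 1 * ν 2 + (B 2 * ν 3 + z)))
                   (∑<-cong (suc K) λ i → cong (λ z → B z * ν (4 ℕ.+ i)) (ℕₚ.+-comm i 3))) ⟩
          ∑< (4 ℕ.+ K) (λ k → B k * ν (suc k))
            ∎
          where
          open ≤-Reasoning
          f₃ = 1/fac 3
          f₄ = 1/fac 4
          f₅ = 1/fac 5
          f₆ = 1/fac 6
          f₇ = 1/fac 7
          low high : ℚ
          low  = ½ * α * f₃ * ν 1 + coefficient 3 * ν 2 + coefficient 5 * ν 3
          high = B 0 * ν 1 + B 1 * ν 2 + B 2 * ν 3
          odd : ℕ → ℚ
          odd i = ½ * (α * ν i + β * ν (suc i))
          μ = interleave (λ i → ν (4 ℕ.+ i)) (λ i → ω (4 ℕ.+ i))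
          rest = ∑< (double K) (λ j → 1/fac (8 ℕ.+ j) * μ j)
          reindex : rest ≡ ∑< (double K) (λ j → 1/fac (j ℕ.+ 8) * μ j)
          reindex = ∑<-cong (double K) λ j → cong (λ z → 1/fac z * μ j) (ℕₚ.+-comm 8 j)
          regroup :
            (B 0 - (½ * α * 1/fac 3 + δ * (m * m))) * ν 1 + ((B 1 + (m + m) * δ - coefficient 3) * ν 2
              + ((B 2 - (coefficient 5 + δ)) * ν 3 + δ * (m * m * ν 1 + ν 3 - (m + m) * ν 2)))
            ≡ (B 0 * ν 1 + B 1 * ν 2 + B 2 * ν 3) - (½ * α * f₃ * ν 1 + coefficient 3 * ν 2 + coefficient 5 * ν 3)
          regroup = solve 11 (λ b₀ b₁ b₂ x₀ x₁ x₂ δ m n₁ n₂ n₃ →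
            (b₀ :- (x₀ :+ δ :* (m :* m))) :* n₁ :+ ((b₁ :+ (m :+ m) :* δ :- x₁) :* n₂
              :+ ((b₂ :- (x₂ :+ δ)) :* n₃ :+ δ :* (m :* m :* n₁ :+ n₃ :- (m :+ m) :* n₂)))
            := (b₀ :* n₁ :+ b₁ :* n₂ :+ b₂ :* n₃) :- (x₀ :* n₁ :+ x₁ :* n₂ :+ x₂ :* n₃)) refl
            (B 0) (B 1) (B 2) (½ * α * f₃) (coefficient 3) (coefficient 5) δ m (ν 1) (ν 2) (ν 3)

-- Moments of exponential variables and powers of e^t - 1 - t - t²/2

module MomentFunctional where

  open Rationals
  open FactorialSeries
  open EvenSeries
  open import Data.Rational
  open import Data.Rational.Properties
  open import Data.Rational.Solver using (module +-*-Solver)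
  open +-*-Solver using (solve; con; _:+_; _:*_; _:-_; :-_; _:=_)

  ∑<-swap : ∀ m n (f : ℕ → ℕ → ℚ) → ∑< m (λ i → ∑< n (f i)) ≡ ∑< n (λ j → ∑< m (λ i → f i j))
  ∑<-swap zero    n f = sym (zeros n)
    where
    zeros : ∀ n → ∑< n (λ _ → 0ℚ) ≡ 0ℚ
    zeros zero    = refl
    zeros (suc n) = trans (+-identityˡ _) (zeros n)
  ∑<-swap (suc m) n f = trans (cong (λ z → ∑< n (f 0) + z) (∑<-swap m n (f ∘ suc))) (sym (∑<-+ n (f 0) _))

  inverse : ∀ {p} → 0ℚ < p → ∃[ q ] (0ℚ ≤ q × q * p ≡ 1ℚ)
  inverse {p} 0<p = 1/ p , <⇒≤ (positive⁻¹ _ {{1/pos⇒pos p}}) , *-inverseˡ p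
    where
    instance
      p⁺ = positive 0<p
      p≢0 = pos⇒nonZero p

  interleave-cong : ∀ {ν ν′ ω ω′ : ℕ → ℚ} → (∀ i → ν i ≡ ν′ i) → (∀ i → ω i ≡ ω′ i) →
    ∀ j → interleave ν ω j ≡ interleave ν′ ω′ j
  interleave-cong ν≗ ω≗ zero          = ν≗ 0
  interleave-cong ν≗ ω≗ (suc zero)    = ω≗ 0
  interleave-cong ν≗ ω≗ (suc (suc j)) = interleave-cong (ν≗ ∘ suc) (ω≗ ∘ suc) j

  convolve : (ℕ → ℚ) → (ℕ → ℚ) → ℕ → ℚ
  convolve f g zero    = f 0 * g 0
  convolve f g (suc h) = f 0 * g (suc h) + convolve (f ∘ suc) g h

  0≤convolve : ∀ {f g : ℕ → ℚ} → (∀ i → 0ℚ ≤ f i) → (∀ i → 0ℚ ≤ g i) → ∀ h → 0ℚ ≤ convolve f g h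
  0≤convolve 0≤f 0≤g zero    = 0≤f 0 *⁰ 0≤g 0
  0≤convolve 0≤f 0≤g (suc h) = 0≤f 0 *⁰ 0≤g (suc h) +⁰ 0≤convolve (0≤f ∘ suc) 0≤g h

  -- The left side sums over pairs of indices with total below `J`; letting the second index run up
  -- to `L` independently adds only nonnegative terms. A truncated functional of a product thereby
  -- becomes an iterated one.
  convolve-functional : ∀ J L {f g μ : ℕ → ℚ} → J ℕ.≤ L → (∀ i → 0ℚ ≤ f i) → (∀ i → 0ℚ ≤ g i) → (∀ i → 0ℚ ≤ μ i) →
    ∑< J (λ h → convolve f g h * μ h) ≤ ∑< J (λ i → f i * ∑< L (λ h → g h * μ (i ℕ.+ h)))
  convolve-functional zero    L J≤L 0≤f 0≤g 0≤μ = ≤-refl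
  convolve-functional (suc J) (suc L) {f} {g} {μ} (ℕ.s≤s J≤L) 0≤f 0≤g 0≤μ = begin
    f 0 * g 0 * μ 0 + ∑< J (λ h → (f 0 * g (suc h) + convolve (f ∘ suc) g h) * μ (suc h))
      ≡⟨ cong₂ _+_ (*-assoc (f 0) (g 0) (μ 0)) (trans
           (∑<-cong J λ h → solve 4 (λ a b c m → (a :* b :+ c) :* m := a :* (b :* m) :+ c :* m) refl
             (f 0) (g (suc h)) (convolve (f ∘ suc) g h) (μ (suc h)))
           (trans (∑<-+ J _ _) (cong (_+ later) (∑<-*ˡ J (f 0) _)))) ⟩
    f 0 * (g 0 * μ 0) + (f 0 * ∑< J (λ h → g (suc h) * μ (suc h)) + later)
      ≡⟨ solve 4 (λ a b c d → a :* b :+ (a :* c :+ d) := a :* (b :+ c) :+ d) refl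
           (f 0) (g 0 * μ 0) (∑< J (λ h → g (suc h) * μ (suc h))) later ⟩
    f 0 * (g 0 * μ 0 + ∑< J (λ h → g (suc h) * μ (suc h))) + later
      ≤⟨ +-mono-≤ (*-monoˡ (0≤f 0) (+-monoʳ-≤ (g 0 * μ 0) (widen J≤L (λ h → 0≤g (suc h) *⁰ 0≤μ (suc h)))))
           (convolve-functional J (suc L) {f ∘ suc} {g} {μ ∘ suc} (ℕₚ.m≤n⇒m≤1+n J≤L) (0≤f ∘ suc) 0≤g (0≤μ ∘ suc)) ⟩
    f 0 * ∑< (suc L) (λ h → g h * μ h) + ∑< J (λ i → f (suc i) * ∑< (suc L) (λ h → g h * μ (suc i ℕ.+ h)))
      ∎
    where
    open ≤-Reasoning
    later = ∑< J (λ h → convolve (f ∘ suc) g h * μ (suc h))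
    widen : ∀ {m n} {f : ℕ → ℚ} → m ℕ.≤ n → (∀ i → 0ℚ ≤ f i) → ∑< m f ≤ ∑< n f
    widen {n = n} {f} ℕ.z≤n 0≤f = 0≤∑< n 0≤f
    widen {f = f} (ℕ.s≤s m≤n) 0≤f = +-monoʳ-≤ (f 0) (widen m≤n (0≤f ∘ suc))

  expTail₃^ : ℕ → ℕ → ℚ
  expTail₃^ zero    zero    = 1ℚ
  expTail₃^ zero    (suc h) = 0ℚ
  expTail₃^ (suc r)         = convolve expTail₃ (expTail₃^ r)

  0≤expTail₃^ : ∀ r h → 0ℚ ≤ expTail₃^ r h
  0≤expTail₃^ zero    zero    = 0≤1
  0≤expTail₃^ zero    (suc h) = 0≤0
  0≤expTail₃^ (suc r)         = 0≤convolve 0≤expTail₃ (0≤expTail₃^ r)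

  -- The functional u^i ↦ y^i i! (the moments of an exponential variable of mean y) with u = t²,
  -- extended to the odd powers of t by averaging.
  even : ℚ → ℕ → ℚ
  even y i = y ^ i * fac i

  0≤even : ∀ {y} → 0ℚ ≤ y → ∀ i → 0ℚ ≤ even y i
  0≤even 0≤y i = 0≤^ i 0≤y *⁰ 0≤fac i

  -- The functional is nonnegative on u^i (m - u)². With n = i + 1 its value there is y^i i! ((m - n
  -- y)² + n y²), which is the slack.
  even-square : ∀ {y} → 0ℚ ≤ y → ∀ m i → (m + m) * even y (suc i) ≤ m * m * even y i + even y (suc (suc i))
  even-square {y} 0≤y m i = ≤-by
    {s = (y ^ i * fac i) * ((m - n * y) * (m - n * y) + n * (y * y))}
    (trans (cong (λ z → m * m * even y i + y * (y * y ^ i) * (z * (n * fac i))) (ι-suc (suc i)))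
      (solve 5 (λ m y p n f →
        m :* m :* (p :* f) :+ y :* (y :* p) :* ((con 1ℚ :+ n) :* (n :* f)) :=
        (m :+ m) :* (y :* p :* (n :* f)) :+ (p :* f) :* ((m :- n :* y) :* (m :- n :* y) :+ n :* (y :* y)))
        refl m y (y ^ i) n (fac i)))
    (0≤even 0≤y i *⁰ (square-nonNeg (m - n * y) +⁰ 0≤ι (suc i) *⁰ square-nonNeg y))
    where n = ι (suc i)

  module Moments
    {α β a b m δ : ℚ} (0≤α : 0ℚ ≤ α) (0≤β : 0ℚ ≤ β) (0≤a : 0ℚ ≤ a) (0≤b : 0ℚ ≤ b) (0≤δ : 0ℚ ≤ δ)
    (αβ≡1 : α * β ≡ 1ℚ)
    where

    open EvenMajorant {α} {β} {a} {b} {m} {δ} 0≤α 0≤β 0≤a 0≤b 0≤δ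

    odd : ℚ → ℕ → ℚ
    odd y i = ½ * (α * even y i + β * even y (suc i))

    -- The functional on u^i t^h. The two exponents are kept apart because each factor e^t - 1 - t -
    -- t²/2 will be traded for a power of u while t^h waits.
    moment : ℚ → ℕ → ℕ → ℚ
    moment y i zero          = even y i
    moment y i (suc zero)    = odd y i
    moment y i (suc (suc h)) = moment y (suc i) h

    0≤moment : ∀ {y} → 0ℚ ≤ y → ∀ i h → 0ℚ ≤ moment y i h
    0≤moment 0≤y i zero          = 0≤even 0≤y i
    0≤moment 0≤y i (suc zero)    = 0≤½ *⁰ (0≤α *⁰ 0≤even 0≤y i +⁰ 0≤β *⁰ 0≤even 0≤y (suc i))
    0≤moment 0≤y i (suc (suc h)) = 0≤moment 0≤y (suc i) h

    moment-even : ∀ y i h → moment y i h ≡ interleave (λ k → even y (k ℕ.+ i)) (λ k → odd y (k ℕ.+ i)) h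
    moment-even y i zero          = refl
    moment-even y i (suc zero)    = refl
    moment-even y i (suc (suc h)) = trans (moment-even y (suc i) h)
      (interleave-cong (λ k → cong (even y) (ℕₚ.+-suc k i)) (λ k → cong (odd y) (ℕₚ.+-suc k i)) h)

    moment-odd : ∀ y i h → moment y i (suc h) ≡ interleave (λ k → odd y (k ℕ.+ i)) (λ k → even y (suc k ℕ.+ i)) h
    moment-odd y i zero          = refl
    moment-odd y i (suc zero)    = refl
    moment-odd y i (suc (suc h)) = trans (moment-odd y (suc i) h)
      (interleave-cong (λ k → cong (odd y) (ℕₚ.+-suc k i)) (λ k → cong (even y ∘ suc) (ℕₚ.+-suc k i)) h)

    -- Multiplication by an odd power of t exchanges the roles of even and odd powers, so even
    -- moments must also be bounded by averages of odd ones. Averaging twice gives (α² E₀ + 2 E₁ +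
    -- β² E₂)/4, and `even-square` with m = α² bounds the outer terms below by 2 E₁.
    even≤odd : ∀ {y} → 0ℚ ≤ y → ∀ i → even y (suc i) ≤ ½ * (α * odd y i + β * odd y (suc i))
    even≤odd {y} 0≤y i = begin
      E₁
        ≡⟨ expand ⟩
      ½ * ½ * (β * β * ((α * α + α * α) * E₁) + (α * β + α * β) * E₁)
        ≤⟨ *-monoˡ (0≤½ *⁰ 0≤½) (+-monoˡ-≤ ((α * β + α * β) * E₁)
             (*-monoˡ (0≤β *⁰ 0≤β) (even-square 0≤y (α * α) i))) ⟩
      ½ * ½ * (β * β * (α * α * (α * α) * E₀ + E₂) + (α * β + α * β) * E₁)
        ≡⟨ solve 6 (λ h a b e₀ e₁ e₂ →
             h :* h :* (b :* b :* (a :* a :* (a :* a) :* e₀ :+ e₂) :+ (a :* b :+ a :* b) :* e₁) :=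
             h :* h :* ((a :* b) :* (a :* b) :* (a :* a) :* e₀ :+ b :* b :* e₂ :+ (a :* b :+ a :* b) :* e₁))
             refl ½ α β E₀ E₁ E₂ ⟩
      ½ * ½ * ((α * β) * (α * β) * (α * α) * E₀ + β * β * E₂ + (α * β + α * β) * E₁)
        ≡⟨ cong (λ z → ½ * ½ * (z * z * (α * α) * E₀ + β * β * E₂ + (α * β + α * β) * E₁)) αβ≡1 ⟩
      ½ * ½ * (1ℚ * 1ℚ * (α * α) * E₀ + β * β * E₂ + (α * β + α * β) * E₁)
        ≡⟨ solve 6 (λ h a b e₀ e₁ e₂ →
             h :* h :* (con 1ℚ :* con 1ℚ :* (a :* a) :* e₀ :+ b :* b :* e₂ :+ (a :* b :+ a :* b) :* e₁) :=
             h :* (a :* (h :* (a :* e₀ :+ b :* e₁)) :+ b :* (h :* (a :* e₁ :+ b :* e₂))))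
             refl ½ α β E₀ E₁ E₂ ⟩
      ½ * (α * odd y i + β * odd y (suc i))
        ∎
      where
      open ≤-Reasoning
      E₀ = even y i
      E₁ = even y (suc i)
      E₂ = even y (suc (suc i))
      expand : E₁ ≡ ½ * ½ * (β * β * ((α * α + α * α) * E₁) + (α * β + α * β) * E₁)
      expand = sym (trans
        (solve 3 (λ a b e → con ½ :* con ½ :* (b :* b :* ((a :* a :+ a :* a) :* e) :+ (a :* b :+ a :* b) :* e) :=
          con ½ :* ((a :* b) :* (a :* b) :+ a :* b) :* e) refl α β E₁)
        (trans (cong (λ z → ½ * (z * z + z) * E₁) αβ≡1)
          (solve 1 (λ e → con ½ :* (con 1ℚ :* con 1ℚ :+ con 1ℚ) :* e := e) refl E₁)))

    module _ {y j : ℚ} (0≤y : 0ℚ ≤ y) (0≤j : 0ℚ ≤ j) (j*[1-by] : j * (1ℚ - b * y) ≡ 1ℚ) where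

      open GeometricSeries {b * y} {j} (0≤b *⁰ 0≤y) 0≤j j*[1-by]

      -- Exponential tilting: an exponential variable of mean y weighted by e^(b u) is, up to the
      -- factor j = 1/(1 - b y), an exponential variable of mean y j.
      even-series : ∀ N i → ∑< N (λ k → B k * even y (suc k ℕ.+ i)) ≤ a * j * even (y * j) (suc i)
      even-series N i = begin
        ∑< N (λ k → B k * even y (suc k ℕ.+ i))
          ≡⟨ ∑<-cong N term ⟩
        ∑< N (λ k → a * y ^ suc i * (rising (suc i) k * (b * y) ^ k))
          ≡⟨ ∑<-*ˡ N (a * y ^ suc i) _ ⟩
        a * y ^ suc i * ∑< N (λ k → rising (suc i) k * (b * y) ^ k)
          ≤⟨ *-monoˡ (0≤a *⁰ 0≤^ (suc i) 0≤y) (rising-series (suc i) N) ⟩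
        a * y ^ suc i * (fac (suc i) * (j * j ^ suc i))
          ≡⟨ solve 5 (λ a p f j q → a :* p :* (f :* (j :* q)) := a :* j :* (p :* q :* f)) refl
               a (y ^ suc i) (fac (suc i)) j (j ^ suc i) ⟩
        a * j * (y ^ suc i * j ^ suc i * fac (suc i))
          ≡⟨ cong (λ z → a * j * (z * fac (suc i))) (sym (^-*-distrib y j (suc i))) ⟩
        a * j * even (y * j) (suc i)
          ∎
        where
        open ≤-Reasoning
        term : ∀ k → B k * even y (suc k ℕ.+ i) ≡ a * y ^ suc i * (rising (suc i) k * (b * y) ^ k)
        term k = trans (cong (λ z → B k * even y z) (sym (ℕₚ.+-suc k i)))
          (trans (cong (λ z → B k * (z * fac (k ℕ.+ suc i))) (^-+ y k (suc i)))
            (trans (solve 6 (λ a p r q s f → a :* (p :* r) :* (q :* s :* f) := a :* s :* (f :* r :* (p :* q))) refl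
                a (b ^ k) (1/fac k) (y ^ k) (y ^ suc i) (fac (k ℕ.+ suc i)))
              (cong (λ z → a * y ^ suc i * (rising (suc i) k * z)) (sym (^-*-distrib b y k)))))

      odd-series : ∀ N i → ∑< N (λ k → B k * odd y (suc k ℕ.+ i)) ≤ a * j * odd (y * j) (suc i)
      odd-series N i = begin
        ∑< N (λ k → B k * odd y (suc k ℕ.+ i))
          ≡⟨ trans (∑<-cong N λ k → solve 5 (λ B a b e₀ e₁ →
                 B :* (con ½ :* (a :* e₀ :+ b :* e₁)) := con ½ :* a :* (B :* e₀) :+ con ½ :* b :* (B :* e₁)) refl
                 (B k) α β (even y (suc k ℕ.+ i)) (even y (suc (suc k ℕ.+ i))))
               (trans (∑<-+ N _ _) (cong₂ _+_ (∑<-*ˡ N (½ * α) _) (trans (∑<-*ˡ N (½ * β) _)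
                 (cong (½ * β *_) (∑<-cong N λ k → cong (λ z → B k * even y (suc z)) (sym (ℕₚ.+-suc k i))))))) ⟩
        ½ * α * ∑< N (λ k → B k * even y (suc k ℕ.+ i)) + ½ * β * ∑< N (λ k → B k * even y (suc k ℕ.+ suc i))
          ≤⟨ +-mono-≤ (*-monoˡ (0≤½ *⁰ 0≤α) (even-series N i)) (*-monoˡ (0≤½ *⁰ 0≤β) (even-series N (suc i))) ⟩
        ½ * α * (a * j * even (y * j) (suc i)) + ½ * β * (a * j * even (y * j) (suc (suc i)))
          ≡⟨ solve 5 (λ c a b e₀ e₁ → con ½ :* a :* (c :* e₀) :+ con ½ :* b :* (c :* e₁) :=
               c :* (con ½ :* (a :* e₀ :+ b :* e₁))) refl (a * j) α β (even (y * j) (suc i)) (even (y * j) (suc (suc i))) ⟩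
        a * j * odd (y * j) (suc i)
          ∎
        where open ≤-Reasoning

    module _ (recip8≤b : recip 8 ≤ b)
      (c₀ : ½ * α * 1/fac 3 + δ * (m * m) ≤ B 0)
      (c₁ : coefficient 3 ≤ B 1 + (m + m) * δ)
      (c₂ : coefficient 5 + δ ≤ B 2)
      (c₃ : κ * 1/fac 7 ≤ B 3)
      where

      -- One factor e^t - 1 - t - t²/2 is exchanged for a j u at the new scale y j. The parity of
      -- `g` decides whether even or odd moments play the part of `ν` in `majorant`.
      expTail₃-moment : ∀ {y j} → 0ℚ ≤ y → 0ℚ ≤ j → j * (1ℚ - b * y) ≡ 1ℚ → ∀ K i g →
        ∑< (double (4 ℕ.+ K)) (λ h → expTail₃ h * moment y i (g ℕ.+ h)) ≤ a * j * moment (y * j) (suc i) g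
      expTail₃-moment {y} 0≤y 0≤j j*[1-by] K i zero = ≤-trans
        (≤-trans (≤-reflexive (∑<-cong (double (4 ℕ.+ K)) λ h → cong (expTail₃ h *_) (moment-even y i h)))
          (majorant recip8≤b c₀ c₁ c₂ c₃ K _ _ (λ k → 0≤even 0≤y (k ℕ.+ i)) (λ k → ≤-refl) (even-square 0≤y m (suc i))))
        (even-series 0≤y 0≤j j*[1-by] (4 ℕ.+ K) i)
      expTail₃-moment {y} 0≤y 0≤j j*[1-by] K i (suc zero) = ≤-trans
        (≤-trans (≤-reflexive (∑<-cong (double (4 ℕ.+ K)) λ h → cong (expTail₃ h *_) (moment-odd y i h)))
          (majorant recip8≤b c₀ c₁ c₂ c₃ K _ _ (λ k → 0≤moment 0≤y (k ℕ.+ i) 1) (λ k → even≤odd 0≤y (k ℕ.+ i)) odd-square))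
        (odd-series 0≤y 0≤j j*[1-by] (4 ℕ.+ K) i)
        where
        odd-square : (m + m) * odd y (2 ℕ.+ i) ≤ m * m * odd y (1 ℕ.+ i) + odd y (3 ℕ.+ i)
        odd-square = subst₂ _≤_
          (solve 5 (λ m a b e₁ e₂ → con ½ :* a :* ((m :+ m) :* e₁) :+ con ½ :* b :* ((m :+ m) :* e₂) :=
            (m :+ m) :* (con ½ :* (a :* e₁ :+ b :* e₂))) refl m α β (even y (2 ℕ.+ i)) (even y (3 ℕ.+ i)))
          (solve 7 (λ m a b e₀ e₁ e₂ e₃ →
            con ½ :* a :* (m :* m :* e₀ :+ e₂) :+ con ½ :* b :* (m :* m :* e₁ :+ e₃) :=
            m :* m :* (con ½ :* (a :* e₀ :+ b :* e₁)) :+ con ½ :* (a :* e₂ :+ b :* e₃)) refl m α β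
            (even y (1 ℕ.+ i)) (even y (2 ℕ.+ i)) (even y (3 ℕ.+ i)) (even y (4 ℕ.+ i)))
          (+-mono-≤ (*-monoˡ (0≤½ *⁰ 0≤α) (even-square 0≤y m (1 ℕ.+ i)))
            (*-monoˡ (0≤½ *⁰ 0≤β) (even-square 0≤y m (2 ℕ.+ i))))
      expTail₃-moment 0≤y 0≤j j*[1-by] K i (suc (suc g)) = expTail₃-moment 0≤y 0≤j j*[1-by] K (suc i) g

      module Iteration (N : ℕ)
        (step : ∀ {y j} → 0ℚ ≤ y → 0ℚ ≤ j → j * (1ℚ - b * y) ≡ 1ℚ → ∀ i g →
          ∑< N (λ h → expTail₃ h * moment y i (g ℕ.+ h)) ≤ a * j * moment (y * j) (suc i) g)
        where

        constant : ∀ n {μ : ℕ → ℚ} → (∀ h → 0ℚ ≤ μ h) → ∑< n (λ h → expTail₃^ 0 h * μ h) ≤ μ 0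
        constant zero        0≤μ = 0≤μ 0
        constant (suc n) {μ} 0≤μ = ≤-reflexive (trans
          (cong₂ _+_ (*-identityˡ (μ 0)) (trans (∑<-*ˡ n 0ℚ (μ ∘ suc)) (*-zeroˡ (∑< n (μ ∘ suc)))))
          (+-identityʳ (μ 0)))

        -- The scale of the functional runs through y / (D - k b y), k = 0, …, r.
        iterate : ∀ r {y D d D′ d′} → 0ℚ ≤ y → 0ℚ ≤ d → d * D ≡ 1ℚ → 0ℚ < D′ → D′ ≡ D - ι r * (b * y) → 0ℚ ≤ d′ →
          d′ * D′ ≡ 1ℚ → 0ℚ ≤ D → ∀ i g →
          ∑< N (λ h → expTail₃^ r h * moment (y * d) i (g ℕ.+ h))
            ≤ a ^ r * (D * d′) * moment (y * d′) (r ℕ.+ i) g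
        iterate zero {y} {D} {d} {D′} {d′} 0≤y 0≤d dD≡1 0<D′ D′≡ 0≤d′ d′D′≡1 0≤D i g = begin
          ∑< N (λ h → expTail₃^ 0 h * moment (y * d) i (g ℕ.+ h))
            ≤⟨ constant N (λ h → 0≤moment (0≤y *⁰ 0≤d) i (g ℕ.+ h)) ⟩
          moment (y * d) i (g ℕ.+ 0)
            ≡⟨ cong₂ (λ z h → moment (y * z) i h) d≡d′ (ℕₚ.+-identityʳ g) ⟩
          moment (y * d′) i g
            ≡⟨ sym (trans (cong (_* moment (y * d′) i g) (trans (*-identityˡ (D * d′)) (trans (*-comm D d′) d′D≡1))) (*-identityˡ _)) ⟩
          1ℚ * (D * d′) * moment (y * d′) i g
            ∎
          where
          open ≤-Reasoning
          d′D≡1 : d′ * D ≡ 1ℚ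
          d′D≡1 = trans (cong (d′ *_) (sym (trans D′≡ (solve 2 (λ D z → D :- con 0ℚ :* z := D) refl D (b * y))))) d′D′≡1
          d≡d′ : d ≡ d′
          d≡d′ = trans (sym (*-identityˡ d)) (trans (cong (_* d) (sym d′D≡1))
            (trans (solve 3 (λ x y z → x :* y :* z := x :* (z :* y)) refl d′ D d)
              (trans (cong (d′ *_) dD≡1) (*-identityʳ d′))))
        iterate (suc r) {y} {D} {d} {D′} {d′} 0≤y 0≤d dD≡1 0<D′ D′≡ 0≤d′ d′D′≡1 0≤D i g =
          first-step (inverse {D - b * y} (<-≤-trans 0<D′ D′≤D₁))
          where
          D′≡′ : D′ ≡ D - b * y - ι r * (b * y)
          D′≡′ = trans D′≡ (trans (cong (λ z → D - z * (b * y)) (ι-suc r))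
            (solve 3 (λ D x r → D :- (con 1ℚ :+ r) :* x := D :- x :- r :* x) refl D (b * y) (ι r)))
          D′≤D₁ : D′ ≤ D - b * y
          D′≤D₁ = ≤-by {s = ι r * (b * y)} (trans
            (solve 2 (λ x z → x := x :- z :+ z) refl (D - b * y) (ι r * (b * y))) (cong (_+ ι r * (b * y)) (sym D′≡′)))
            (0≤ι r *⁰ 0≤b *⁰ 0≤y)
          0≤D₁ : 0ℚ ≤ D - b * y
          0≤D₁ = ≤-trans (<⇒≤ 0<D′) D′≤D₁
          first-step : ∃[ d₁ ] (0ℚ ≤ d₁ × d₁ * (D - b * y) ≡ 1ℚ) →
            ∑< N (λ h → convolve expTail₃ (expTail₃^ r) h * moment (y * d) i (g ℕ.+ h))
              ≤ a ^ suc r * (D * d′) * moment (y * d′) (suc r ℕ.+ i) g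
          first-step (d₁ , 0≤d₁ , d₁D₁≡1) = begin
            ∑< N (λ h → convolve expTail₃ (expTail₃^ r) h * moment (y * d) i (g ℕ.+ h))
              ≤⟨ convolve-functional N N {expTail₃} {expTail₃^ r} {λ h → moment (y * d) i (g ℕ.+ h)} ℕₚ.≤-refl 0≤expTail₃ (0≤expTail₃^ r) (λ h → 0≤moment (0≤y *⁰ 0≤d) i (g ℕ.+ h)) ⟩
            ∑< N (λ k → expTail₃ k * ∑< N (λ h → expTail₃^ r h * moment (y * d) i (g ℕ.+ (k ℕ.+ h))))
              ≡⟨ trans (∑<-cong N λ k → sym (∑<-*ˡ N (expTail₃ k) (λ h → expTail₃^ r h * moment (y * d) i (g ℕ.+ (k ℕ.+ h)))))
                   (∑<-swap N N (λ k h → expTail₃ k * (expTail₃^ r h * moment (y * d) i (g ℕ.+ (k ℕ.+ h))))) ⟩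
            ∑< N (λ h → ∑< N (λ k → expTail₃ k * (expTail₃^ r h * moment (y * d) i (g ℕ.+ (k ℕ.+ h)))))
              ≡⟨ (∑<-cong N λ h → trans (∑<-cong N λ k → reassociate h k)
                   (∑<-*ˡ N (expTail₃^ r h) (λ k → expTail₃ k * moment (y * d) i ((g ℕ.+ h) ℕ.+ k)))) ⟩
            ∑< N (λ h → expTail₃^ r h * ∑< N (λ k → expTail₃ k * moment (y * d) i ((g ℕ.+ h) ℕ.+ k)))
              ≤⟨ (∑<-mono N λ h → *-monoˡ (0≤expTail₃^ r h)
                   (step (0≤y *⁰ 0≤d) (0≤D *⁰ 0≤d₁) j*[1-by] i (g ℕ.+ h))) ⟩
            ∑< N (λ h → expTail₃^ r h * (a * (D * d₁) * moment (y * d * (D * d₁)) (suc i) (g ℕ.+ h)))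
              ≡⟨ trans (∑<-cong N λ h → trans
                   (solve 3 (λ x c m → x :* (c :* m) := c :* (x :* m)) refl (expTail₃^ r h) (a * (D * d₁))
                   (moment (y * d * (D * d₁)) (suc i) (g ℕ.+ h)))
                   (cong (λ z → a * (D * d₁) * (expTail₃^ r h * moment z (suc i) (g ℕ.+ h))) rescale))
                   (∑<-*ˡ N (a * (D * d₁)) (λ h → expTail₃^ r h * moment (y * d₁) (suc i) (g ℕ.+ h))) ⟩
            a * (D * d₁) * ∑< N (λ h → expTail₃^ r h * moment (y * d₁) (suc i) (g ℕ.+ h))
              ≤⟨ *-monoˡ (0≤a *⁰ 0≤D *⁰ 0≤d₁) (iterate r 0≤y 0≤d₁ d₁D₁≡1 0<D′ D′≡′ 0≤d′ d′D′≡1 0≤D₁ (suc i) g) ⟩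
            a * (D * d₁) * (a ^ r * ((D - b * y) * d′) * moment (y * d′) (r ℕ.+ suc i) g)
              ≡⟨ solve 7 (λ a D d₁ p D₁ d′ m → a :* (D :* d₁) :* (p :* (D₁ :* d′) :* m) :=
                   a :* p :* (d₁ :* D₁ :* (D :* d′)) :* m) refl a D d₁ (a ^ r) (D - b * y) d′ (moment (y * d′) (r ℕ.+ suc i) g) ⟩
            a * a ^ r * (d₁ * (D - b * y) * (D * d′)) * moment (y * d′) (r ℕ.+ suc i) g
              ≡⟨ cong₂ (λ z k → a * a ^ r * z * moment (y * d′) k g)
                   (trans (cong (_* (D * d′)) d₁D₁≡1) (*-identityˡ (D * d′))) (ℕₚ.+-suc r i) ⟩
            a ^ suc r * (D * d′) * moment (y * d′) (suc r ℕ.+ i) g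
              ∎
            where
            open ≤-Reasoning
            reassociate : ∀ h k → expTail₃ k * (expTail₃^ r h * moment (y * d) i (g ℕ.+ (k ℕ.+ h)))
              ≡ expTail₃^ r h * (expTail₃ k * moment (y * d) i ((g ℕ.+ h) ℕ.+ k))
            reassociate h k = trans (solve 3 (λ x y z → x :* (y :* z) := y :* (x :* z)) refl (expTail₃ k) (expTail₃^ r h)
              (moment (y * d) i (g ℕ.+ (k ℕ.+ h))))
              (cong (λ z → expTail₃^ r h * (expTail₃ k * moment (y * d) i z))
                (trans (cong (g ℕ.+_) (ℕₚ.+-comm k h)) (sym (ℕₚ.+-assoc g h k))))
            rescale : y * d * (D * d₁) ≡ y * d₁
            rescale = trans (solve 4 (λ y d D e → y :* d :* (D :* e) := y :* (d :* D :* e)) refl y d D d₁)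
              (cong (y *_) (trans (cong (_* d₁) dD≡1) (*-identityˡ d₁)))
            j*[1-by] : D * d₁ * (1ℚ - b * (y * d)) ≡ 1ℚ
            j*[1-by] = trans (solve 5 (λ D e b y d → D :* e :* (con 1ℚ :- b :* (y :* d)) := e :* (D :- (d :* D) :* (b :* y))) refl D d₁ b y d)
              (trans (cong (λ z → d₁ * (D - z * (b * y))) dD≡1)
                (trans (cong (λ z → d₁ * (D - z)) (*-identityˡ (b * y))) d₁D₁≡1))

      -- Over r exchanges the factors j telescope to d, and the scale ends at y d.
      expTail₃^-moment : ∀ r K {y d} → 0ℚ ≤ y → 0ℚ < 1ℚ - ι r * (b * y) → 0ℚ ≤ d → d * (1ℚ - ι r * (b * y)) ≡ 1ℚ →
        ∑< (double (4 ℕ.+ K)) (λ h → expTail₃^ r h * moment y 0 h) ≤ d * ((a * (y * d)) ^ r * fac r)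
      expTail₃^-moment r K {y} {d} 0≤y 0<D 0≤d dD≡1 = subst₂ _≤_
        (∑<-cong (double (4 ℕ.+ K)) λ h → cong (λ z → expTail₃^ r h * moment z 0 h) (*-identityʳ y))
        (trans (cong (λ k → a ^ r * (1ℚ * d) * even (y * d) k) (ℕₚ.+-identityʳ r))
          (trans (solve 4 (λ p d q f → p :* (con 1ℚ :* d) :* (q :* f) := d :* (p :* q :* f)) refl (a ^ r) d ((y * d) ^ r) (fac r))
            (cong (λ z → d * (z * fac r)) (sym (^-*-distrib a (y * d) r)))))
        (Iteration.iterate (double (4 ℕ.+ K)) (λ 0≤y 0≤j e → expTail₃-moment 0≤y 0≤j e K) r {y} {1ℚ} {1ℚ} 0≤y 0≤1 refl 0<D refl 0≤d dD≡1 0≤1 0 0)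

-- Words in which every letter occurs at least three times

module WordCounting where

  open Rationals
  open FactorialSeries
  open EvenSeries
  open MomentFunctional
  open import Data.List.Relation.Binary.Permutation.Propositional using (_↭_; ↭-refl; ↭-prep; ↭-swap; ↭-trans)
  open import Data.Rational
  open import Data.Rational.Properties
  open import Data.Rational.Solver using (module +-*-Solver)
  open +-*-Solver using (solve; con; _:+_; _:*_; _:=_)

  convolve-cong : ∀ {f f′ g g′ : ℕ → ℚ} → (∀ i → f i ≡ f′ i) → (∀ i → g i ≡ g′ i) → ∀ h → convolve f g h ≡ convolve f′ g′ h
  convolve-cong f≗ g≗ zero    = cong₂ _*_ (f≗ 0) (g≗ 0)
  convolve-cong f≗ g≗ (suc h) = cong₂ _+_ (cong₂ _*_ (f≗ 0) (g≗ (suc h))) (convolve-cong (f≗ ∘ suc) g≗ h)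

  convolve-∑ʳ : ∀ {A : Set} (xs : List A) (f : ℕ → ℚ) (g : A → ℕ → ℚ) h →
    ∑ xs (λ x → convolve f (g x) h) ≡ convolve f (λ i → ∑ xs (λ x → g x i)) h
  convolve-∑ʳ xs f g zero    = ∑-*ˡ xs (f 0) (λ x → g x 0)
  convolve-∑ʳ xs f g (suc h) = trans (∑-+ xs (λ x → f 0 * g x (suc h)) (λ x → convolve (f ∘ suc) (g x) h))
    (cong₂ _+_ (∑-*ˡ xs (f 0) (λ x → g x (suc h))) (convolve-∑ʳ xs (f ∘ suc) g h))

  derivative : (ℕ → ℚ) → ℕ → ℚ
  derivative f j = ι (suc j) * f (suc j)

  -- Leibniz's rule for the product of two power series.
  convolve-derivative : ∀ h (f g : ℕ → ℚ) →
    ι (suc h) * convolve f g (suc h) ≡ convolve (derivative f) g h + convolve f (derivative g) h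
  convolve-derivative zero f g =
    solve 4 (λ f₀ f₁ g₀ g₁ → con 1ℚ :* (f₀ :* g₁ :+ f₁ :* g₀) := con 1ℚ :* f₁ :* g₀ :+ f₀ :* (con 1ℚ :* g₁)) refl
      (f 0) (f 1) (g 0) (g 1)
  convolve-derivative (suc h) f g = begin
    n * (f 0 * g (2 ℕ.+ h) + c)
      ≡⟨ cong (λ z → z * (f 0 * g (2 ℕ.+ h) + c)) (ι-suc (suc h)) ⟩
    (1ℚ + ι (suc h)) * (f 0 * g (2 ℕ.+ h) + c)
      ≡⟨ solve 4 (λ n f₀ g₂ c → (con 1ℚ :+ n) :* (f₀ :* g₂ :+ c) := n :* c :+ c :+ f₀ :* ((con 1ℚ :+ n) :* g₂)) refl
           (ι (suc h)) (f 0) (g (2 ℕ.+ h)) c ⟩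
    ι (suc h) * c + c + f 0 * ((1ℚ + ι (suc h)) * g (2 ℕ.+ h))
      ≡⟨ cong₂ (λ x z → x + c + f 0 * (z * g (2 ℕ.+ h))) (convolve-derivative h (f ∘ suc) g) (sym (ι-suc (suc h))) ⟩
    (p + q) + c + f 0 * derivative g (suc h)
      ≡⟨ solve 6 (λ p q f₁ g₁ d x → (p :+ q) :+ (f₁ :* g₁ :+ d) :+ x := con 1ℚ :* f₁ :* g₁ :+ (p :+ d) :+ (x :+ q)) refl
           p q (f 1) (g (suc h)) d (f 0 * derivative g (suc h)) ⟩
    1ℚ * f 1 * g (suc h) + (p + d) + (f 0 * derivative g (suc h) + q)
      ≡⟨ cong (λ z → 1ℚ * f 1 * g (suc h) + z + (f 0 * derivative g (suc h) + q)) (sym (split h (f ∘ suc) g)) ⟩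
    convolve (derivative f) g (suc h) + convolve f (derivative g) (suc h)
      ∎
    where
    open ≡-Reasoning
    n = ι (2 ℕ.+ h)
    c = convolve (f ∘ suc) g (suc h)
    p = convolve (derivative (f ∘ suc)) g h
    q = convolve (f ∘ suc) (derivative g) h
    d = convolve (f ∘ suc ∘ suc) g h
    -- The derivative of f has weight j + 2 at index j + 1, that of `f ∘ suc` only j + 1 at index j;
    -- the difference is the summand `d`.
    split : ∀ h (f g : ℕ → ℚ) → convolve (λ j → ι (2 ℕ.+ j) * f (suc j)) g h
      ≡ convolve (derivative f) g h + convolve (f ∘ suc) g h
    split zero f g = trans (cong (λ z → z * f 1 * g 0) (ι-suc 1))
      (solve 3 (λ i f g → (con 1ℚ :+ i) :* f :* g := i :* f :* g :+ f :* g) refl (ι 1) (f 1) (g 0))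
    split (suc h) f g = trans (cong₂ _+_ (cong (λ z → z * f 1 * g (suc h)) (ι-suc 1))
        (trans (convolve-cong (λ j → shift j) (λ _ → refl) h) (split′ h)))
      (solve 5 (λ i f g x y → (con 1ℚ :+ i) :* f :* g :+ (x :+ y) := i :* f :* g :+ x :+ (f :* g :+ y)) refl
        (ι 1) (f 1) (g (suc h)) (convolve (λ j → derivative f (suc j)) g h) (convolve (f ∘ suc ∘ suc) g h))
      where
      shift : ∀ j → ι (3 ℕ.+ j) * f (2 ℕ.+ j) ≡ derivative f (suc j) + f (2 ℕ.+ j)
      shift j = trans (cong (_* f (2 ℕ.+ j)) (ι-suc (2 ℕ.+ j)))
        (solve 2 (λ i f → (con 1ℚ :+ i) :* f := i :* f :+ f) refl (ι (2 ℕ.+ j)) (f (2 ℕ.+ j)))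
      split′ : ∀ h → convolve (λ j → derivative f (suc j) + f (2 ℕ.+ j)) g h
        ≡ convolve (λ j → derivative f (suc j)) g h + convolve (f ∘ suc ∘ suc) g h
      split′ = additive (λ j → derivative f (suc j)) (f ∘ suc ∘ suc)
        where
        additive : ∀ (k l : ℕ → ℚ) h → convolve (λ j → k j + l j) g h ≡ convolve k g h + convolve l g h
        additive k l zero    = *-distribʳ-+ (g 0) (k 0) (l 0)
        additive k l (suc h) = trans (cong (λ z → (k 0 + l 0) * g (suc h) + z) (additive (k ∘ suc) (l ∘ suc) h))
          (solve 5 (λ k l g x y → (k :+ l) :* g :+ (x :+ y) := k :* g :+ x :+ (l :* g :+ y)) refl
            (k 0) (l 0) (g (suc h)) (convolve (k ∘ suc) g h) (convolve (l ∘ suc) g h))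

  atLeast₃ : ℕ → ℚ
  atLeast₃ (suc (suc (suc _))) = 1ℚ
  atLeast₃ _                   = 0ℚ

  0≤atLeast₃ : ∀ c → 0ℚ ≤ atLeast₃ c
  0≤atLeast₃ zero                = 0≤0
  0≤atLeast₃ (suc zero)          = 0≤0
  0≤atLeast₃ (suc (suc zero))    = 0≤0
  0≤atLeast₃ (suc (suc (suc c))) = 0≤1

  -- The series for a letter that has already occurred c times and has to occur at least 3 times.
  letter : ℕ → ℕ → ℚ
  letter c j = atLeast₃ (c ℕ.+ j) * 1/fac j

  0≤letter : ∀ c j → 0ℚ ≤ letter c j
  0≤letter c j = 0≤atLeast₃ (c ℕ.+ j) *⁰ 0≤1/fac j

  -- For exponential generating functions, prescribing one more occurrence of a letter is
  -- differentiation.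
  letter-derivative : ∀ c j → letter (suc c) j ≡ derivative (letter c) j
  letter-derivative c j = sym (trans
    (solve 3 (λ i a f → i :* (a :* f) := a :* (i :* f)) refl (ι (suc j)) (atLeast₃ (c ℕ.+ suc j)) (1/fac (suc j)))
    (cong₂ (λ k f → atLeast₃ k * f) (ℕₚ.+-suc c j) (ι*1/fac j)))

  letter-zero : ∀ j → letter 0 j ≡ expTail₃ j
  letter-zero zero                = refl
  letter-zero (suc zero)          = refl
  letter-zero (suc (suc zero))    = refl
  letter-zero (suc (suc (suc j))) = *-identityˡ (1/fac (3 ℕ.+ j))

  -- The central binomial coefficient is at most 4^s. This turns (2s)!/s!, with 2s letters in order
  -- but s links unordered, into s!, the moment of an exponential variable.
  fac-double : ∀ s → fac (double s) ≤ (ι 4) ^ s * (fac s * fac s)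
  fac-double zero    = ≤-refl
  fac-double (suc s) = begin
    ι (2 ℕ.+ double s) * (ι (1 ℕ.+ double s) * fac (double s))
      ≤⟨ *-monoˡ (0≤ι (2 ℕ.+ double s))
           (*-mono (0≤ι (1 ℕ.+ double s)) (0≤^ s (0≤ι 4) *⁰ 0≤fac s *⁰ 0≤fac s) (ι-mono {1 ℕ.+ double s} (ℕₚ.n≤1+n (1 ℕ.+ double s))) (fac-double s)) ⟩
    ι (2 ℕ.+ double s) * (ι (2 ℕ.+ double s) * (ι 4 ^ s * (fac s * fac s)))
      ≡⟨ cong (λ z → z * (z * (ι 4 ^ s * (fac s * fac s)))) (trans (cong ι (double-≡ s)) (ι-+ (suc s) (suc s))) ⟩
    (n + n) * ((n + n) * (ι 4 ^ s * (fac s * fac s)))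
      ≡⟨ solve 3 (λ n p f → (n :+ n) :* ((n :+ n) :* (p :* (f :* f))) := con (ι 4) :* p :* (n :* f :* (n :* f))) refl n (ι 4 ^ s) (fac s) ⟩
    ι 4 ^ suc s * (fac (suc s) * fac (suc s))
      ∎
    where
    open ≤-Reasoning
    n = ι (suc s)
    double-≡ : ∀ s → 2 ℕ.+ double s ≡ suc s ℕ.+ suc s
    double-≡ zero    = refl
    double-≡ (suc s) = cong suc (trans (cong suc (double-≡ s)) (cong suc (sym (ℕₚ.+-suc s (suc s)))))

  module Words {V : Set} (_≟_ : DecidableEquality V) where

    Word : Set
    Word = List V

    occurs : V → V → ℕ
    occurs u v with u ≟ v
    ... | yes _ = 1
    ... | no  _ = 0

    occurs-refl : ∀ u → occurs u u ≡ 1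
    occurs-refl u with u ≟ u
    ... | yes _   = refl
    ... | no  u≢u = contradiction refl u≢u

    occurs-≢ : ∀ {u v} → u ≢ v → occurs u v ≡ 0
    occurs-≢ {u} {v} u≢v with u ≟ v
    ... | yes u≡v = contradiction u≡v u≢v
    ... | no  _   = refl

    count : V → Word → ℕ
    count u []      = 0
    count u (v ∷ w) = occurs u v ℕ.+ count u w

    count-≡ : ∀ u w → count u (u ∷ w) ≡ suc (count u w)
    count-≡ u w = cong (ℕ._+ count u w) (occurs-refl u)

    count-≢ : ∀ {u v} w → u ≢ v → count u (v ∷ w) ≡ count u w
    count-≢ {u} w u≢v = cong (ℕ._+ count u w) (occurs-≢ u≢v)

    count-swap : ∀ u v v′ w → count u (v ∷ v′ ∷ w) ≡ count u (v′ ∷ v ∷ w)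
    count-swap u v v′ w = trans (sym (ℕₚ.+-assoc (occurs u v) (occurs u v′) (count u w)))
      (trans (cong (ℕ._+ count u w) (ℕₚ.+-comm (occurs u v) (occurs u v′)))
        (ℕₚ.+-assoc (occurs u v′) (occurs u v) (count u w)))

    count-↭ : ∀ u {w w′} → w ↭ w′ → count u w ≡ count u w′
    count-↭ u _↭_.refl           = refl
    count-↭ u (_↭_.prep v p)     = cong (occurs u v ℕ.+_) (count-↭ u p)
    count-↭ u (_↭_.swap {xs = w} v v′ p) = trans (count-swap u v v′ w)
      (cong (λ c → occurs u v′ ℕ.+ (occurs u v ℕ.+ c)) (count-↭ u p))
    count-↭ u (_↭_.trans p q)    = trans (count-↭ u p) (count-↭ u q)

    -- An indicator with rational values, written as a product over the letters so that the count of
    -- completions is a convolution of one series per letter.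
    saturated : List V → Word → ℚ
    saturated []       w = 1ℚ
    saturated (u ∷ us) w = atLeast₃ (count u w) * saturated us w

    0≤saturated : ∀ us w → 0ℚ ≤ saturated us w
    0≤saturated []       w = 0≤1
    0≤saturated (u ∷ us) w = 0≤atLeast₃ (count u w) *⁰ 0≤saturated us w

    saturated-↭ : ∀ us {w w′} → w ↭ w′ → saturated us w ≡ saturated us w′
    saturated-↭ []       p = refl
    saturated-↭ (u ∷ us) p = cong₂ (λ c s → atLeast₃ c * s) (count-↭ u p) (saturated-↭ us p)

    -- 1/h! times the number of words v of length h over us for which v ++ w is saturated.
    completions : List V → Word → ℕ → ℚ
    completions []       w zero    = 1ℚ
    completions []       w (suc h) = 0ℚ
    completions (u ∷ us) w         = convolve (letter (count u w)) (completions us w)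

    0≤completions : ∀ us w h → 0ℚ ≤ completions us w h
    0≤completions []       w zero    = 0≤1
    0≤completions []       w (suc h) = 0≤0
    0≤completions (u ∷ us) w         = 0≤convolve (0≤letter (count u w)) (0≤completions us w)

    completions-zero : ∀ us w → completions us w 0 ≡ saturated us w
    completions-zero []       w = refl
    completions-zero (u ∷ us) w = cong₂ _*_
      (trans (*-identityʳ _) (cong atLeast₃ (ℕₚ.+-identityʳ (count u w)))) (completions-zero us w)

    completions-fresh : ∀ us u w → All (u ≢_) us → ∀ h → completions us (u ∷ w) h ≡ completions us w h
    completions-fresh []       u w []            zero    = refl
    completions-fresh []       u w []            (suc h) = refl
    completions-fresh (v ∷ us) u w (u≢v ∷ u≢us) h       = convolve-cong
      (λ i → cong (λ c → letter c i) (count-≢ w (u≢v ∘ sym))) (completions-fresh us u w u≢us) h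

    completions-[] : ∀ us h → completions us [] h ≡ expTail₃^ (length us) h
    completions-[] []       zero    = refl
    completions-[] []       (suc h) = refl
    completions-[] (u ∷ us) h       = convolve-cong letter-zero (completions-[] us) h

    -- The sum runs over the next letter. Prescribing `u` differentiates only the series of `u`, so
    -- the sum over all letters is the derivative of the product.
    completions-derivative : ∀ {us} → Unique us → ∀ w h →
      ∑ us (λ u → completions us (u ∷ w) h) ≡ ι (suc h) * completions us w (suc h)
    completions-derivative []                             w h = sym (*-zeroʳ (ι (suc h)))
    completions-derivative {u ∷ us} (u≢us ∷ us-unique) w h = begin
      convolve (letter (count u (u ∷ w))) (completions us (u ∷ w)) h
        + ∑ us (λ v → convolve (letter (count u (v ∷ w))) (completions us (v ∷ w)) h)
        ≡⟨ cong₂ _+_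
             (convolve-cong (λ j → trans (cong (λ c → letter c j) (count-≡ u w)) (letter-derivative c j))
               (completions-fresh us u w u≢us) h)
             (trans (∑-cong-All u≢us)
               (trans (convolve-∑ʳ us (letter c) (λ v → completions us (v ∷ w)) h)
                 (convolve-cong (λ _ → refl) (completions-derivative us-unique w) h))) ⟩
      convolve (derivative (letter c)) (completions us w) h + convolve (letter c) (derivative (completions us w)) h
        ≡⟨ sym (convolve-derivative h (letter c) (completions us w)) ⟩
      ι (suc h) * completions (u ∷ us) w (suc h)
        ∎
      where
      open ≡-Reasoning
      c = count u w
      ∑-cong-All : ∀ {vs} → All (u ≢_) vs →
        ∑ vs (λ v → convolve (letter (count u (v ∷ w))) (completions us (v ∷ w)) h)
          ≡ ∑ vs (λ v → convolve (letter c) (completions us (v ∷ w)) h)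
      ∑-cong-All []                     = refl
      ∑-cong-All {v ∷ vs} (u≢v ∷ u≢vs) = cong₂ _+_
        (convolve-cong (λ j → cong (λ c → letter c j) (count-≢ w u≢v)) (λ _ → refl) h) (∑-cong-All u≢vs)

    Link : Set
    Link = V × V

    -- A weight and the links of which at most one is chosen.
    Cell : Set
    Cell = ℚ × List Link

    NonNegCell : Cell → Set
    NonNegCell (x , _) = 0ℚ ≤ x

    extend : Cell → (Word → ℚ) → Word → ℚ
    extend (x , ls) G w = x * ∑ ls (λ (i , j) → G (i ∷ j ∷ w))

    extendAny : List Cell → (Word → ℚ) → Word → ℚ
    extendAny cs G w = ∑ cs (λ c → extend c G w)

    choices : List Cell → (Word → ℚ) → Word → ℚ
    choices []       G w = G w
    choices (c ∷ cs) G w = choices cs G w + extend c (choices cs G) w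

    -- The elementary symmetric polynomials in the commuting operators extend c; hence Newton's
    -- inequality (s + 1) eₛ₊₁ ≤ e₁ eₛ in choose-suc.
    choose : ℕ → List Cell → (Word → ℚ) → Word → ℚ
    choose zero    cs       G w = G w
    choose (suc s) []       G w = 0ℚ
    choose (suc s) (c ∷ cs) G w = choose (suc s) cs G w + extend c (choose s cs G) w

    Symmetric : (Word → ℚ) → Set
    Symmetric G = ∀ {w w′} → w ↭ w′ → G w ≡ G w′

    0≤extend : ∀ {c G} → NonNegCell c → (∀ w → 0ℚ ≤ G w) → ∀ w → 0ℚ ≤ extend c G w
    0≤extend {_ , ls} 0≤x 0≤G w = 0≤x *⁰ 0≤∑ ls (λ (i , j) → 0≤G (i ∷ j ∷ w))

    extend-mono : ∀ {c} {G H : Word → ℚ} → NonNegCell c → (∀ w → G w ≤ H w) → ∀ w → extend c G w ≤ extend c H w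
    extend-mono {_ , ls} 0≤x G≤H w = *-monoˡ 0≤x (∑-mono ls (λ (i , j) → G≤H (i ∷ j ∷ w)))

    extend-cong : ∀ c {G H : Word → ℚ} → (∀ w → G w ≡ H w) → ∀ w → extend c G w ≡ extend c H w
    extend-cong (x , ls) G≗H w = cong (x *_) (∑-cong ls (λ (i , j) → G≗H (i ∷ j ∷ w)))

    extend-+ : ∀ c G H w → extend c (λ w → G w + H w) w ≡ extend c G w + extend c H w
    extend-+ (x , ls) G H w = trans (cong (x *_) (∑-+ ls (λ (i , j) → G (i ∷ j ∷ w)) (λ (i , j) → H (i ∷ j ∷ w))))
      (*-distribˡ-+ x _ _)

    extend-*ˡ : ∀ c a G w → extend c (λ w → a * G w) w ≡ a * extend c G w
    extend-*ˡ (x , ls) a G w = trans (cong (x *_) (∑-*ˡ ls a (λ (i , j) → G (i ∷ j ∷ w))))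
      (solve 3 (λ x a s → x :* (a :* s) := a :* (x :* s)) refl x a (∑ ls (λ (i , j) → G (i ∷ j ∷ w))))

    extend-∑< : ∀ c n (G : ℕ → Word → ℚ) w → extend c (λ w → ∑< n (λ s → G s w)) w ≡ ∑< n (λ s → extend c (G s) w)
    extend-∑< (x , ls) zero    G w = trans (cong (x *_) (∑-0 ls)) (*-zeroʳ x)
    extend-∑< c       (suc n) G w = trans (extend-+ c (G 0) (λ w → ∑< n (λ s → G (suc s) w)) w)
      (cong (λ z → extend c (G 0) w + z) (extend-∑< c n (G ∘ suc) w))

    extend-↭ : ∀ c {G} → Symmetric G → Symmetric (extend c G)
    extend-↭ (x , ls) G-sym p = cong (x *_) (∑-cong ls (λ (i , j) → G-sym (↭-prep i (↭-prep j p))))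

    extend-comm : ∀ c d {G} → Symmetric G → ∀ w → extend c (extend d G) w ≡ extend d (extend c G) w
    extend-comm (x , ls) (y , ms) {G} G-sym w = begin
      x * ∑ ls (λ (i , j) → y * ∑ ms (λ (k , l) → G (k ∷ l ∷ i ∷ j ∷ w)))
        ≡⟨ cong (x *_) (∑-*ˡ ls y _) ⟩
      x * (y * ∑ ls (λ (i , j) → ∑ ms (λ (k , l) → G (k ∷ l ∷ i ∷ j ∷ w))))
        ≡⟨ cong (λ z → x * (y * z)) (trans (∑-swap ls ms (λ (i , j) (k , l) → G (k ∷ l ∷ i ∷ j ∷ w)))
             (∑-cong ms λ (k , l) → ∑-cong ls λ (i , j) → G-sym (exchange k l i j))) ⟩
      x * (y * ∑ ms (λ (k , l) → ∑ ls (λ (i , j) → G (i ∷ j ∷ k ∷ l ∷ w))))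
        ≡⟨ solve 3 (λ x y s → x :* (y :* s) := y :* (x :* s)) refl x y
             (∑ ms (λ (k , l) → ∑ ls (λ (i , j) → G (i ∷ j ∷ k ∷ l ∷ w)))) ⟩
      y * (x * ∑ ms (λ (k , l) → ∑ ls (λ (i , j) → G (i ∷ j ∷ k ∷ l ∷ w))))
        ≡⟨ cong (y *_) (sym (∑-*ˡ ms x _)) ⟩
      y * ∑ ms (λ (k , l) → x * ∑ ls (λ (i , j) → G (i ∷ j ∷ k ∷ l ∷ w)))
        ∎
      where
      open ≡-Reasoning
      exchange : ∀ k l i j → k ∷ l ∷ i ∷ j ∷ w ↭ i ∷ j ∷ k ∷ l ∷ w
      exchange k l i j = ↭-trans (↭-prep k (↭-swap l i ↭-refl)) (↭-trans (↭-swap k i ↭-refl)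
        (↭-prep i (↭-trans (↭-prep k (↭-swap l j ↭-refl)) (↭-swap k j ↭-refl))))

    extendAny-+ : ∀ cs G H w → extendAny cs (λ w → G w + H w) w ≡ extendAny cs G w + extendAny cs H w
    extendAny-+ cs G H w = trans (∑-cong cs λ c → extend-+ c G H w)
      (∑-+ cs (λ c → extend c G w) (λ c → extend c H w))

    extendAny-comm : ∀ cs c {G} → Symmetric G → ∀ w → extendAny cs (extend c G) w ≡ extend c (extendAny cs G) w
    extendAny-comm cs c@(x , ls) {G} G-sym w = trans (∑-cong cs λ d → extend-comm d c G-sym w)
      (trans (∑-*ˡ cs x _) (cong (x *_) (∑-swap cs ls (λ d (i , j) → extend d G (i ∷ j ∷ w)))))

    0≤choose : ∀ s {cs G} → All NonNegCell cs → (∀ w → 0ℚ ≤ G w) → ∀ w → 0ℚ ≤ choose s cs G w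
    0≤choose zero            0≤cs         0≤G w = 0≤G w
    0≤choose (suc s) {[]}    []           0≤G w = 0≤0
    0≤choose (suc s) {c ∷ _} (0≤c ∷ 0≤cs) 0≤G w =
      0≤choose (suc s) 0≤cs 0≤G w +⁰ 0≤extend {c} 0≤c (0≤choose s 0≤cs 0≤G) w

    choose-↭ : ∀ s cs {G} → Symmetric G → Symmetric (choose s cs G)
    choose-↭ zero    cs       G-sym p = G-sym p
    choose-↭ (suc s) []       G-sym p = refl
    choose-↭ (suc s) (c ∷ cs) G-sym p =
      cong₂ _+_ (choose-↭ (suc s) cs G-sym p) (extend-↭ c (choose-↭ s cs G-sym) p)

    choices≤choose : ∀ N cs {G} → All NonNegCell cs → (∀ w → 0ℚ ≤ G w) → length cs ℕ.< N → ∀ w →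
      choices cs G w ≤ ∑< N (λ s → choose s cs G w)
    choices≤choose (suc N) [] {G} 0≤cs 0≤G l w = ≤-by {s = ∑< N (λ s → choose (suc s) [] G w)} refl
      (0≤∑< N (λ s → 0≤choose (suc s) {[]} {G} [] 0≤G w))
    choices≤choose (suc N) (c ∷ cs) {G} (0≤c ∷ 0≤cs) 0≤G (ℕ.s≤s l) w = begin
      choices cs G w + extend c (choices cs G) w
        ≤⟨ +-mono-≤ (choices≤choose (suc N) cs 0≤cs 0≤G (ℕₚ.m≤n⇒m≤1+n l) w)
             (extend-mono {c} 0≤c (choices≤choose N cs 0≤cs 0≤G l) w) ⟩
      (G w + ∑< N (λ s → choose (suc s) cs G w)) + extend c (λ w → ∑< N (λ s → choose s cs G w)) w
        ≡⟨ trans (+-assoc (G w) _ _) (cong (λ z → G w + (∑< N (λ s → choose (suc s) cs G w) + z))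
             (extend-∑< c N (λ s → choose s cs G) w)) ⟩
      G w + (∑< N (λ s → choose (suc s) cs G w) + ∑< N (λ s → extend c (choose s cs G) w))
        ≡⟨ cong (λ z → G w + z) (sym (∑<-+ N (λ s → choose (suc s) cs G w) (λ s → extend c (choose s cs G) w))) ⟩
      ∑< (suc N) (λ s → choose s (c ∷ cs) G w)
        ∎
      where open ≤-Reasoning

    choose-suc : ∀ s cs {G} → All NonNegCell cs → (∀ w → 0ℚ ≤ G w) → Symmetric G → ∀ w →
      ι (suc s) * choose (suc s) cs G w ≤ extendAny cs (choose s cs G) w
    choose-suc s [] 0≤cs 0≤G G-sym w = ≤-reflexive (*-zeroʳ (ι (suc s)))
    choose-suc zero (c ∷ cs) {G} (0≤c ∷ 0≤cs) 0≤G G-sym w = begin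
      1ℚ * (choose 1 cs G w + extend c G w)
        ≡⟨ solve 2 (λ x y → con 1ℚ :* (x :+ y) := y :+ con 1ℚ :* x) refl (choose 1 cs G w) (extend c G w) ⟩
      extend c G w + 1ℚ * choose 1 cs G w
        ≤⟨ +-monoʳ-≤ (extend c G w) (choose-suc zero cs 0≤cs 0≤G G-sym w) ⟩
      extend c G w + extendAny cs G w
        ∎
      where open ≤-Reasoning
    choose-suc (suc s) (c ∷ cs) {G} (0≤c ∷ 0≤cs) 0≤G G-sym w = begin
      ι (2 ℕ.+ s) * (choose (2 ℕ.+ s) cs G w + extend c e₁ w)
        ≡⟨ trans (*-distribˡ-+ (ι (2 ℕ.+ s)) (choose (2 ℕ.+ s) cs G w) (extend c e₁ w))
             (cong (λ z → ι (2 ℕ.+ s) * choose (2 ℕ.+ s) cs G w + z * extend c e₁ w) (ι-suc (suc s))) ⟩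
      ι (2 ℕ.+ s) * choose (2 ℕ.+ s) cs G w + (1ℚ + ι (suc s)) * extend c e₁ w
        ≡⟨ solve 3 (λ x n y → x :+ (con 1ℚ :+ n) :* y := y :+ x :+ n :* y) refl
             (ι (2 ℕ.+ s) * choose (2 ℕ.+ s) cs G w) (ι (suc s)) (extend c e₁ w) ⟩
      extend c e₁ w + ι (2 ℕ.+ s) * choose (2 ℕ.+ s) cs G w + ι (suc s) * extend c e₁ w
        ≤⟨ +-mono-≤ (+-monoʳ-≤ (extend c e₁ w) (choose-suc (suc s) cs 0≤cs 0≤G G-sym w))
             (≤-trans (≤-reflexive (sym (extend-*ˡ c (ι (suc s)) e₁ w)))
               (extend-mono {c} 0≤c (choose-suc s cs 0≤cs 0≤G G-sym) w)) ⟩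
      extend c e₁ w + extendAny cs e₁ w + extend c (extendAny cs e₀) w
        ≡⟨ cong (λ z → extend c e₁ w + extendAny cs e₁ w + z) (sym (extendAny-comm cs c (choose-↭ s cs G-sym) w)) ⟩
      extend c e₁ w + extendAny cs e₁ w + extendAny cs (extend c e₀) w
        -- The added term uses the cell `c` twice. Such repetitions are what e₁ eₛ counts beyond (s
        -- + 1) eₛ₊₁.
        ≤⟨ ≤-by {s = extend c (extend c e₀) w}
             (solve 4 (λ x y u v → x :+ v :+ (y :+ u) := x :+ y :+ u :+ v) refl
               (extend c e₁ w) (extendAny cs e₁ w) (extendAny cs (extend c e₀) w) (extend c (extend c e₀) w))
             (0≤extend {c} 0≤c (0≤extend {c} 0≤c (0≤choose s 0≤cs 0≤G)) w) ⟩
      extend c e₁ w + extend c (extend c e₀) w + (extendAny cs e₁ w + extendAny cs (extend c e₀) w)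
        ≡⟨ sym (cong₂ _+_ (extend-+ c e₁ (extend c e₀) w) (extendAny-+ cs e₁ (extend c e₀) w)) ⟩
      extendAny (c ∷ cs) (λ w → e₁ w + extend c e₀ w) w
        ∎
      where
      open ≤-Reasoning
      e₀ = choose s cs G
      e₁ = choose (suc s) cs G

-- From sets of links to words

module Links where

  open Rationals
  open FactorialSeries
  open EvenSeries
  open MomentFunctional
  open WordCounting
  open import Data.List.Relation.Binary.Permutation.Propositional using (↭-refl; ↭-swap)
  open import Data.Rational
  open import Data.Rational.Properties
  open import Data.Rational.Solver using (module +-*-Solver)
  open +-*-Solver using (solve; con; _:+_; _:*_; _:=_)

  triangle : ℕ → ℕ
  triangle zero    = 0
  triangle (suc r) = r ℕ.+ triangle r

  pairsOf : ∀ {A : Set} → List A → List (A × A)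
  pairsOf []       = []
  pairsOf (x ∷ xs) = map (x ,_) xs ++ pairsOf xs

  length-pairsOf : ∀ {A : Set} (xs : List A) → length (pairsOf xs) ≡ triangle (length xs)
  length-pairsOf []       = refl
  length-pairsOf (x ∷ xs) = trans (Listₚ.length-++ (map (x ,_) xs))
    (cong₂ ℕ._+_ (Listₚ.length-map (x ,_) xs) (length-pairsOf xs))

  -- By symmetry the full square counts every pair twice; the diagonal is only thrown in. This lets
  -- the two letters of a link be chosen freely.
  ∑-pairsOf : ∀ {A : Set} (xs : List A) (f : A → A → ℚ) → (∀ x y → 0ℚ ≤ f x y) → (∀ x y → f x y ≡ f y x) →
    ∑ (pairsOf xs) (λ (x , y) → f x y) ≤ ½ * ∑ xs (λ x → ∑ xs (f x))
  ∑-pairsOf []       f 0≤f f-sym = ≤-refl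
  ∑-pairsOf {A} (x ∷ xs) f 0≤f f-sym = begin
    ∑ (map (x ,_) xs ++ pairsOf xs) (λ (x , y) → f x y)
      ≡⟨ trans (∑-++ (map (x ,_) xs) (pairsOf xs) (λ (x , y) → f x y))
           (cong (_+ ∑ (pairsOf xs) (λ (x , y) → f x y)) (∑-map (x ,_) xs (λ (x , y) → f x y))) ⟩
    row + ∑ (pairsOf xs) (λ (x , y) → f x y)
      ≤⟨ +-monoʳ-≤ row (∑-pairsOf xs f 0≤f f-sym) ⟩
    row + ½ * square
      ≤⟨ ≤-by {s = ½ * f x x}
           (solve 3 (λ d r s → con ½ :* ((d :+ r) :+ (r :+ s)) := (r :+ con ½ :* s) :+ con ½ :* d) refl (f x x) row square)
           (0≤½ *⁰ 0≤f x x) ⟩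
    ½ * ((f x x + row) + (row + square))
      ≡⟨ cong (λ z → ½ * ((f x x + row) + z)) (sym (trans (∑-+ xs (λ y → f y x) (λ y → ∑ xs (f y)))
           (cong (_+ square) (∑-cong xs λ y → f-sym y x)))) ⟩
    ½ * ∑ (x ∷ xs) (λ y → ∑ (x ∷ xs) (f y))
      ∎
    where
    open ≤-Reasoning
    row square : ℚ
    row    = ∑ xs (f x)
    square = ∑ xs (λ y → ∑ xs (f y))

  ∑-const : ∀ {A : Set} (xs : List A) c → ∑ xs (λ _ → c) ≡ ι (length xs) * c
  ∑-const []       c = sym (*-zeroˡ c)
  ∑-const (x ∷ xs) c = trans (cong (c +_) (∑-const xs c)) (trans
    (solve 2 (λ c n → c :+ n :* c := (con 1ℚ :+ n) :* c) refl c (ι (length xs)))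
    (cong (_* c) (sym (ι-suc (length xs)))))

  module WordBounds {V : Set} (_≟_ : DecidableEquality V) where

    open Words _≟_

    module _ {us : List V} (us-unique : Unique us) {cs : List Cell} (0≤cs : All NonNegCell cs) {P : ℚ} (0≤P : 0ℚ ≤ P)
      (extendAny≤ : ∀ {G : Word → ℚ} → (∀ w → 0ℚ ≤ G w) → Symmetric G → ∀ w →
        extendAny cs G w ≤ ½ * P * ∑ us (λ i → ∑ us (λ j → G (i ∷ j ∷ w))))
      where

      -- By `choose-suc`, s! eₛ is at most the sum over ordered sequences of s links, which are read
      -- as words of length 2s. The induction prepends one link, hence the arbitrary initial word
      -- `w`.
      choose≤completions : ∀ s w →
        fac s * choose s cs (saturated us) w ≤ (½ * P) ^ s * (fac (double s) * completions us w (double s))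
      choose≤completions zero    w = ≤-reflexive (trans (*-identityˡ (saturated us w))
        (trans (sym (completions-zero us w)) (solve 1 (λ x → x := con 1ℚ :* (con 1ℚ :* x)) refl (completions us w 0))))
      choose≤completions (suc s) w = begin
        ι (suc s) * fac s * e₁ w
          ≡⟨ solve 3 (λ n f e → n :* f :* e := f :* (n :* e)) refl (ι (suc s)) (fac s) (e₁ w) ⟩
        fac s * (ι (suc s) * e₁ w)
          ≤⟨ *-monoˡ (0≤fac s) (≤-trans (choose-suc s cs 0≤cs (0≤saturated us) (saturated-↭ us) w)
               (extendAny≤ (0≤choose s 0≤cs (0≤saturated us)) (choose-↭ s cs (saturated-↭ us)) w)) ⟩
        fac s * (½ * P * ∑ us (λ i → ∑ us (λ j → e₀ (i ∷ j ∷ w))))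
          ≡⟨ trans (solve 3 (λ f p x → f :* (p :* x) := p :* (f :* x)) refl (fac s) (½ * P) (∑ us (λ i → ∑ us (λ j → e₀ (i ∷ j ∷ w)))))
               (cong (½ * P *_) (trans (sym (∑-*ˡ us (fac s) (λ i → ∑ us (λ j → e₀ (i ∷ j ∷ w)))))
                 (∑-cong us λ i → sym (∑-*ˡ us (fac s) (λ j → e₀ (i ∷ j ∷ w)))))) ⟩
        ½ * P * ∑ us (λ i → ∑ us (λ j → fac s * e₀ (i ∷ j ∷ w)))
          ≤⟨ *-monoˡ (0≤½ *⁰ 0≤P) (∑-mono us λ i → ∑-mono us λ j → choose≤completions s (i ∷ j ∷ w)) ⟩
        ½ * P * ∑ us (λ i → ∑ us (λ j → (½ * P) ^ s * (f₀ * φ (i ∷ j ∷ w) m)))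
          ≡⟨ cong (½ * P *_) (trans (∑-swap us us (λ i j → (½ * P) ^ s * (f₀ * φ (i ∷ j ∷ w) m)))
               (trans (∑-cong us λ j → trans (pull (λ i → φ (i ∷ j ∷ w) m))
                 (cong (λ z → (½ * P) ^ s * (f₀ * z)) (completions-derivative us-unique (j ∷ w) m)))
               (trans (pull (λ j → ι (suc m) * φ (j ∷ w) (suc m)))
                 (cong (λ z → (½ * P) ^ s * (f₀ * z)) (trans (∑-*ˡ us (ι (suc m)) (λ j → φ (j ∷ w) (suc m)))
                   (cong (ι (suc m) *_) (completions-derivative us-unique w (suc m)))))))) ⟩
        ½ * P * ((½ * P) ^ s * (f₀ * (ι (suc m) * (ι (2 ℕ.+ m) * φ w (2 ℕ.+ m)))))
          ≡⟨ solve 6 (λ p q f a b x → p :* (q :* (f :* (a :* (b :* x)))) := p :* q :* (b :* (a :* f) :* x)) refl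
               (½ * P) ((½ * P) ^ s) f₀ (ι (suc m)) (ι (2 ℕ.+ m)) (φ w (2 ℕ.+ m)) ⟩
        (½ * P) ^ suc s * (fac (double (suc s)) * φ w (double (suc s)))
          ∎
        where
        open ≤-Reasoning
        m : ℕ
        m = double s
        f₀ : ℚ
        f₀ = fac m
        φ : Word → ℕ → ℚ
        φ = completions us
        e₀ e₁ : Word → ℚ
        e₀ = choose s cs (saturated us)
        e₁ = choose (suc s) cs (saturated us)
        pull : ∀ (g : V → ℚ) → ∑ us (λ i → (½ * P) ^ s * (f₀ * g i)) ≡ (½ * P) ^ s * (f₀ * ∑ us g)
        pull g = trans (∑-*ˡ us ((½ * P) ^ s) (λ i → f₀ * g i)) (cong ((½ * P) ^ s *_) (∑-*ˡ us f₀ g))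

      -- The factor 1/2 of unordered links and the 4 of `fac-double` combine to the mean 2P of the
      -- exponential variable.
      choose≤even : ∀ s w → choose s cs (saturated us) w ≤ completions us w (double s) * even (P + P) s
      choose≤even s w = begin
        e
          ≤⟨ ≤-divide (0≤1/fac s) (trans (*-comm (1/fac s) (fac s)) (fac*1/fac s)) (choose≤completions s w) ⟩
        1/fac s * ((½ * P) ^ s * (fac (double s) * x))
          ≤⟨ *-monoˡ (0≤1/fac s) (*-monoˡ (0≤^ s (0≤½ *⁰ 0≤P)) (*-monoʳ (0≤completions us w (double s)) (fac-double s))) ⟩
        1/fac s * ((½ * P) ^ s * (ι 4 ^ s * (fac s * fac s) * x))
          ≡⟨ solve 5 (λ g p q f x → g :* (p :* (q :* (f :* f) :* x)) := f :* g :* (x :* (p :* q :* f))) refl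
               (1/fac s) ((½ * P) ^ s) (ι 4 ^ s) (fac s) x ⟩
        fac s * 1/fac s * (x * ((½ * P) ^ s * ι 4 ^ s * fac s))
          ≡⟨ cong₂ (λ a b → a * (x * (b * fac s))) (fac*1/fac s)
               (trans (sym (^-*-distrib (½ * P) (ι 4) s))
                 (cong (_^ s) (solve 1 (λ P → con ½ :* P :* con (ι 4) := P :+ P) refl P))) ⟩
        1ℚ * (x * even (P + P) s)
          ≡⟨ *-identityˡ _ ⟩
        x * even (P + P) s
          ∎
        where
        open ≤-Reasoning
        e x : ℚ
        e = choose s cs (saturated us) w
        x = completions us w (double s)

      choices≤even : ∀ N → length cs ℕ.< N →
        choices cs (saturated us) [] ≤ ∑< N (λ s → expTail₃^ (length us) (double s) * even (P + P) s)
      choices≤even N l = ≤-trans (choices≤choose N cs 0≤cs (0≤saturated us) l [])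
        (∑<-mono N λ s → ≤-trans (choose≤even s [])
          (≤-reflexive (cong (_* even (P + P) s) (completions-[] us (double s)))))

    -- A vertex outside us can serve as the middle of at most one link, of weight x;
    -- every link is itself an edge with odds z.
    cells : ℚ → ℚ → List Link → List V → List Cell
    cells x z ls vs = map (λ _ → x , ls) vs ++ map (λ l → z , l ∷ []) ls

    0≤cells : ∀ {x z} → 0ℚ ≤ x → 0ℚ ≤ z → ∀ ls vs → All NonNegCell (cells x z ls vs)
    0≤cells 0≤x 0≤z ls vs = Allₚ.++⁺ (Allₚ.map⁺ (All.universal (λ _ → 0≤x) vs)) (Allₚ.map⁺ (All.universal (λ _ → 0≤z) ls))

    extendAny-cells : ∀ x z ls vs G w →
      extendAny (cells x z ls vs) G w ≡ (ι (length vs) * x + z) * ∑ ls (λ (i , j) → G (i ∷ j ∷ w))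
    extendAny-cells x z ls vs G w = begin
      ∑ (map (λ _ → x , ls) vs ++ map (λ l → z , l ∷ []) ls) (λ c → extend c G w)
        ≡⟨ ∑-++ (map (λ _ → x , ls) vs) (map (λ l → z , l ∷ []) ls) (λ c → extend c G w) ⟩
      ∑ (map (λ _ → x , ls) vs) (λ c → extend c G w) + ∑ (map (λ l → z , l ∷ []) ls) (λ c → extend c G w)
        ≡⟨ cong₂ _+_
             (trans (∑-map (λ _ → x , ls) vs (λ c → extend c G w)) (∑-const vs (x * s)))
             (trans (∑-map (λ l → z , l ∷ []) ls (λ c → extend c G w))
               (trans (∑-cong ls λ (i , j) → cong (z *_) (+-identityʳ (G (i ∷ j ∷ w))))
                 (∑-*ˡ ls z (λ (i , j) → G (i ∷ j ∷ w))))) ⟩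
      ι (length vs) * (x * s) + z * s
        ≡⟨ solve 4 (λ n x s z → n :* (x :* s) :+ z :* s := (n :* x :+ z) :* s) refl (ι (length vs)) x s z ⟩
      (ι (length vs) * x + z) * s
        ∎
      where
      open ≡-Reasoning
      s : ℚ
      s = ∑ ls (λ (i , j) → G (i ∷ j ∷ w))

    choices-cells≤even : ∀ {us} → Unique us → ∀ {x z} → 0ℚ ≤ x → 0ℚ ≤ z → ∀ vs N →
      length (cells x z (pairsOf us) vs) ℕ.< N →
      let P = ι (length vs) * x + z in
      choices (cells x z (pairsOf us) vs) (saturated us) []
        ≤ ∑< N (λ s → expTail₃^ (length us) (double s) * even (P + P) s)
    choices-cells≤even {us} us-unique {x} {z} 0≤x 0≤z vs = choices≤even us-unique
      (0≤cells 0≤x 0≤z (pairsOf us) vs) 0≤P λ {G} 0≤G G-sym w → begin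
        extendAny (cells x z (pairsOf us) vs) G w
          ≡⟨ extendAny-cells x z (pairsOf us) vs G w ⟩
        P * ∑ (pairsOf us) (λ (i , j) → G (i ∷ j ∷ w))
          ≤⟨ *-monoˡ 0≤P (∑-pairsOf us (λ i j → G (i ∷ j ∷ w)) (λ i j → 0≤G (i ∷ j ∷ w)) (λ i j → G-sym (↭-swap i j ↭-refl))) ⟩
        P * (½ * ∑ us (λ i → ∑ us (λ j → G (i ∷ j ∷ w))))
          ≡⟨ solve 3 (λ p h s → p :* (h :* s) := h :* p :* s) refl P ½ (∑ us (λ i → ∑ us (λ j → G (i ∷ j ∷ w)))) ⟩
        ½ * P * ∑ us (λ i → ∑ us (λ j → G (i ∷ j ∷ w)))
          ∎
      where
      open ≤-Reasoning
      P : ℚ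
      P = ι (length vs) * x + z
      0≤P : 0ℚ ≤ P
      0≤P = 0≤ι (length vs) *⁰ 0≤x +⁰ 0≤z

-- Expectations over random sublists

module Expectation where

  open Rationals
  open MomentFunctional
  open WordCounting
  open Links
  open import Data.List.Membership.Propositional using (_∈_)
  open import Data.List.Relation.Unary.Any using (here; there)
  open import Data.Rational
  open import Data.Rational.Properties hiding (_≟_)
  open import Data.Rational.Solver using (module +-*-Solver)
  open +-*-Solver using (solve; con; _:+_; _:*_; _:-_; :-_; _:=_)

  module _ {A : Set} where

    𝔼 : ℚ → List A → (List A → ℚ) → ℚ
    𝔼 p []       f = f []
    𝔼 p (x ∷ xs) f = p * 𝔼 p xs (f ∘ (x ∷_)) + (1ℚ - p) * 𝔼 p xs f

    𝔼-cong-All : ∀ {Q : A → Set} p {xs f g} → All Q xs → (∀ {es} → All Q es → f es ≡ g es) → 𝔼 p xs f ≡ 𝔼 p xs g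
    𝔼-cong-All p []        f≗g = f≗g []
    𝔼-cong-All p (q ∷ qs) f≗g = cong₂ (λ a b → p * a + (1ℚ - p) * b)
      (𝔼-cong-All p qs (λ qs′ → f≗g (q ∷ qs′))) (𝔼-cong-All p qs f≗g)

    𝔼-cong : ∀ p xs {f g} → (∀ es → f es ≡ g es) → 𝔼 p xs f ≡ 𝔼 p xs g
    𝔼-cong p []       f≗g = f≗g []
    𝔼-cong p (x ∷ xs) f≗g = cong₂ (λ a b → p * a + (1ℚ - p) * b) (𝔼-cong p xs (f≗g ∘ (x ∷_))) (𝔼-cong p xs f≗g)

    𝔼-mono-All : ∀ {Q : A → Set} {p} → 0ℚ ≤ p → p ≤ 1ℚ → ∀ {xs f g} → All Q xs →
      (∀ {es} → All Q es → f es ≤ g es) → 𝔼 p xs f ≤ 𝔼 p xs g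
    𝔼-mono-All 0≤p p≤1 []       f≤g = f≤g []
    𝔼-mono-All 0≤p p≤1 (q ∷ qs) f≤g = +-mono-≤
      (*-monoˡ 0≤p (𝔼-mono-All 0≤p p≤1 qs (λ qs′ → f≤g (q ∷ qs′))))
      (*-monoˡ (0≤- p≤1) (𝔼-mono-All 0≤p p≤1 qs f≤g))

    𝔼-+ : ∀ p xs f g → 𝔼 p xs (λ es → f es + g es) ≡ 𝔼 p xs f + 𝔼 p xs g
    𝔼-+ p []       f g = refl
    𝔼-+ p (x ∷ xs) f g = trans
      (cong₂ (λ a b → p * a + (1ℚ - p) * b) (𝔼-+ p xs (f ∘ (x ∷_)) (g ∘ (x ∷_))) (𝔼-+ p xs f g))
      (solve 5 (λ p a b c d → p :* (a :+ b) :+ (con 1ℚ :- p) :* (c :+ d) :=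
        p :* a :+ (con 1ℚ :- p) :* c :+ (p :* b :+ (con 1ℚ :- p) :* d)) refl
        p (𝔼 p xs (f ∘ (x ∷_))) (𝔼 p xs (g ∘ (x ∷_))) (𝔼 p xs f) (𝔼 p xs g))

    𝔼-const : ∀ p xs c → 𝔼 p xs (λ _ → c) ≡ c
    𝔼-const p []       c = refl
    𝔼-const p (x ∷ xs) c = trans (cong (λ a → p * a + (1ℚ - p) * a) (𝔼-const p xs c))
      (solve 2 (λ p c → p :* c :+ (con 1ℚ :- p) :* c := c) refl p c)

    𝔼-∑ : ∀ p xs {B : Set} (ys : List B) (f : B → List A → ℚ) →
      𝔼 p xs (λ es → ∑ ys (λ y → f y es)) ≡ ∑ ys (λ y → 𝔼 p xs (f y))
    𝔼-∑ p xs []       f = 𝔼-const p xs 0ℚ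
    𝔼-∑ p xs (y ∷ ys) f = trans (𝔼-+ p xs (f y) (λ es → ∑ ys (λ y → f y es)))
      (cong (𝔼 p xs (f y) +_) (𝔼-∑ p xs ys f))

  module Membership {E : Set} (_≟_ : DecidableEquality E) where

    member : E → List E → Bool
    member e []       = false
    member e (x ∷ es) = does (e ≟ x) ∨ member e es

    member-here : ∀ e es → member e (e ∷ es) ≡ true
    member-here e es with e ≟ e
    ... | yes _   = refl
    ... | no  e≢e = contradiction refl e≢e

    member-≢ : ∀ {e x} es → e ≢ x → member e (x ∷ es) ≡ member e es
    member-≢ {e} {x} es e≢x with e ≟ x
    ... | yes e≡x = contradiction e≡x e≢x
    ... | no  _   = refl

    member-∈ : ∀ {e es} → e ∈ es → member e es ≡ true
    member-∈ {e} {x ∷ es} e∈ with e ≟ x | e∈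
    ... | yes _   | _        = refl
    ... | no  e≢x | here e≡x = contradiction e≡x e≢x
    ... | no  _   | there e∈es = member-∈ e∈es

    member-fresh : ∀ {e es} → All (e ≢_) es → member e es ≡ false
    member-fresh []                 = refl
    member-fresh {es = _ ∷ es} (e≢x ∷ e≢es) = trans (member-≢ es e≢x) (member-fresh e≢es)

    -- Insertion at an arbitrary place, not just in front: the recursion of `𝔼` puts other elements
    -- before `e` on its way to it.
    Ignores : E → (List E → ℚ) → Set
    Ignores e f = ∀ xs ys → f (xs ++ e ∷ ys) ≡ f (xs ++ ys)

    member-ignores : ∀ {e e′} → e′ ≢ e → ∀ xs ys → member e′ (xs ++ e ∷ ys) ≡ member e′ (xs ++ ys)
    member-ignores e′≢e []       ys = member-≢ ys e′≢e
    member-ignores {e′ = e′} e′≢e (x ∷ xs) ys = cong (does (e′ ≟ x) ∨_) (member-ignores e′≢e xs ys)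

    if-ignores : ∀ {e e′ f g} → e′ ≢ e → Ignores e f → Ignores e g →
      Ignores e (λ es → if member e′ es then f es else g es)
    if-ignores {e} {e′} {f} {g} e′≢e f-ign g-ign xs ys = trans
      (cong (λ b → if b then f (xs ++ e ∷ ys) else g (xs ++ e ∷ ys)) (member-ignores e′≢e xs ys))
      (cong₂ (λ a b → if member e′ (xs ++ ys) then a else b) (f-ign xs ys) (g-ign xs ys))

    -- Conditioning on whether `e` is kept, which is independent of everything that `f` and `g` look
    -- at.
    𝔼-member : ∀ p {e L f g} → e ∈ L → Unique L → Ignores e f → Ignores e g →
      𝔼 p L (λ es → if member e es then f es else g es) ≡ p * 𝔼 p L f + (1ℚ - p) * 𝔼 p L g
    𝔼-member p {e} {.e ∷ L} {f} {g} (here refl) (e≢L ∷ _) f-ign g-ign = cong₂ (λ a b → p * a + (1ℚ - p) * b)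
      (trans (𝔼-cong p L λ es → trans (cong (λ b → if b then f (e ∷ es) else g (e ∷ es)) (member-here e es)) (f-ign [] es))
        (absorb f f-ign))
      (trans (𝔼-cong-All p e≢L λ {es} e≢es → cong (λ b → if b then f es else g es) (member-fresh e≢es))
        (absorb g g-ign))
      where
      absorb : ∀ f → Ignores e f → 𝔼 p L f ≡ p * 𝔼 p L (f ∘ (e ∷_)) + (1ℚ - p) * 𝔼 p L f
      absorb f f-ign = trans (solve 2 (λ p a → a := p :* a :+ (con 1ℚ :- p) :* a) refl p (𝔼 p L f))
        (cong (λ a → p * a + (1ℚ - p) * 𝔼 p L f) (sym (𝔼-cong p L (f-ign []))))
    𝔼-member p {e} {x ∷ L} {f} {g} (there e∈L) (x≢L ∷ L-unique) f-ign g-ign = begin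
      p * 𝔼 p L (λ es → if member e (x ∷ es) then f (x ∷ es) else g (x ∷ es))
        + (1ℚ - p) * 𝔼 p L (λ es → if member e es then f es else g es)
        ≡⟨ cong₂ (λ a b → p * a + (1ℚ - p) * b)
             (trans (𝔼-cong p L λ es → cong (λ b → if b then f (x ∷ es) else g (x ∷ es)) (member-≢ es e≢x))
               (𝔼-member p e∈L L-unique (λ xs → f-ign (x ∷ xs)) (λ xs → g-ign (x ∷ xs))))
             (𝔼-member p e∈L L-unique f-ign g-ign) ⟩
      p * (p * f₁ + (1ℚ - p) * g₁) + (1ℚ - p) * (p * f₀ + (1ℚ - p) * g₀)
        ≡⟨ solve 5 (λ p a b c d → p :* (p :* a :+ (con 1ℚ :- p) :* b) :+ (con 1ℚ :- p) :* (p :* c :+ (con 1ℚ :- p) :* d) :=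
             p :* (p :* a :+ (con 1ℚ :- p) :* c) :+ (con 1ℚ :- p) :* (p :* b :+ (con 1ℚ :- p) :* d)) refl p f₁ g₁ f₀ g₀ ⟩
      p * 𝔼 p (x ∷ L) f + (1ℚ - p) * 𝔼 p (x ∷ L) g
        ∎
      where
      open ≡-Reasoning
      f₀ f₁ g₀ g₁ : ℚ
      f₀ = 𝔼 p L f
      f₁ = 𝔼 p L (f ∘ (x ∷_))
      g₀ = 𝔼 p L g
      g₁ = 𝔼 p L (g ∘ (x ∷_))
      e≢x : e ≢ x
      e≢x e≡x = All.lookup x≢L e∈L (sym e≡x)

  ∑-cong-∈ : ∀ {A : Set} xs {f g : A → ℚ} → (∀ {x} → x ∈ xs → f x ≡ g x) → ∑ xs f ≡ ∑ xs g
  ∑-cong-∈ []       f≗g = refl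
  ∑-cong-∈ (x ∷ xs) f≗g = cong₂ _+_ (f≗g (here refl)) (∑-cong-∈ xs (f≗g ∘ there))

  module LinkCounting {V E : Set} (_≟_ : DecidableEquality V) (_≟ᴱ_ : DecidableEquality E) (edge : V → V → E) where

    open Words _≟_
    open WordBounds _≟_
    open Membership _≟ᴱ_

    -- A link i j is present directly if ij is an edge, and through v if vi and vj are edges.
    module _ (F : Word → ℚ) where

      direct : List Link → Word → List E → ℚ
      direct []             w es = F w
      direct ((i , j) ∷ ls) w es = if member (edge i j) es then direct ls (i ∷ j ∷ w) es else direct ls w es

      through : List Link → List V → Word → List E → ℚ
      through ls []       w es = direct ls w es
      through ls (v ∷ vs) w es = through ls vs w es + ∑ ls (λ (i , j) →
        if member (edge v i) es then (if member (edge v j) es then through ls vs (i ∷ j ∷ w) es else 0ℚ) else 0ℚ)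

      direct-mean : ℚ → List Link → Word → ℚ
      direct-mean p []             w = F w
      direct-mean p ((i , j) ∷ ls) w = p * direct-mean p ls (i ∷ j ∷ w) + (1ℚ - p) * direct-mean p ls w

      through-mean : ℚ → List Link → List V → Word → ℚ
      through-mean p ls []       w = direct-mean p ls w
      through-mean p ls (v ∷ vs) w = through-mean p ls vs w + extend (p * p , ls) (through-mean p ls vs) w

      0≤direct : (∀ w → 0ℚ ≤ F w) → ∀ ls w es → 0ℚ ≤ direct ls w es
      0≤direct 0≤F []             w es = 0≤F w
      0≤direct 0≤F ((i , j) ∷ ls) w es with member (edge i j) es
      ... | true  = 0≤direct 0≤F ls (i ∷ j ∷ w) es
      ... | false = 0≤direct 0≤F ls w es

      0≤through-term : ∀ ls vs → (∀ w es → 0ℚ ≤ through ls vs w es) → ∀ v w es ((i , j) : Link) →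
        0ℚ ≤ (if member (edge v i) es then (if member (edge v j) es then through ls vs (i ∷ j ∷ w) es else 0ℚ) else 0ℚ)
      0≤through-term ls vs 0≤th v w es (i , j) with member (edge v i) es | member (edge v j) es
      ... | true  | true  = 0≤th (i ∷ j ∷ w) es
      ... | true  | false = 0≤0
      ... | false | _     = 0≤0

      0≤through : (∀ w → 0ℚ ≤ F w) → ∀ ls vs w es → 0ℚ ≤ through ls vs w es
      0≤through 0≤F ls []       w es = 0≤direct 0≤F ls w es
      0≤through 0≤F ls (v ∷ vs) w es =
        0≤through 0≤F ls vs w es +⁰ 0≤∑ ls (0≤through-term ls vs (0≤through 0≤F ls vs) v w es)

      direct-ignores : ∀ {e} ls w → All (λ (i , j) → edge i j ≢ e) ls → Ignores e (direct ls w)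
      direct-ignores []             w []            xs ys = refl
      direct-ignores {e} ((i , j) ∷ ls) w (≢e ∷ ls≢e) =
        if-ignores {f = direct ls (i ∷ j ∷ w)} {direct ls w} ≢e (direct-ignores ls (i ∷ j ∷ w) ls≢e) (direct-ignores ls w ls≢e)

      through-ignores : ∀ {e} ls vs w → All (λ (i , j) → edge i j ≢ e) ls →
        All (λ v → All (λ (i , j) → edge v i ≢ e × edge v j ≢ e) ls) vs → Ignores e (through ls vs w)
      through-ignores ls []       w ls≢e []             = direct-ignores ls w ls≢e
      through-ignores {e} ls (v ∷ vs) w ls≢e (v≢e ∷ vs≢e) xs ys =
        cong₂ _+_ (through-ignores ls vs w ls≢e vs≢e xs ys) (terms v≢e)
        where
        term : List E → Link → ℚ
        term es (i , j) =
          if member (edge v i) es then (if member (edge v j) es then through ls vs (i ∷ j ∷ w) es else 0ℚ) else 0ℚ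
        terms : ∀ {ms} → All (λ (i , j) → edge v i ≢ e × edge v j ≢ e) ms →
          ∑ ms (term (xs ++ e ∷ ys)) ≡ ∑ ms (term (xs ++ ys))
        terms []                              = refl
        terms {(i , j) ∷ ms} ((i≢ , j≢) ∷ ≢e) = cong₂ _+_
          (if-ignores {f = λ es → if member (edge v j) es then through ls vs (i ∷ j ∷ w) es else 0ℚ} {λ _ → 0ℚ} i≢
            (if-ignores {f = through ls vs (i ∷ j ∷ w)} {λ _ → 0ℚ} j≢
              (through-ignores ls vs (i ∷ j ∷ w) ls≢e vs≢e) (λ _ _ → refl)) (λ _ _ → refl) xs ys)
          (terms ≢e)

      module _ {L : List E} (L-unique : Unique L) (edge∈ : ∀ {u v} → u ≢ v → edge u v ∈ L)
        (edge-injective : ∀ {a b c d} → edge a b ≡ edge c d → (a ≡ c × b ≡ d) ⊎ (a ≡ d × b ≡ c))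
        where

        Distinct : Link → Set
        Distinct (i , j) = i ≢ j

        DifferentEdges : Link → Link → Set
        DifferentEdges (i , j) (k , l) = edge k l ≢ edge i j

        𝔼-direct : ∀ p {ls} → All Distinct ls → AllPairs DifferentEdges ls → ∀ w →
          𝔼 p L (direct ls w) ≡ direct-mean p ls w
        𝔼-direct p []             []             w = 𝔼-const p L (F w)
        𝔼-direct p {(i , j) ∷ ls} (i≢j ∷ ls-distinct) (ij-new ∷ ls-new) w = trans
          (𝔼-member p {f = direct ls (i ∷ j ∷ w)} {direct ls w} (edge∈ i≢j) L-unique
            (direct-ignores ls (i ∷ j ∷ w) ij-new) (direct-ignores ls w ij-new))
          (cong₂ (λ a b → p * a + (1ℚ - p) * b)
            (𝔼-direct p ls-distinct ls-new (i ∷ j ∷ w)) (𝔼-direct p ls-distinct ls-new w))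

        -- The edges vi and vj differ from each other, from the links inside the core and from all
        -- edges at the remaining outer vertices. So `𝔼-member` applies to each of them and together
        -- they contribute p².
        𝔼-through : ∀ p {ls} → All Distinct ls → AllPairs DifferentEdges ls → ∀ {vs} → Unique vs →
          All (λ v → All (λ (i , j) → v ≢ i × v ≢ j) ls) vs → ∀ w →
          𝔼 p L (through ls vs w) ≡ through-mean p ls vs w
        𝔼-through p ls-distinct ls-new []                         []               w = 𝔼-direct p ls-distinct ls-new w
        𝔼-through p {ls} ls-distinct ls-new {v ∷ vs} (v≢vs ∷ vs-unique) (v∉ls ∷ vs∉ls) w = trans
          (𝔼-+ p L (through ls vs w) (λ es → ∑ ls (λ l → term l es)))
          (cong₂ _+_ (mean w) (trans (𝔼-∑ p L ls term) (trans (∑-cong-∈ ls terms)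
            (∑-*ˡ ls (p * p) (λ (i , j) → through-mean p ls vs (i ∷ j ∷ w))))))
          where
          mean : ∀ w → 𝔼 p L (through ls vs w) ≡ through-mean p ls vs w
          mean = 𝔼-through p ls-distinct ls-new vs-unique vs∉ls
          term : Link → List E → ℚ
          term (i , j) es =
            if member (edge v i) es then (if member (edge v j) es then through ls vs (i ∷ j ∷ w) es else 0ℚ) else 0ℚ
          ls≢ : ∀ i → All (λ (k , l) → edge k l ≢ edge v i) ls
          ls≢ i = All.map (λ (v≢k , v≢l) e → different v≢k v≢l (edge-injective e)) v∉ls
            where
            different : ∀ {k l} → v ≢ k → v ≢ l → ¬ ((k ≡ v × l ≡ i) ⊎ (k ≡ i × l ≡ v))
            different v≢k v≢l (inj₁ (k≡v , _)) = v≢k (sym k≡v)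
            different v≢k v≢l (inj₂ (_ , l≡v)) = v≢l (sym l≡v)
          vs≢ : ∀ {i} → All (_≢ i) vs →
            All (λ v′ → All (λ (k , l) → edge v′ k ≢ edge v i × edge v′ l ≢ edge v i) ls) vs
          vs≢ {i} vs≢i = All.zipWith (λ (v≢v′ , v′≢i) → All.universal (λ _ →
            different v≢v′ v′≢i ∘ edge-injective , different v≢v′ v′≢i ∘ edge-injective) ls) (v≢vs , vs≢i)
            where
            different : ∀ {v′ k} → v ≢ v′ → v′ ≢ i → ¬ ((v′ ≡ v × k ≡ i) ⊎ (v′ ≡ i × k ≡ v))
            different v≢v′ v′≢i (inj₁ (v′≡v , _)) = v≢v′ (sym v′≡v)
            different v≢v′ v′≢i (inj₂ (v′≡i , _)) = v′≢i v′≡i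
          second : ∀ {i j} → (i , j) ∈ ls → 𝔼 p L (λ es → if member (edge v j) es then through ls vs (i ∷ j ∷ w) es else 0ℚ)
            ≡ p * through-mean p ls vs (i ∷ j ∷ w)
          second {i} {j} ij∈ls = trans
            (𝔼-member p {f = through ls vs (i ∷ j ∷ w)} {λ _ → 0ℚ} (edge∈ (proj₂ (All.lookup v∉ls ij∈ls))) L-unique
              (through-ignores ls vs (i ∷ j ∷ w) (ls≢ j) (vs≢ (All.map (λ a → proj₂ (All.lookup a ij∈ls)) vs∉ls)))
              (λ _ _ → refl))
            (trans (cong₂ (λ a b → p * a + (1ℚ - p) * b) (mean (i ∷ j ∷ w)) (𝔼-const p L 0ℚ))
              (solve 2 (λ p a → p :* a :+ (con 1ℚ :- p) :* con 0ℚ := p :* a) refl p (through-mean p ls vs (i ∷ j ∷ w))))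
          terms : ∀ {l} → l ∈ ls → 𝔼 p L (term l) ≡ p * p * through-mean p ls vs (proj₁ l ∷ proj₂ l ∷ w)
          terms {i , j} ij∈ls = trans
            (𝔼-member p {f = λ es → if member (edge v j) es then through ls vs (i ∷ j ∷ w) es else 0ℚ} {λ _ → 0ℚ}
              (edge∈ (proj₁ (All.lookup v∉ls ij∈ls))) L-unique
              (if-ignores {f = through ls vs (i ∷ j ∷ w)} {λ _ → 0ℚ} vj≢vi
                (through-ignores ls vs (i ∷ j ∷ w) (ls≢ i) (vs≢ (All.map (λ a → proj₁ (All.lookup a ij∈ls)) vs∉ls)))
                (λ _ _ → refl))
              (λ _ _ → refl))
            (trans (cong₂ (λ a b → p * a + (1ℚ - p) * b) (second ij∈ls) (𝔼-const p L 0ℚ))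
              (solve 2 (λ p a → p :* (p :* a) :+ (con 1ℚ :- p) :* con 0ℚ := p :* p :* a) refl p (through-mean p ls vs (i ∷ j ∷ w))))
            where
            vj≢vi : edge v j ≢ edge v i
            vj≢vi e with edge-injective e
            ... | inj₁ (_ , j≡i) = All.lookup ls-distinct ij∈ls (sym j≡i)
            ... | inj₂ (v≡i , _) = proj₁ (All.lookup v∉ls ij∈ls) v≡i

-- The expected number of cores

module CoreMeans where

  open Rationals
  open FactorialSeries
  open EvenSeries
  open MomentFunctional
  open WordCounting
  open Links
  open Expectation
  open import Data.List.Membership.Propositional using (_∈_)
  open import Data.Rational
  open import Data.Rational.Properties hiding (_≟_)
  open import Data.Rational.Solver using (module +-*-Solver)
  open +-*-Solver using (solve; con; _:+_; _:*_; _:-_; :-_; _:=_)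

  All-pairsOf : ∀ {A : Set} {Q : A → Set} {xs} → All Q xs → All (λ (x , y) → Q x × Q y) (pairsOf xs)
  All-pairsOf []       = []
  All-pairsOf (q ∷ qs) = Allₚ.++⁺ (Allₚ.map⁺ (All.map (q ,_) qs)) (All-pairsOf qs)

  pairsOf-distinct : ∀ {A : Set} {xs : List A} → Unique xs → All (λ (x , y) → x ≢ y) (pairsOf xs)
  pairsOf-distinct []             = []
  pairsOf-distinct (x≢xs ∷ unique) = Allₚ.++⁺ (Allₚ.map⁺ x≢xs) (pairsOf-distinct unique)

  pairsOf-different : ∀ {A E : Set} (edge : A → A → E) →
    (∀ {a b c d} → edge a b ≡ edge c d → (a ≡ c × b ≡ d) ⊎ (a ≡ d × b ≡ c)) →
    ∀ {xs} → Unique xs → AllPairs (λ (i , j) (k , l) → edge k l ≢ edge i j) (pairsOf xs)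
  pairsOf-different edge injective []                              = []
  pairsOf-different edge injective {x ∷ xs} (x≢xs ∷ xs-unique) = AllPairsₚ.++⁺
    (AllPairsₚ.map⁺ (row x≢xs xs-unique))
    (pairsOf-different edge injective xs-unique)
    (Allₚ.map⁺ (All.map (λ _ → All.map (λ (x≢k , x≢l) e → apart x≢k x≢l (injective e)) (All-pairsOf x≢xs)) x≢xs))
    where
    apart : ∀ {k l y} → x ≢ k → x ≢ l → ¬ ((k ≡ x × l ≡ y) ⊎ (k ≡ y × l ≡ x))
    apart x≢k x≢l (inj₁ (k≡x , _)) = x≢k (sym k≡x)
    apart x≢k x≢l (inj₂ (_ , l≡x)) = x≢l (sym l≡x)
    row : ∀ {ys} → All (x ≢_) ys → Unique ys → AllPairs (λ y z → edge x z ≢ edge x y) ys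
    row []            []                  = []
    row (x≢y ∷ x≢ys) (y≢ys ∷ ys-unique) =
      All.map (λ y≢z e → same x≢y y≢z (injective e)) y≢ys ∷ row x≢ys ys-unique
      where
      same : ∀ {y z} → x ≢ y → y ≢ z → ¬ ((x ≡ x × z ≡ y) ⊎ (x ≡ y × z ≡ x))
      same x≢y y≢z (inj₁ (_ , z≡y)) = y≢z (sym z≡y)
      same x≢y y≢z (inj₂ (x≡y , _)) = x≢y x≡y

  splits : ∀ {A : Set} → List A → List (List A × List A)
  splits []       = ([] , []) ∷ []
  splits (x ∷ xs) = map (λ (us , vs) → x ∷ us , vs) (splits xs) ++ map (λ (us , vs) → us , x ∷ vs) (splits xs)

  record IsSplit {A : Set} (n : ℕ) (s : List A × List A) : Set where
    field
      left-unique  : Unique (proj₁ s)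
      right-unique : Unique (proj₂ s)
      disjoint     : All (λ v → All (v ≢_) (proj₁ s)) (proj₂ s)
      lengths      : length (proj₁ s) ℕ.+ length (proj₂ s) ≡ n
  open IsSplit

  splits-All : ∀ {A : Set} {Q : A → Set} {xs} → All Q xs → All (λ (us , vs) → All Q us × All Q vs) (splits xs)
  splits-All []       = ([] , []) ∷ []
  splits-All (q ∷ qs) = Allₚ.++⁺
    (Allₚ.map⁺ (All.map (λ (us , vs) → q ∷ us , vs) (splits-All qs)))
    (Allₚ.map⁺ (All.map (λ (us , vs) → us , q ∷ vs) (splits-All qs)))

  splits-IsSplit : ∀ {A : Set} {xs : List A} → Unique xs → All (IsSplit (length xs)) (splits xs)
  splits-IsSplit []                = record { left-unique = [] ; right-unique = [] ; disjoint = [] ; lengths = refl } ∷ []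
  splits-IsSplit (x≢xs ∷ xs-unique) = Allₚ.++⁺
    (Allₚ.map⁺ (All.zipWith (λ ((x≢us , x≢vs) , s) → record
      { left-unique  = x≢us ∷ left-unique s
      ; right-unique = right-unique s
      ; disjoint     = All.zipWith (λ (x≢v , v≢us) → (λ v≡x → x≢v (sym v≡x)) ∷ v≢us) (x≢vs , disjoint s)
      ; lengths      = cong suc (lengths s) }) (splits-All x≢xs , splits-IsSplit xs-unique)))
    (Allₚ.map⁺ (All.zipWith (λ {p} ((x≢us , x≢vs) , s) → record
      { left-unique  = left-unique s
      ; right-unique = x≢vs ∷ right-unique s
      ; disjoint     = x≢us ∷ disjoint s
      ; lengths      = trans (ℕₚ.+-suc (length (proj₁ p)) (length (proj₂ p))) (cong suc (lengths s)) })
      (splits-All x≢xs , splits-IsSplit xs-unique)))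

  -- falling n r = n (n - 1) ⋯ (n - r + 1), by its Pascal recursion.
  falling : ℕ → ℕ → ℚ
  falling n       zero    = 1ℚ
  falling zero    (suc r) = 0ℚ
  falling (suc n) (suc r) = falling n (suc r) + ι (suc r) * falling n r

  0≤falling : ∀ n r → 0ℚ ≤ falling n r
  0≤falling n       zero    = 0≤1
  0≤falling zero    (suc r) = 0≤0
  0≤falling (suc n) (suc r) = 0≤falling n (suc r) +⁰ 0≤ι (suc r) *⁰ 0≤falling n r

  falling-suc : ∀ n r → falling n (suc r) ≡ falling n r * (ι n - ι r)
  falling-suc zero    zero    = refl
  falling-suc zero    (suc r) = sym (*-zeroˡ (ι 0 - ι (suc r)))
  falling-suc (suc n) r       = begin
    falling n (suc r) + ι (suc r) * falling n r
      ≡⟨ falling-suc-suc n r ⟩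
    falling n r * ι (suc n)
      ≡⟨ last r ⟩
    falling (suc n) r * (ι (suc n) - ι r)
      ∎
    where
    open ≡-Reasoning
    falling-suc-suc : ∀ n r → falling n (suc r) + ι (suc r) * falling n r ≡ falling n r * ι (suc n)
    falling-suc-suc n r = trans (cong₂ (λ x y → x + y * falling n r) (falling-suc n r) (ι-suc r))
      (trans (solve 3 (λ f n r → f :* (n :- r) :+ (con 1ℚ :+ r) :* f := f :* (con 1ℚ :+ n)) refl (falling n r) (ι n) (ι r))
        (cong (falling n r *_) (sym (ι-suc n))))
    last : ∀ r → falling n r * ι (suc n) ≡ falling (suc n) r * (ι (suc n) - ι r)
    last zero    = solve 1 (λ n → con 1ℚ :* n := con 1ℚ :* (n :- con 0ℚ)) refl (ι (suc n))
    last (suc r) = trans (cong (_* ι (suc n)) (falling-suc n r))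
      (trans (trans (solve 4 (λ f n r m → f :* (n :- r) :* m := f :* m :* ((con 1ℚ :+ n) :- (con 1ℚ :+ r))) refl
          (falling n r) (ι n) (ι r) (ι (suc n)))
        (cong₂ (λ x y → falling n r * ι (suc n) * (x - y)) (sym (ι-suc n)) (sym (ι-suc r))))
        (cong (_* (ι (suc n) - ι (suc r))) (sym (falling-suc-suc n r))))

  ∑<-widen-0 : ∀ n {f} → f n ≡ 0ℚ → ∑< (suc n) f ≡ ∑< n f
  ∑<-widen-0 n {f} fn≡0 = trans (∑<-last n f) (trans (cong (∑< n f +_) fn≡0) (+-identityʳ _))

  falling-beyond : ∀ n → falling n (suc n) ≡ 0ℚ
  falling-beyond n = trans (falling-suc n n) (trans (cong (falling n n *_) (+-inverseʳ (ι n))) (*-zeroʳ (falling n n)))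

  -- Of the splits, n choose r have a left part of size r, and this number times r! is
  -- `falling n r`. The factor r! is supplied by the bound on the mean of a single core.
  ∑-splits : ∀ {A : Set} (xs : List A) (g : ℕ → ℚ) →
    ∑ (splits xs) (λ (us , vs) → g (length us) * fac (length us)) ≡ ∑< (suc (length xs)) (λ r → falling (length xs) r * g r)
  ∑-splits []       g = solve 1 (λ g → g :* con 1ℚ :+ con 0ℚ := con 1ℚ :* g :+ con 0ℚ) refl (g 0)
  ∑-splits (x ∷ xs) g = begin
    ∑ (map (λ (us , vs) → x ∷ us , vs) (splits xs) ++ map (λ (us , vs) → us , x ∷ vs) (splits xs)) f
      ≡⟨ trans (∑-++ (map _ (splits xs)) (map _ (splits xs)) f)
           (cong₂ _+_ (∑-map (λ (us , vs) → x ∷ us , vs) (splits xs) f) (∑-map (λ (us , vs) → us , x ∷ vs) (splits xs) f)) ⟩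
    ∑ (splits xs) (λ (us , vs) → g (suc (length us)) * (ι (suc (length us)) * fac (length us))) + ∑ (splits xs) f
      ≡⟨ cong₂ _+_
           (trans (∑-cong (splits xs) λ (us , vs) → sym (*-assoc (g (suc (length us))) (ι (suc (length us))) (fac (length us))))
             (∑-splits xs (λ r → g (suc r) * ι (suc r))))
           (∑-splits xs g) ⟩
    ∑< (suc n) (λ r → falling n r * (g (suc r) * ι (suc r))) + (falling n 0 * g 0 + ∑< n (λ r → falling n (suc r) * g (suc r)))
      ≡⟨ cong (λ z → ∑< (suc n) (λ r → falling n r * (g (suc r) * ι (suc r))) + (1ℚ * g 0 + z)) (sym (∑<-widen-0 n
           (trans (cong (_* g (suc n)) (falling-beyond n)) (*-zeroˡ (g (suc n)))))) ⟩
    ∑< (suc n) (λ r → falling n r * (g (suc r) * ι (suc r))) + (1ℚ * g 0 + ∑< (suc n) (λ r → falling n (suc r) * g (suc r)))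
      ≡⟨ solve 3 (λ a b c → a :+ (b :+ c) := b :+ (c :+ a)) refl
           (∑< (suc n) (λ r → falling n r * (g (suc r) * ι (suc r)))) (1ℚ * g 0) (∑< (suc n) (λ r → falling n (suc r) * g (suc r))) ⟩
    1ℚ * g 0 + (∑< (suc n) (λ r → falling n (suc r) * g (suc r)) + ∑< (suc n) (λ r → falling n r * (g (suc r) * ι (suc r))))
      ≡⟨ cong (λ z → 1ℚ * g 0 + z) (trans
             (sym (∑<-+ (suc n) (λ r → falling n (suc r) * g (suc r)) (λ r → falling n r * (g (suc r) * ι (suc r)))))
             (∑<-cong (suc n) λ r →
           solve 4 (λ a g i b → a :* g :+ b :* (g :* i) := (a :+ i :* b) :* g) refl
             (falling n (suc r)) (g (suc r)) (ι (suc r)) (falling n r))) ⟩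
    ∑< (suc (suc n)) (λ r → falling (suc n) r * g r)
      ∎
    where
    open ≡-Reasoning
    n = length xs
    f : List _ × List _ → ℚ
    f (us , vs) = g (length us) * fac (length us)

  module Cores {V E : Set} (_≟_ : DecidableEquality V) (_≟ᴱ_ : DecidableEquality E) (edge : V → V → E) where

    open Words _≟_
    open WordBounds _≟_
    open LinkCounting _≟_ _≟ᴱ_ edge

    _⊑_ : Word → Word → Set
    w ⊑ w′ = ∀ u → count u w ℕ.≤ count u w′

    atLeast₃-mono : ∀ {c d} → c ℕ.≤ d → atLeast₃ c ≤ atLeast₃ d
    atLeast₃-mono {zero}                {d} _ = 0≤atLeast₃ d
    atLeast₃-mono {suc zero}            {d} _ = 0≤atLeast₃ d
    atLeast₃-mono {suc (suc zero)}      {d} _ = 0≤atLeast₃ d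
    atLeast₃-mono {suc (suc (suc c))} (ℕ.s≤s (ℕ.s≤s (ℕ.s≤s _))) = ≤-refl

    saturated-mono : ∀ us {w w′} → w ⊑ w′ → saturated us w ≤ saturated us w′
    saturated-mono []            w⊑w′ = ≤-refl
    saturated-mono (u ∷ us) {w} {w′} w⊑w′ = *-mono (0≤atLeast₃ (count u w)) (0≤saturated us w′)
      (atLeast₃-mono (w⊑w′ u)) (saturated-mono us {w} {w′} w⊑w′)

    module _ {F : Word → ℚ} (0≤F : ∀ w → 0ℚ ≤ F w) (F-mono : ∀ {w w′} → w ⊑ w′ → F w ≤ F w′)
      {p q : ℚ} (0≤p : 0ℚ ≤ p) (p≤q : p ≤ q) (q≤1 : q ≤ 1ℚ) where

      0≤direct-mean : ∀ ls w → 0ℚ ≤ direct-mean F p ls w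
      0≤direct-mean []             w = 0≤F w
      0≤direct-mean ((i , j) ∷ ls) w =
        0≤p *⁰ 0≤direct-mean ls (i ∷ j ∷ w) +⁰ 0≤- (≤-trans p≤q q≤1) *⁰ 0≤direct-mean ls w

      direct-mean-monoʷ : ∀ ls {w w′} → w ⊑ w′ → direct-mean F q ls w ≤ direct-mean F q ls w′
      direct-mean-monoʷ []             w⊑w′ = F-mono w⊑w′
      direct-mean-monoʷ ((i , j) ∷ ls) w⊑w′ = +-mono-≤
        (*-monoˡ (≤-trans 0≤p p≤q) (direct-mean-monoʷ ls λ u → ℕₚ.+-monoʳ-≤ (occurs u i) (ℕₚ.+-monoʳ-≤ (occurs u j) (w⊑w′ u))))
        (*-monoˡ (0≤- q≤1) (direct-mean-monoʷ ls w⊑w′))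

      -- Raising p to q moves weight from the absence of an edge to its presence, and a longer word
      -- cannot lower a monotone `F`. This replacement has to come before (1 - q) is factored out,
      -- since that factor by itself decreases in q.
      direct-mean-mono : ∀ ls w → direct-mean F p ls w ≤ direct-mean F q ls w
      direct-mean-mono []             w = ≤-refl
      direct-mean-mono ((i , j) ∷ ls) w = begin
        p * direct-mean F p ls (i ∷ j ∷ w) + (1ℚ - p) * direct-mean F p ls w
          ≤⟨ +-mono-≤ (*-monoˡ 0≤p (direct-mean-mono ls (i ∷ j ∷ w)))
               (*-monoˡ (0≤- (≤-trans p≤q q≤1)) (direct-mean-mono ls w)) ⟩
        p * a + (1ℚ - p) * b
          ≤⟨ ≤-by {s = (q - p) * (a - b)}
               (solve 4 (λ p q a b → q :* a :+ (con 1ℚ :- q) :* b := p :* a :+ (con 1ℚ :- p) :* b :+ (q :- p) :* (a :- b)) refl p q a b)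
               (0≤- p≤q *⁰ 0≤- (direct-mean-monoʷ ls λ u → ℕₚ.≤-trans (ℕₚ.m≤n+m _ (occurs u j)) (ℕₚ.m≤n+m _ (occurs u i)))) ⟩
        q * a + (1ℚ - q) * b
          ∎
        where
        open ≤-Reasoning
        a b : ℚ
        a = direct-mean F q ls (i ∷ j ∷ w)
        b = direct-mean F q ls w

      0≤through-mean : ∀ ls vs w → 0ℚ ≤ through-mean F p ls vs w
      0≤through-mean ls []       w = 0≤direct-mean ls w
      0≤through-mean ls (v ∷ vs) w =
        0≤through-mean ls vs w +⁰ 0≤extend {p * p , ls} (0≤p *⁰ 0≤p) (0≤through-mean ls vs) w

      through-mean-mono : ∀ ls vs w → through-mean F p ls vs w ≤ through-mean F q ls vs w
      through-mean-mono ls []       w = direct-mean-mono ls w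
      through-mean-mono ls (v ∷ vs) w = +-mono-≤ (through-mean-mono ls vs w)
        (*-mono (0≤p *⁰ 0≤p) (0≤∑ ls λ (i , j) → ≤-trans (0≤through-mean ls vs (i ∷ j ∷ w)) (through-mean-mono ls vs (i ∷ j ∷ w)))
          (*-mono 0≤p (≤-trans 0≤p p≤q) p≤q p≤q) (∑-mono ls λ (i , j) → through-mean-mono ls vs (i ∷ j ∷ w)))

    module _ (F : Word → ℚ) {q z : ℚ} (q≡ : q ≡ (1ℚ - q) * z) where

      -- With 1 - q taken out for every link, a present link keeps the odds z = q/(1 - q). The power
      -- of 1 - q is retained because cores of linear size cannot be excluded without it.
      direct-mean-choices : ∀ ls w →
        direct-mean F q ls w ≡ (1ℚ - q) ^ length ls * choices (map (λ l → z , l ∷ []) ls) F w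
      direct-mean-choices []             w = sym (*-identityˡ (F w))
      direct-mean-choices ((i , j) ∷ ls) w = begin
        q * direct-mean F q ls (i ∷ j ∷ w) + (1ℚ - q) * direct-mean F q ls w
          ≡⟨ cong₂ _+_ (cong₂ _*_ q≡ (direct-mean-choices ls (i ∷ j ∷ w))) (cong ((1ℚ - q) *_) (direct-mean-choices ls w)) ⟩
        (1ℚ - q) * z * (x * a) + (1ℚ - q) * (x * b)
          ≡⟨ solve 5 (λ y z x a b → y :* z :* (x :* a) :+ y :* (x :* b) := y :* x :* (b :+ z :* (a :+ con 0ℚ))) refl (1ℚ - q) z x a b ⟩
        (1ℚ - q) * x * (b + z * (a + 0ℚ))
          ∎
        where
        open ≡-Reasoning
        x a b : ℚ
        x = (1ℚ - q) ^ length ls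
        a = choices (map (λ l → z , l ∷ []) ls) F (i ∷ j ∷ w)
        b = choices (map (λ l → z , l ∷ []) ls) F w

      through-mean-choices : ∀ ls vs w →
        through-mean F q ls vs w ≡ (1ℚ - q) ^ length ls * choices (cells (q * q) z ls vs) F w
      through-mean-choices ls []       w = direct-mean-choices ls w
      through-mean-choices ls (v ∷ vs) w = trans
        (cong₂ _+_ (through-mean-choices ls vs w) (trans
          (extend-cong (q * q , ls) (through-mean-choices ls vs) w)
          (extend-*ˡ (q * q , ls) ((1ℚ - q) ^ length ls) (choices (cells (q * q) z ls vs) F) w)))
        (sym (*-distribˡ-+ ((1ℚ - q) ^ length ls) _ _))

    -- An upper bound for the indicator of the event that us is a core.
    core : List V × List V → List E → ℚ
    core ([] , vs)         es = 0ℚ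
    core (us@(_ ∷ _) , vs) es = through (saturated us) (pairsOf us) vs [] es

    0≤core : ∀ s es → 0ℚ ≤ core s es
    0≤core ([] , vs)         es = 0≤0
    0≤core (us@(_ ∷ _) , vs) es = 0≤through (saturated us) (0≤saturated us) (pairsOf us) vs [] es

    cores : List V → List E → ℚ
    cores xs es = ∑ (splits xs) (λ s → core s es)

    module _ {L : List E} (L-unique : Unique L) (edge∈ : ∀ {u v} → u ≢ v → edge u v ∈ L)
      (edge-injective : ∀ {a b c d} → edge a b ≡ edge c d → (a ≡ c × b ≡ d) ⊎ (a ≡ d × b ≡ c))
      {p q z : ℚ} (0≤p : 0ℚ ≤ p) (p≤q : p ≤ q) (q≤1 : q ≤ 1ℚ) (0≤z : 0ℚ ≤ z) (q≡ : q ≡ (1ℚ - q) * z)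
      {n : ℕ} (β : ℕ → ℚ) (0≤β : ∀ r → 0ℚ ≤ β r)
      (≤β : ∀ r m N → suc r ℕ.+ m ≡ n →
        (1ℚ - q) ^ triangle (suc r) * ∑< (4 ℕ.+ N) (λ s → expTail₃^ (suc r) (double s) *
          even ((ι m * (q * q) + z) + (ι m * (q * q) + z)) s) ≤ β (suc r) * fac (suc r))
      where

      𝔼-core : ∀ {s} → IsSplit n s → 𝔼 p L (core s) ≤ β (length (proj₁ s)) * fac (length (proj₁ s))
      𝔼-core {[] , vs}         s = ≤-trans (≤-reflexive (𝔼-const p L 0ℚ)) (0≤β 0 *⁰ 0≤1)
      𝔼-core {us@(_ ∷ us′) , vs} s = begin
        𝔼 p L (through F ls vs [])
          ≡⟨ 𝔼-through F L-unique edge∈ edge-injective p (pairsOf-distinct (left-unique s))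
               (pairsOf-different edge edge-injective (left-unique s)) (right-unique s)
               (All.map All-pairsOf (disjoint s)) [] ⟩
        through-mean F p ls vs []
          ≤⟨ through-mean-mono (0≤saturated us) (λ {w} {w′} → saturated-mono us {w} {w′}) 0≤p p≤q q≤1 ls vs [] ⟩
        through-mean F q ls vs []
          ≡⟨ through-mean-choices F q≡ ls vs [] ⟩
        (1ℚ - q) ^ length ls * choices (cells (q * q) z ls vs) F []
          ≡⟨ cong (λ k → (1ℚ - q) ^ k * choices (cells (q * q) z ls vs) F []) (length-pairsOf us) ⟩
        (1ℚ - q) ^ triangle (length us) * choices (cells (q * q) z ls vs) F []
          -- More terms than the `suc N` that the number of cells asks for: the analytic bound is
          -- available only for at least four.
          ≤⟨ *-monoˡ (0≤^ (triangle (length us)) (0≤- q≤1))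
               (choices-cells≤even (left-unique s) (0≤q *⁰ 0≤q) 0≤z vs (4 ℕ.+ N) (ℕₚ.m≤n+m (suc N) 3)) ⟩
        (1ℚ - q) ^ triangle (length us) * ∑< (4 ℕ.+ N) (λ k → expTail₃^ (length us) (double k) * even (P + P) k)
          ≤⟨ ≤β (length us′) (length vs) N (lengths s) ⟩
        β (length us) * fac (length us)
          ∎
        where
        open ≤-Reasoning
        F : Word → ℚ
        F = saturated us
        ls : List Link
        ls = pairsOf us
        P : ℚ
        P = ι (length vs) * (q * q) + z
        N : ℕ
        N = length (cells (q * q) z ls vs)
        0≤q : 0ℚ ≤ q
        0≤q = ≤-trans 0≤p p≤q

      𝔼-cores : ∀ {xs} → Unique xs → length xs ≡ n → 𝔼 p L (cores xs) ≤ ∑< (suc n) (λ r → falling n r * β r)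
      𝔼-cores {xs} xs-unique refl = begin
        𝔼 p L (cores xs)
          ≡⟨ 𝔼-∑ p L (splits xs) core ⟩
        ∑ (splits xs) (λ s → 𝔼 p L (core s))
          ≤⟨ ∑-mono-All (splits-IsSplit xs-unique) ⟩
        ∑ (splits xs) (λ s → β (length (proj₁ s)) * fac (length (proj₁ s)))
          ≡⟨ ∑-splits xs β ⟩
        ∑< (suc n) (λ r → falling n r * β r)
          ∎
        where
        open ≤-Reasoning
        ∑-mono-All : ∀ {ss} → All (IsSplit n) ss →
          ∑ ss (λ s → 𝔼 p L (core s)) ≤ ∑ ss (λ s → β (length (proj₁ s)) * fac (length (proj₁ s)))
        ∑-mono-All []                  = ≤-refl
        ∑-mono-All (split ∷ are-splits) = +-mono-≤ (𝔼-core split) (∑-mono-All are-splits)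

-- Numerical inequalities

module Inequalities where

  open Rationals
  open FactorialSeries
  open Links
  open CoreMeans
  open import Data.Rational
  open import Data.Rational.Properties hiding (_≟_)
  open import Data.Rational.Solver using (module +-*-Solver)
  open +-*-Solver using (solve; con; _:+_; _:*_; _:-_; :-_; _:=_)

  infix 9 _%_

  _%_ : ℕ → (d : ℕ) → .{{_ : ℕ.NonZero d}} → ℚ
  n % d = ℤ.+ n / d

  0≤% : ∀ n d .{{_ : ℕ.NonZero d}} → 0ℚ ≤ n % d
  0≤% n d = nonNegative⁻¹ _ {{normalize-nonNeg n d}}

  -- The decay per vertex of the bound for large cores; its inverse is 1 + 1/49.
  q₀ : ℚ
  q₀ = 49 % 50

  -- ρ is the proportion of core vertices, and c/n an upper bound for the probability of a link.
  core-inequality : ∀ {ρ} → 0ℚ ≤ ρ → ρ ≤ 1ℚ → let c = 121 % 100 * (1ℚ - ρ) + 1102 % 1000 in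
    38 % 100 * c ≤ q₀ * ((997 % 1000 + 105 % 100 * ρ + 55 % 100 * (ρ * ρ)) * (1ℚ - 68 % 100 * ρ * c))
  core-inequality {ρ} 0≤ρ ρ≤1 = ≤-by
    (solve 1 (λ ρ → let c = con (121 % 100) :* (con 1ℚ :- ρ) :+ con (1102 % 1000) in
      con q₀ :* ((con (997 % 1000) :+ con (105 % 100) :* ρ :+ con (55 % 100) :* (ρ :* ρ)) :* (con 1ℚ :- con (68 % 100) :* ρ :* c))
      := con (38 % 100) :* c :+
        (con k₁ :* ((ρ :* ρ :- con (36 % 100)) :* (ρ :* ρ :- con (36 % 100)))
          :+ (con k₂ :* ((ρ :- con (3 % 5)) :* (ρ :- con (3 % 5)))
          :+ (con k₃ :* (ρ :* ρ :* (con 1ℚ :- ρ))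
          :+ (con k₄ :* (ρ :* ρ) :+ con k₅))))) refl ρ)
    (0≤k₁ *⁰ square-nonNeg (ρ * ρ - 36 % 100) +⁰ (0≤k₂ *⁰ square-nonNeg (ρ - 3 % 5)
      +⁰ (0≤k₃ *⁰ ((0≤ρ *⁰ 0≤ρ) *⁰ 0≤- ρ≤1) +⁰ (0≤k₄ *⁰ (0≤ρ *⁰ 0≤ρ) +⁰ 0≤k₅))))
    where
    k₁ k₂ k₃ k₄ k₅ : ℚ
    k₁ = 1108723 % 2500000
    k₂ = 2463263 % 62500000
    k₃ = 9163 % 12500000
    k₄ = 542413 % 125000000
    k₅ = 524129 % 19531250
    0≤k₁ : 0ℚ ≤ k₁
    0≤k₁ = nonNegative⁻¹ k₁
    0≤k₂ : 0ℚ ≤ k₂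
    0≤k₂ = nonNegative⁻¹ k₂
    0≤k₃ : 0ℚ ≤ k₃
    0≤k₃ = nonNegative⁻¹ k₃
    0≤k₄ : 0ℚ ≤ k₄
    0≤k₄ = nonNegative⁻¹ k₄
    0≤k₅ : 0ℚ ≤ k₅
    0≤k₅ = nonNegative⁻¹ k₅

  -- The right side has its minimum, about 0.249, near ρ = 0.955, which explains the centre 95/100
  -- of the square.
  denominator-inequality : ∀ {ρ} → 0ℚ ≤ ρ → ρ ≤ 1ℚ → let c = 121 % 100 * (1ℚ - ρ) + 1102 % 1000 in
    1 % 5 ≤ 1ℚ - 68 % 100 * ρ * c
  denominator-inequality {ρ} 0≤ρ ρ≤1 = ≤-by
    (solve 1 (λ ρ → con 1ℚ :- con (68 % 100) :* ρ :* (con (121 % 100) :* (con 1ℚ :- ρ) :+ con (1102 % 1000))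
      := con (1 % 5) :+ (con (8228 % 10000) :* ((ρ :- con (95 % 100)) :* (ρ :- con (95 % 100)))
        :+ (con (884 % 100000) :* (con 1ℚ :- ρ) :+ con (48583 % 1000000)))) refl ρ)
    (0≤% 8228 10000 *⁰ square-nonNeg (ρ - 95 % 100) +⁰ (0≤% 884 100000 *⁰ 0≤- ρ≤1 +⁰ nonNegative⁻¹ (48583 % 1000000)))

  -- The start of the binomial expansion. Its quadratic term makes a power of 1 + 1.05/n a
  -- sufficient substitute for e^(1.05 ρ), and also shows that q₀^r r² is bounded.
  bernoulli₂ : ∀ {x} → 0ℚ ≤ x → ∀ k → 1ℚ + ι k * x + ½ * (ι k * (ι k - 1ℚ)) * (x * x) ≤ (1ℚ + x) ^ k
  bernoulli₂ {x} 0≤x zero    = ≤-reflexive (solve 1 (λ x → con 1ℚ :+ con 0ℚ :* x :+ con ½ :* (con 0ℚ :* (con 0ℚ :- con 1ℚ)) :* (x :* x) := con 1ℚ) refl x)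
  bernoulli₂ {x} 0≤x (suc k) = begin
    1ℚ + ι (suc k) * x + ½ * (ι (suc k) * (ι (suc k) - 1ℚ)) * (x * x)
      ≡⟨ cong (λ z → 1ℚ + z * x + ½ * (z * (z - 1ℚ)) * (x * x)) (ι-suc k) ⟩
    1ℚ + (1ℚ + n) * x + ½ * ((1ℚ + n) * (1ℚ + n - 1ℚ)) * (x * x)
      ≤⟨ ≤-by {s = ½ * (n * (n - 1ℚ)) * (x * x) * x}
           (solve 2 (λ n x → (con 1ℚ :+ x) :* (con 1ℚ :+ n :* x :+ con ½ :* (n :* (n :- con 1ℚ)) :* (x :* x)) :=
             con 1ℚ :+ (con 1ℚ :+ n) :* x :+ con ½ :* ((con 1ℚ :+ n) :* (con 1ℚ :+ n :- con 1ℚ)) :* (x :* x)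
               :+ con ½ :* (n :* (n :- con 1ℚ)) :* (x :* x) :* x) refl n x)
           (((0≤½ *⁰ 0≤n[n-1] k) *⁰ (0≤x *⁰ 0≤x)) *⁰ 0≤x) ⟩
    (1ℚ + x) * (1ℚ + n * x + ½ * (n * (n - 1ℚ)) * (x * x))
      ≤⟨ *-monoˡ (0≤1 +⁰ 0≤x) (bernoulli₂ 0≤x k) ⟩
    (1ℚ + x) ^ suc k
      ∎
    where
    open ≤-Reasoning
    n : ℚ
    n = ι k
    0≤n[n-1] : ∀ k → 0ℚ ≤ ι k * (ι k - 1ℚ)
    0≤n[n-1] zero    = ≤-refl
    0≤n[n-1] (suc k) = 0≤ι (suc k) *⁰ 0≤- (ι-mono {1} (ℕ.s≤s (ℕ.z≤n {k})))

  bernoulli : ∀ {x} → 0ℚ ≤ x → x ≤ 1ℚ → ∀ k → 1ℚ - ι k * x ≤ (1ℚ - x) ^ k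
  bernoulli {x} 0≤x x≤1 zero    = ≤-reflexive (solve 1 (λ x → con 1ℚ :- con 0ℚ :* x := con 1ℚ) refl x)
  bernoulli {x} 0≤x x≤1 (suc k) = begin
    1ℚ - ι (suc k) * x
      ≡⟨ cong (λ z → 1ℚ - z * x) (ι-suc k) ⟩
    1ℚ - (1ℚ + ι k) * x
      ≤⟨ ≤-by {s = ι k * (x * x)} (solve 2 (λ n x → (con 1ℚ :- x) :* (con 1ℚ :- n :* x) :=
           con 1ℚ :- (con 1ℚ :+ n) :* x :+ n :* (x :* x)) refl (ι k) x) (0≤ι k *⁰ 0≤x *⁰ 0≤x) ⟩
    (1ℚ - x) * (1ℚ - ι k * x)
      ≤⟨ *-monoˡ (0≤- x≤1) (bernoulli 0≤x x≤1 k) ⟩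
    (1ℚ - x) ^ suc k
      ∎
    where open ≤-Reasoning

  -- Since r (r + 1) is twice the number of pairs among r + 1 vertices, a factor x^r per vertex can
  -- be spent as x² per pair.
  ^-triangle : ∀ x r → (x ^ r) ^ suc r ≡ (x * x) ^ triangle (suc r)
  ^-triangle x r = trans (^-^ r (suc r)) (trans (cong (x ^_) (identity r)) (sym (square (triangle (suc r)))))
    where
    ^-^ : ∀ m n → (x ^ m) ^ n ≡ x ^ (n ℕ.* m)
    ^-^ m zero    = refl
    ^-^ m (suc n) = trans (cong (x ^ m *_) (^-^ m n)) (sym (^-+ x m (n ℕ.* m)))
    square : ∀ n → (x * x) ^ n ≡ x ^ (n ℕ.+ n)
    square n = trans (^-*-distrib x x n) (sym (^-+ x n n))
    identity : ∀ r → suc r ℕ.* r ≡ triangle (suc r) ℕ.+ triangle (suc r)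
    identity zero    = refl
    identity (suc r) = trans
      (ℕ-Solver.+-*-Solver.solve 1 (λ r → (one :+ⁿ (one :+ⁿ r)) :*ⁿ (one :+ⁿ r) :=ⁿ (one :+ⁿ r) :*ⁿ r :+ⁿ (one :+ⁿ r) :+ⁿ (one :+ⁿ r)) refl r)
      (trans (cong (λ z → z ℕ.+ suc r ℕ.+ suc r) (identity r))
        (ℕ-Solver.+-*-Solver.solve 2 (λ t r → t :+ⁿ t :+ⁿ r :+ⁿ r :=ⁿ (r :+ⁿ t) :+ⁿ (r :+ⁿ t)) refl (triangle (suc r)) (suc r)))
      where
      open ℕ-Solver.+-*-Solver using () renaming (_:+_ to _:+ⁿ_; _:*_ to _:*ⁿ_; _:=_ to _:=ⁿ_; con to conⁿ)
      one : ∀ {n} → ℕ-Solver.+-*-Solver.Polynomial n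
      one = conⁿ 1

  -- With N = n + 1, each factor is N - r = N (1 - r/N) ≤ N (1 - 1/N)^r by Bernoulli's inequality,
  -- and the exponents add up to the number of pairs.
  falling-bound : ∀ n r → falling (suc n) r ≤ ι (suc n) ^ r * (1ℚ - recip n) ^ triangle r
  falling-bound n zero    = ≤-refl
  falling-bound n (suc r) = begin
    falling (suc n) (suc r)
      ≡⟨ falling-suc (suc n) r ⟩
    falling (suc n) r * (N - ι r)
      ≤⟨ *-monoˡ (0≤falling (suc n) r) (≤-trans (≤-reflexive
           (trans (cong (λ z → N - z) (sym (trans (cong (_* ι r) (ι*recip n)) (*-identityˡ (ι r)))))
             (solve 3 (λ N i r → N :- N :* i :* r := N :* (con 1ℚ :- r :* i)) refl N (recip n) (ι r))))
           (*-monoˡ (0≤ι (suc n)) (bernoulli (0≤recip n) (recip-anti {0} {n} ℕ.z≤n) r))) ⟩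
    falling (suc n) r * (N * t ^ r)
      ≤⟨ *-monoʳ (0≤ι (suc n) *⁰ 0≤^ r 0≤t) (falling-bound n r) ⟩
    N ^ r * t ^ triangle r * (N * t ^ r)
      ≡⟨ solve 4 (λ a b c d → a :* b :* (c :* d) := c :* a :* (d :* b)) refl (N ^ r) (t ^ triangle r) N (t ^ r) ⟩
    N ^ suc r * (t ^ r * t ^ triangle r)
      ≡⟨ cong (N ^ suc r *_) (sym (^-+ t r (triangle r))) ⟩
    N ^ suc r * t ^ triangle (suc r)
      ∎
    where
    open ≤-Reasoning
    N t : ℚ
    N = ι (suc n)
    t = 1ℚ - recip n
    0≤t : 0ℚ ≤ t
    0≤t = 0≤- (recip-anti {0} {n} ℕ.z≤n)

-- The two majorants, for large and for small cores

module CoreSeries where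

  open Rationals
  open FactorialSeries
  open EvenSeries
  open MomentFunctional
  open Inequalities
  open import Data.Rational
  open import Data.Rational.Properties hiding (_≟_)
  open import Data.Rational.Solver using (module +-*-Solver)
  open +-*-Solver using (solve; con; _:+_; _:*_; _:-_; :-_; _:=_)

  -- Comparisons of closed rational numbers are settled by evaluation.
  from≤ᵇ : ∀ p q → (p ≤ᵇ q) ≡ true → p ≤ q
  from≤ᵇ p q e = ≤ᵇ⇒≤ (subst T (sym e) _)

  module EvenMoments
    {α β a b m δ : ℚ} (0≤α : 0ℚ ≤ α) (0≤β : 0ℚ ≤ β) (0≤a : 0ℚ ≤ a) (0≤b : 0ℚ ≤ b) (0≤δ : 0ℚ ≤ δ)
    (αβ≡1 : α * β ≡ 1ℚ)
    where

    open EvenMajorant {α} {β} {a} {b} {m} {δ} 0≤α 0≤β 0≤a 0≤b 0≤δ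
    open Moments {α} {β} {a} {b} {m} {δ} 0≤α 0≤β 0≤a 0≤b 0≤δ αβ≡1

    moment-double : ∀ y i s → moment y i (double s) ≡ even y (s ℕ.+ i)
    moment-double y i zero    = refl
    moment-double y i (suc s) = trans (moment-double y (suc i) s) (cong (even y) (ℕₚ.+-suc s i))

    -- Links give words of even length only, but a product of the series mixes parities, so the
    -- iteration bounds all lengths at once. The odd ones are nonnegative extras.
    even-terms : ∀ M (f : ℕ → ℚ) {y} → (∀ h → 0ℚ ≤ f h) → 0ℚ ≤ y → ∀ i →
      ∑< M (λ s → f (double s) * moment y i (double s)) ≤ ∑< (double M) (λ h → f h * moment y i h)
    even-terms zero    f     0≤f 0≤y i = ≤-refl
    even-terms (suc M) f {y} 0≤f 0≤y i = +-monoʳ-≤ (f 0 * even y i) (begin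
      ∑< M (λ s → f (double (suc s)) * moment y (suc i) (double s))
        ≤⟨ even-terms M (f ∘ suc ∘ suc) (0≤f ∘ suc ∘ suc) 0≤y (suc i) ⟩
      rest
        ≤⟨ ≤-by {s = f 1 * odd y i} (+-comm (f 1 * odd y i) rest) (0≤f 1 *⁰ 0≤moment 0≤y i 1) ⟩
      f 1 * odd y i + rest
        ∎)
      where
      open ≤-Reasoning
      rest : ℚ
      rest = ∑< (double M) (λ h → f (suc (suc h)) * moment y (suc i) h)

    module _ (recip8≤b : recip 8 ≤ b)
      (c₀ : ½ * α * 1/fac 3 + δ * (m * m) ≤ B 0)
      (c₁ : coefficient 3 ≤ B 1 + (m + m) * δ)
      (c₂ : coefficient 5 + δ ≤ B 2)
      (c₃ : κ * 1/fac 7 ≤ B 3)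
      where

      expTail₃^-even : ∀ r K {y D e x} → 0ℚ ≤ y → D ≡ 1ℚ - ι r * (b * y) → 0ℚ < D →
        (∀ d → 0ℚ ≤ d → d * D ≡ 1ℚ → d ≤ e × a * (y * d) ≤ x) →
        ∑< (4 ℕ.+ K) (λ s → expTail₃^ r (double s) * even y s) ≤ e * (x ^ r * fac r)
      expTail₃^-even r K {y} {D} {e} {x} 0≤y refl 0<D bounds = with-inverse (inverse {D} 0<D)
        where
        with-inverse : ∃[ d ] (0ℚ ≤ d × d * D ≡ 1ℚ) →
          ∑< (4 ℕ.+ K) (λ s → expTail₃^ r (double s) * even y s) ≤ e * (x ^ r * fac r)
        with-inverse (d , 0≤d , dD≡1) = begin
          ∑< (4 ℕ.+ K) (λ s → expTail₃^ r (double s) * even y s)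
            ≡⟨ (∑<-cong (4 ℕ.+ K) λ s → cong (expTail₃^ r (double s) *_)
                 (sym (trans (moment-double y 0 s) (cong (even y) (ℕₚ.+-identityʳ s))))) ⟩
          ∑< (4 ℕ.+ K) (λ s → expTail₃^ r (double s) * moment y 0 (double s))
            ≤⟨ even-terms (4 ℕ.+ K) (expTail₃^ r) (0≤expTail₃^ r) 0≤y 0 ⟩
          ∑< (double (4 ℕ.+ K)) (λ h → expTail₃^ r h * moment y 0 h)
            ≤⟨ expTail₃^-moment recip8≤b c₀ c₁ c₂ c₃ r K 0≤y 0<D 0≤d dD≡1 ⟩
          d * ((a * (y * d)) ^ r * fac r)
            ≤⟨ *-mono 0≤d (0≤^ r (≤-trans 0≤ayd (proj₂ (bounds d 0≤d dD≡1))) *⁰ 0≤fac r) (proj₁ (bounds d 0≤d dD≡1))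
                 (*-monoʳ (0≤fac r) (^-mono r 0≤ayd (proj₂ (bounds d 0≤d dD≡1)))) ⟩
          e * (x ^ r * fac r)
            ∎
          where
          open ≤-Reasoning
          0≤ayd : 0ℚ ≤ a * (y * d)
          0≤ayd = 0≤a *⁰ 0≤y *⁰ 0≤d

  module LargeCores where

    -- Here B 1 = 0.0646 is well below `coefficient 3` ≈ 0.1035. The multiple 0.0066 of the square
    -- centred at 2.95 makes up for this, at the expense of u and u³; `c₁` and `c₂` then hold with
    -- hardly any room.
    open EvenMoments {3 % 2} {2 % 3} {19 % 100} {34 % 100} {295 % 100} {66 % 10000}
      (0≤% 3 2) (0≤% 2 3) (0≤% 19 100) (0≤% 34 100) (0≤% 66 10000) refl

    large-cores : ∀ r K {y D e x} → 0ℚ ≤ y → D ≡ 1ℚ - ι r * (34 % 100 * y) → 0ℚ < D →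
      (∀ d → 0ℚ ≤ d → d * D ≡ 1ℚ → d ≤ e × 19 % 100 * (y * d) ≤ x) →
      ∑< (4 ℕ.+ K) (λ s → expTail₃^ r (double s) * even y s) ≤ e * (x ^ r * fac r)
    large-cores = expTail₃^-even (from≤ᵇ _ _ refl) (from≤ᵇ _ _ refl) (from≤ᵇ _ _ refl) (from≤ᵇ _ _ refl) (from≤ᵇ _ _ refl)

  module SmallCores (k : ℕ) where

    α κ : ℚ
    α = recip k
    κ = ι (suc k)

    0≤α : 0ℚ ≤ α
    0≤α = 0≤recip k

    0≤κ : 0ℚ ≤ κ
    0≤κ = 0≤ι (suc k)

    1≤κ : 1ℚ ≤ κ
    1≤κ = ι-mono {1} (ℕ.s≤s (ℕ.z≤n {k}))

    α≤1 : α ≤ 1ℚ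
    α≤1 = recip-anti {0} {k} ℕ.z≤n

    -- Near 0 the series is of order t³ = o(u). Averaging odd powers with weight 1/κ on the lower
    -- neighbour leaves only 1/(12 κ) as coefficient of u, so a = 1/κ suffices; the large weight on
    -- the upper neighbour is paid for by b = κ².
    open EvenMoments {α} {κ} {α} {κ * κ} {0ℚ} {0ℚ} 0≤α 0≤κ 0≤α (0≤κ *⁰ 0≤κ) 0≤0 (recip*ι k)

    private
      1≤κκ : 1ℚ ≤ κ * κ
      1≤κκ = ≤-trans (≤-reflexive (sym (*-identityˡ 1ℚ))) (*-mono 0≤1 0≤κ 1≤κ 1≤κ)

      κ≤κ³ : κ ≤ κ * (κ * κ)
      κ≤κ³ = ≤-trans (≤-reflexive (sym (*-identityʳ κ))) (*-monoˡ 0≤κ 1≤κκ)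

      κ≤κ⁵ : κ ≤ κ * (κ * κ) * (κ * κ)
      κ≤κ⁵ = ≤-trans κ≤κ³ (≤-trans (≤-reflexive (sym (*-identityʳ (κ * (κ * κ))))) (*-monoˡ (0≤κ *⁰ 0≤κ *⁰ 0≤κ) 1≤κκ))

      cancel : ∀ x → α * (κ * x) ≡ x
      cancel x = trans (sym (*-assoc α κ x)) (trans (cong (_* x) (recip*ι k)) (*-identityˡ x))

      b₁ : κ ≡ α * ((κ * κ) * 1ℚ * 1/fac 1) + (0ℚ + 0ℚ) * 0ℚ
      b₁ = trans (sym (cancel κ)) (solve 2 (λ a k → a :* (k :* k) := a :* ((k :* k) :* con 1ℚ :* con (1/fac 1)) :+ (con 0ℚ :+ con 0ℚ) :* con 0ℚ) refl α κ)

      b₂ : 1/fac 2 * (κ * (κ * κ)) ≡ α * ((κ * κ) * ((κ * κ) * 1ℚ) * 1/fac 2)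
      b₂ = trans (sym (cancel _)) (solve 3 (λ a k f → a :* (k :* (f :* (k :* (k :* k)))) := a :* ((k :* k) :* ((k :* k) :* con 1ℚ) :* f)) refl α κ (1/fac 2))

      b₃ : 1/fac 3 * (κ * (κ * κ) * (κ * κ)) ≡ α * ((κ * κ) * ((κ * κ) * ((κ * κ) * 1ℚ)) * 1/fac 3)
      b₃ = trans (sym (cancel _)) (solve 3 (λ a k f → a :* (k :* (f :* (k :* (k :* k) :* (k :* k)))) :=
        a :* ((k :* k) :* ((k :* k) :* ((k :* k) :* con 1ℚ)) :* f)) refl α κ (1/fac 3))

    small-cores : ∀ r K {y D e x} → 0ℚ ≤ y → D ≡ 1ℚ - ι r * (κ * κ * y) → 0ℚ < D →
      (∀ d → 0ℚ ≤ d → d * D ≡ 1ℚ → d ≤ e × α * (y * d) ≤ x) →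
      ∑< (4 ℕ.+ K) (λ s → expTail₃^ r (double s) * even y s) ≤ e * (x ^ r * fac r)
    small-cores = expTail₃^-even
      (≤-trans (from≤ᵇ (recip 8) 1ℚ refl) 1≤κκ)
      (≤-by {s = 11 % 12 * α} (solve 1 (λ a → a :* (con 1ℚ :* con 1ℚ) :=
          con ½ :* a :* con (1/fac 3) :+ con 0ℚ :* (con 0ℚ :* con 0ℚ) :+ con (11 % 12) :* a) refl α)
        (0≤% 11 12 *⁰ 0≤α))
      (≤-trans (≤-by {s = 11 % 12 * (κ - 1ℚ) + (1 % 240 * (1ℚ - α) + 209 % 240)}
          (solve 2 (λ a k → k := con ½ :* k :* con (1/fac 3) :+ con (1/fac 4) :+ con ½ :* a :* con (1/fac 5)
            :+ (con (11 % 12) :* (k :- con 1ℚ) :+ (con (1 % 240) :* (con 1ℚ :- a) :+ con (209 % 240)))) refl α κ)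
          (0≤% 11 12 *⁰ 0≤- 1≤κ +⁰ (0≤% 1 240 *⁰ 0≤- α≤1 +⁰ 0≤% 209 240)))
        (≤-reflexive b₁))
      (≤-trans (≤-trans (≤-by {s = 119 % 240 * (κ - 1ℚ) + (1 % 10080 * (1ℚ - α) + S₂)}
          (solve 2 (λ a k → con (1/fac 2) :* k := con ½ :* k :* con (1/fac 5) :+ con (1/fac 6) :+ con ½ :* a :* con (1/fac 7) :+ con 0ℚ
            :+ (con (119 % 240) :* (k :- con 1ℚ) :+ (con (1 % 10080) :* (con 1ℚ :- a) :+ con S₂))) refl α κ)
          (0≤% 119 240 *⁰ 0≤- 1≤κ +⁰ (0≤% 1 10080 *⁰ 0≤- α≤1 +⁰ nonNegative⁻¹ S₂)))
          (*-monoˡ (0≤1/fac 2) κ≤κ³))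
        (≤-reflexive b₂))
      (≤-trans (≤-trans (≤-by {s = T₁ * (κ - 1ℚ) + (T₂ * (1ℚ - α) + T₃)}
          (solve 2 (λ a k → con (1/fac 3) :* k := (con ½ :* k :+ con (recip 7) :+ con ½ :* a :* (con (recip 8) :* con (recip 7))) :* con (1/fac 7)
            :+ (con T₁ :* (k :- con 1ℚ) :+ (con T₂ :* (con 1ℚ :- a) :+ con T₃))) refl α κ)
          (nonNegative⁻¹ T₁ *⁰ 0≤- 1≤κ +⁰ (nonNegative⁻¹ T₂ *⁰ 0≤- α≤1 +⁰ nonNegative⁻¹ T₃)))
          (*-monoˡ (0≤1/fac 3) κ≤κ⁵))
        (≤-reflexive b₃))
      where
      -- `S₂` and `T₃` are the slacks at κ = α = 1; `T₁` and `T₂` are the coefficients of κ - 1 and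
      -- 1 - α.
      S₂ T₁ T₂ T₃ : ℚ
      S₂ = 1/fac 2 - ½ * 1/fac 5 - 1/fac 6 - ½ * 1/fac 7
      T₁ = 1/fac 3 - ½ * 1/fac 7
      T₂ = ½ * (recip 8 * recip 7) * 1/fac 7
      T₃ = T₁ - (recip 7 + ½ * (recip 8 * recip 7)) * 1/fac 7

-- Summation over all core sizes

module CoreEstimate where

  open Rationals
  open FactorialSeries
  open EvenSeries
  open MomentFunctional
  open Links
  open CoreMeans
  open Inequalities
  open CoreSeries
  open import Data.Rational
  open import Data.Rational.Properties hiding (_≟_)
  open import Data.Rational.Solver using (module +-*-Solver)
  open +-*-Solver using (solve; con; _:+_; _:*_; _:-_; :-_; _:=_)

  ∑<-½ : ∀ n → ∑< n (½ ^_) ≤ ι 2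
  ∑<-½ zero    = 0≤ι 2
  ∑<-½ (suc n) = ≤-trans (+-monoʳ-≤ 1ℚ (≤-trans (≤-reflexive (∑<-*ˡ n ½ (½ ^_))) (*-monoˡ 0≤½ (∑<-½ n))))
    (≤-reflexive refl)

  ∑<-const : ∀ n c → ∑< n (λ _ → c) ≡ ι n * c
  ∑<-const zero    c = sym (*-zeroˡ c)
  ∑<-const (suc n) c = trans (cong (c +_) (∑<-const n c))
    (trans (solve 2 (λ c n → c :+ n :* c := (con 1ℚ :+ n) :* c) refl c (ι n)) (cong (_* c) (sym (ι-suc n))))

  -- The second-order bound gives (1 + 1/49)^r ≥ r²/(2 · 49²), and 4802 = 2 · 49².
  q₀^-bound : ∀ r → q₀ ^ r * (ι r * ι r) ≤ ι 4802
  q₀^-bound r = begin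
    q₀ ^ r * (n * n)
      ≡⟨ solve 2 (λ q n → q :* (n :* n) := con (ι 4802) :* (q :* (con ½ :* (n :* n) :* (con x :* con x)))) refl (q₀ ^ r) n ⟩
    ι 4802 * (q₀ ^ r * (½ * (n * n) * (x * x)))
      ≤⟨ *-monoˡ (0≤ι 4802) (*-monoˡ (0≤^ r (0≤% 49 50)) (≤-trans
           (≤-by {s = 1ℚ + (1 % 49 - ½ * (x * x)) * n}
             (solve 1 (λ n → con 1ℚ :+ n :* con x :+ con ½ :* (n :* (n :- con 1ℚ)) :* (con x :* con x)
               := con ½ :* (n :* n) :* (con x :* con x) :+ (con 1ℚ :+ con (1 % 49 - ½ * (x * x)) :* n)) refl n)
             (0≤1 +⁰ nonNegative⁻¹ (1 % 49 - ½ * (x * x)) *⁰ 0≤ι r))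
           (bernoulli₂ (0≤% 1 49) r))) ⟩
    ι 4802 * (q₀ ^ r * (1ℚ + x) ^ r)
      ≡⟨ cong (ι 4802 *_) (trans (sym (^-*-distrib q₀ (1ℚ + x) r)) (1^ r)) ⟩
    ι 4802 * 1ℚ
      ≡⟨ *-identityʳ (ι 4802) ⟩
    ι 4802
      ∎
    where
    open ≤-Reasoning
    n x : ℚ
    n = ι r
    x = 1 % 49

  -- A case distinction as a function, so that properties of both branches pass through
  -- `select-elim` without abstracting the test from large goals.
  select : ∀ {A : Set} → Dec A → ℚ → ℚ → ℚ
  select (yes _) p q = p
  select (no  _) p q = q

  select-elim : ∀ {A : Set} (R : ℚ → Set) (d : Dec A) {p q} → (A → R p) → (¬ A → R q) → R (select d p q)
  select-elim R (yes a) r s = r a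
  select-elim R (no ¬a) r s = s ¬a

  module Estimate (n k : ℕ) (1000≤n : 1000 ℕ.≤ suc n) (19≤k : 19 ℕ.≤ k) where

    open SmallCores k using (α; κ; 0≤α; 0≤κ; small-cores)
    open LargeCores using (large-cores)

    N i q χ : ℚ
    N = ι (suc n)
    i = recip n
    q = 11 % 10 * i
    χ = 1ℚ + 105 % 100 * i

    0≤i : 0ℚ ≤ i
    0≤i = 0≤recip n

    0≤q : 0ℚ ≤ q
    0≤q = 0≤% 11 10 *⁰ 0≤i

    i≤ : i ≤ 1 % 1000
    i≤ = recip-anti {999} {n} (ℕₚ.≤-pred 1000≤n)

    q≤ : q ≤ 11 % 10000
    q≤ = *-monoˡ (0≤% 11 10) i≤

    q≤1 : q ≤ 1ℚ
    q≤1 = ≤-trans q≤ (from≤ᵇ (11 % 10000) 1ℚ refl)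

    0≤χ : 0ℚ ≤ χ
    0≤χ = 0≤1 +⁰ 0≤% 105 100 *⁰ 0≤i

    -- In the first case 10 κ² r ≤ N. Together with y ≤ 5/N and b = κ² this keeps the denominator 1
    -- - b r y at least 1/2. The second case keeps the factor 1 - q per pair.
    β : ℕ → ℚ
    β zero    = 0ℚ
    β (suc r) = select (10 ℕ.* (suc k ℕ.* suc k) ℕ.* suc r ℕ.≤? suc n)
      (ι 2 * (ι 10 * α * i) ^ suc r)
      ((1ℚ - q) ^ triangle (suc r) * (ι 5 * (q₀ * i * χ ^ r) ^ suc r))

    0≤β : ∀ r → 0ℚ ≤ β r
    0≤β zero    = 0≤0
    0≤β (suc r) = select-elim (0ℚ ≤_) (10 ℕ.* (suc k ℕ.* suc k) ℕ.* suc r ℕ.≤? suc n)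
      (λ _ → 0≤ι 2 *⁰ 0≤^ (suc r) ((0≤ι 10 *⁰ 0≤α) *⁰ 0≤i))
      (λ _ → 0≤^ (triangle (suc r)) (0≤- q≤1) *⁰ 0≤ι 5 *⁰ 0≤^ (suc r) ((0≤% 49 50 *⁰ 0≤i) *⁰ 0≤^ r 0≤χ))

    cast-≤ : ∀ r → 10 ℕ.* (suc k ℕ.* suc k) ℕ.* r ℕ.≤ suc n → ι 10 * (κ * κ) * ι r ≤ N
    cast-≤ r l = subst (_≤ N) (cast r) (ι-mono l)
      where
      cast : ∀ r → ι (10 ℕ.* (suc k ℕ.* suc k) ℕ.* r) ≡ ι 10 * (κ * κ) * ι r
      cast r = trans (ι-* (10 ℕ.* (suc k ℕ.* suc k)) r) (cong (_* ι r) (trans (ι-* 10 (suc k ℕ.* suc k)) (cong (ι 10 *_) (ι-* (suc k) (suc k)))))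

    cast-≥ : ∀ r → ¬ 10 ℕ.* (suc k ℕ.* suc k) ℕ.* r ℕ.≤ suc n → N ≤ ι 10 * (κ * κ) * ι r
    cast-≥ r l = subst (N ≤_) (trans (ι-* (10 ℕ.* (suc k ℕ.* suc k)) r) (cong (_* ι r) (trans (ι-* 10 (suc k ℕ.* suc k)) (cong (ι 10 *_) (ι-* (suc k) (suc k))))))
      (ι-mono (ℕₚ.<⇒≤ (ℕₚ.≰⇒> l)))

    ≤-reciprocal : ∀ {D d} e j → 0ℚ ≤ e → 0ℚ ≤ d → e * j ≡ 1ℚ → j ≤ D → d * D ≡ 1ℚ → d ≤ e
    ≤-reciprocal {D} {d} e j 0≤e 0≤d ej≡1 j≤D dD≡1 = begin
      d             ≡⟨ sym (trans (cong (d *_) ej≡1) (*-identityʳ d)) ⟩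
      d * (e * j)   ≤⟨ *-monoˡ 0≤d (*-monoˡ 0≤e j≤D) ⟩
      d * (e * D)   ≡⟨ solve 3 (λ d e D → d :* (e :* D) := e :* (d :* D)) refl d e D ⟩
      e * (d * D)   ≡⟨ trans (cong (e *_) dD≡1) (*-identityʳ e) ⟩
      e             ∎
      where open ≤-Reasoning

    module _ {w : ℚ} (0≤w : 0ℚ ≤ w) (w*[1-q] : w * (1ℚ - q) ≡ 1ℚ) where

      -- The origin of the constant 1.102: from q ≤ 0.0011 follows 1.1/(1 - q) ≤ 11000/9989.
      w≤ : 11 % 10 * w ≤ 1102 % 1000
      w≤ = ≤-trans (*-monoˡ (0≤% 11 10) (≤-reciprocal (10000 % 9989) (9989 % 10000) (0≤% 10000 9989) 0≤w refl
        (0≤-⇒≤ (subst (0ℚ ≤_) (solve 1 (λ q → con (11 % 10000) :- q := con 1ℚ :- q :- con (9989 % 10000)) refl q) (0≤- q≤))) w*[1-q]))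
        (from≤ᵇ (11 % 10 * (10000 % 9989)) (1102 % 1000) refl)

      module _ {r m : ℕ} (r+m : suc r ℕ.+ m ≡ suc n) where

        -- A link has weight m q² + q w = Q/N, with m = N (1 - ρ) outer vertices; `y` is twice this
        -- weight and `c` bounds `Q` without reference to `w`.
        ρ c Q y : ℚ
        ρ = ι (suc r) * i
        c = 121 % 100 * (1ℚ - ρ) + 1102 % 1000
        Q = 121 % 100 * (1ℚ - ρ) + 11 % 10 * w
        y = i * (Q + Q)

        0≤ρ : 0ℚ ≤ ρ
        0≤ρ = 0≤ι (suc r) *⁰ 0≤i

        m*i : ι m * i ≡ 1ℚ - ρ
        m*i = begin
          ι m * i                  ≡⟨ solve 3 (λ m r i → m :* i := (r :+ m) :* i :- r :* i) refl (ι m) (ι (suc r)) i ⟩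
          (ι (suc r) + ι m) * i - ρ ≡⟨ cong (λ z → z * i - ρ) (trans (sym (ι-+ (suc r) m)) (cong ι r+m)) ⟩
          N * i - ρ                ≡⟨ cong (_- ρ) (ι*recip n) ⟩
          1ℚ - ρ                   ∎
          where open ≡-Reasoning

        ρ≤1 : ρ ≤ 1ℚ
        ρ≤1 = 0≤-⇒≤ (subst (0ℚ ≤_) m*i (0≤ι m *⁰ 0≤i))

        0≤Q : 0ℚ ≤ Q
        0≤Q = 0≤% 121 100 *⁰ 0≤- ρ≤1 +⁰ 0≤% 11 10 *⁰ 0≤w

        Q≤c : Q ≤ c
        Q≤c = +-monoʳ-≤ (121 % 100 * (1ℚ - ρ)) w≤

        0≤y : 0ℚ ≤ y
        0≤y = 0≤i *⁰ (0≤Q +⁰ 0≤Q)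

        P≡ : let P = ι m * (q * q) + q * w in P + P ≡ y
        P≡ = trans (solve 3 (λ m i w → let q = con (11 % 10) :* i ; P = m :* (q :* q) :+ q :* w in P :+ P :=
            i :* ((con (121 % 100) :* (m :* i) :+ con (11 % 10) :* w) :+ (con (121 % 100) :* (m :* i) :+ con (11 % 10) :* w))) refl (ι m) i w)
          (cong (λ z → i * ((121 % 100 * z + 11 % 10 * w) + (121 % 100 * z + 11 % 10 * w))) m*i)

        small : ι 10 * (κ * κ) * ι (suc r) ≤ N → ∀ K →
          ∑< (4 ℕ.+ K) (λ s → expTail₃^ (suc r) (double s) * even y s) ≤ ι 2 * ((ι 10 * α * i) ^ suc r * fac (suc r))
        small l K = small-cores (suc r) K 0≤y refl 0<D λ d 0≤d dD≡1 →
          let d≤2 = ≤-reciprocal (ι 2) ½ (0≤ι 2) 0≤d refl ½≤D dD≡1 in d≤2 , (begin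
            α * (i * (Q + Q) * d)
              ≤⟨ *-monoˡ 0≤α (*-mono (0≤i *⁰ (0≤Q +⁰ 0≤Q)) (0≤ι 2) (*-monoˡ 0≤i (+-mono-≤ Q≤5/2 Q≤5/2)) d≤2) ⟩
            α * (i * (5 % 2 + 5 % 2) * ι 2)
              ≡⟨ solve 2 (λ a i → a :* (i :* (con (5 % 2) :+ con (5 % 2)) :* con (ι 2)) := con (ι 10) :* a :* i) refl α i ⟩
            ι 10 * α * i
              ∎)
          where
          open ≤-Reasoning
          Q≤5/2 : Q ≤ 5 % 2
          Q≤5/2 = ≤-trans Q≤c (≤-by {s = 121 % 100 * ρ + 188 % 1000}
            (solve 1 (λ r → con (5 % 2) := con (121 % 100) :* (con 1ℚ :- r) :+ con (1102 % 1000) :+ (con (121 % 100) :* r :+ con (188 % 1000))) refl ρ)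
            (0≤% 121 100 *⁰ 0≤ρ +⁰ 0≤% 188 1000))
          ½≤D : ½ ≤ 1ℚ - ι (suc r) * (κ * κ * y)
          ½≤D = 0≤-⇒≤ (subst (0ℚ ≤_)
            (solve 5 (λ N i k r Q →
                con ½ :* (con 1ℚ :- N :* i) :+ con ½ :* i :* (N :- con (ι 10) :* k :* r) :+ con (ι 2) :* (r :* k) :* i :* (con (5 % 2) :- Q)
                := con 1ℚ :- r :* (k :* (i :* (Q :+ Q))) :- con ½) refl N i (κ * κ) (ι (suc r)) Q)
            ((0≤½ *⁰ 0≤- (≤-reflexive (ι*recip n)) +⁰ (0≤½ *⁰ 0≤i) *⁰ 0≤- l)
              +⁰ ((0≤ι 2 *⁰ 0≤ι (suc r) *⁰ 0≤κ *⁰ 0≤κ) *⁰ 0≤i) *⁰ 0≤- Q≤5/2))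
          0<D : 0ℚ < 1ℚ - ι (suc r) * (κ * κ * y)
          0<D = <-≤-trans (positive⁻¹ ½) ½≤D

        large : ∀ K → ∑< (4 ℕ.+ K) (λ s → expTail₃^ (suc r) (double s) * even y s)
          ≤ ι 5 * ((q₀ * i * χ ^ r) ^ suc r * fac (suc r))
        large K = large-cores (suc r) K 0≤y D≡ (<-≤-trans (positive⁻¹ (1 % 5)) 1/5≤D) λ d 0≤d dD≡1 →
          ≤-reciprocal (ι 5) (1 % 5) (0≤ι 5) 0≤d refl 1/5≤D dD≡1 , (begin
            19 % 100 * (i * (Q + Q) * d)
              -- Since y = 2 i Q, the constants 0.38 and 0.68 are twice a = 0.19 and b = 0.34.
              ≡⟨ solve 3 (λ i Q d → con (19 % 100) :* (i :* (Q :+ Q) :* d) := i :* d :* (con (38 % 100) :* Q)) refl i Q d ⟩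
            i * d * (38 % 100 * Q)
              ≤⟨ *-monoˡ (0≤i *⁰ 0≤d) (≤-trans 38Q≤ (*-monoˡ (0≤% 49 50) (*-monoʳ (≤-trans (0≤% 1 5) 1/5≤D) E≤χ))) ⟩
            i * d * (q₀ * (χ ^ r * D))
              ≡⟨ solve 5 (λ i d q x D → i :* d :* (q :* (x :* D)) := q :* i :* x :* (d :* D)) refl i d q₀ (χ ^ r) D ⟩
            q₀ * i * χ ^ r * (d * D)
              ≡⟨ trans (cong (q₀ * i * χ ^ r *_) dD≡1) (*-identityʳ _) ⟩
            q₀ * i * χ ^ r
              ∎)
          where
          open ≤-Reasoning
          D E : ℚ
          D = 1ℚ - 68 % 100 * ρ * Q
          E = 997 % 1000 + 105 % 100 * ρ + 55 % 100 * (ρ * ρ)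
          0≤E : 0ℚ ≤ E
          0≤E = (0≤% 997 1000 +⁰ 0≤% 105 100 *⁰ 0≤ρ) +⁰ 0≤% 55 100 *⁰ 0≤ρ *⁰ 0≤ρ
          D≡ : D ≡ 1ℚ - ι (suc r) * (34 % 100 * y)
          D≡ = solve 3 (λ r i Q → con 1ℚ :- con (68 % 100) :* (r :* i) :* Q := con 1ℚ :- r :* (con (34 % 100) :* (i :* (Q :+ Q)))) refl (ι (suc r)) i Q
          1/5≤D : 1 % 5 ≤ D
          1/5≤D = ≤-trans (denominator-inequality 0≤ρ ρ≤1) (+-monoʳ-≤ 1ℚ (neg-antimono-≤ (*-monoˡ (0≤% 68 100 *⁰ 0≤ρ) Q≤c)))
          38Q≤ : 38 % 100 * Q ≤ q₀ * (E * D)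
          38Q≤ = 0≤-⇒≤ (subst (0ℚ ≤_)
            (solve 4 (λ c Q E r →
              (con q₀ :* (E :* (con 1ℚ :- con (68 % 100) :* r :* c)) :- con (38 % 100) :* c)
                :+ (con (38 % 100) :+ con q₀ :* E :* (con (68 % 100) :* r)) :* (c :- Q)
              := con q₀ :* (E :* (con 1ℚ :- con (68 % 100) :* r :* Q)) :- con (38 % 100) :* Q) refl c Q E ρ)
            (0≤- (core-inequality 0≤ρ ρ≤1)
              +⁰ (0≤% 38 100 +⁰ (0≤% 49 50 *⁰ 0≤E) *⁰ 0≤% 68 100 *⁰ 0≤ρ) *⁰ 0≤- Q≤c))
          -- The exponent is r while ρ counts r + 1 vertices. Using 0.997 instead of 1 and 0.55
          -- instead of 1.05²/2 pays for this shift, given i ≤ 1/1000.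
          E≤χ : E ≤ χ ^ r
          E≤χ = ≤-trans (≤-by (trans
              (solve 2 (λ R i → let x = con (105 % 100) :* i ; ρ = (con 1ℚ :+ R) :* i in
                con 1ℚ :+ R :* x :+ con ½ :* (R :* (R :- con 1ℚ)) :* (x :* x)
                := con (997 % 1000) :+ con (105 % 100) :* ρ :+ con (55 % 100) :* (ρ :* ρ)
                  :+ (con (125 % 100000) :* (ρ :* ρ) :+ (con (11025 % 10000) :* (i :* i)
                    :+ (con (165375 % 100000) :* (i :* (con 1ℚ :- ρ)) :+ (con (270375 % 100000) :* (con (1 % 1000) :- i)
                    :+ con (29625 % 100000000)))))) refl (ι r) i)
              (cong (λ z → 997 % 1000 + 105 % 100 * z + 55 % 100 * (z * z) + excess z) (cong (_* i) (sym (ι-suc r)))))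
              (0≤% 125 100000 *⁰ 0≤ρ *⁰ 0≤ρ +⁰ (0≤% 11025 10000 *⁰ 0≤i *⁰ 0≤i
                +⁰ (0≤% 165375 100000 *⁰ 0≤i *⁰ 0≤- ρ≤1 +⁰ (0≤% 270375 100000 *⁰ 0≤- i≤ +⁰ 0≤% 29625 100000000)))))
            (bernoulli₂ (0≤% 105 100 *⁰ 0≤i) r)
            where
            excess : ℚ → ℚ
            excess z = 125 % 100000 * (z * z) + (11025 % 10000 * (i * i)
              + (165375 % 100000 * (i * (1ℚ - z)) + (270375 % 100000 * (1 % 1000 - i) + 29625 % 100000000)))

        cores-bound : ∀ K → let P = ι m * (q * q) + q * w in
          (1ℚ - q) ^ triangle (suc r) * ∑< (4 ℕ.+ K) (λ s → expTail₃^ (suc r) (double s) * even (P + P) s)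
            ≤ β (suc r) * fac (suc r)
        cores-bound K = begin
          (1ℚ - q) ^ τ * ∑< (4 ℕ.+ K) (λ s → expTail₃^ (suc r) (double s) * even (P + P) s)
            ≡⟨ cong ((1ℚ - q) ^ τ *_) (∑<-cong (4 ℕ.+ K) λ s → cong (λ z → expTail₃^ (suc r) (double s) * even z s) P≡) ⟩
          (1ℚ - q) ^ τ * S
            ≤⟨ select-elim (λ z → (1ℚ - q) ^ τ * S ≤ z * fac (suc r)) (10 ℕ.* (suc k ℕ.* suc k) ℕ.* suc r ℕ.≤? suc n)
                 if-small (λ _ → if-large) ⟩
          β (suc r) * fac (suc r)
            ∎
          where
          open ≤-Reasoning
          τ : ℕ
          τ = triangle (suc r)
          P S : ℚ
          P = ι m * (q * q) + q * w
          S = ∑< (4 ℕ.+ K) (λ s → expTail₃^ (suc r) (double s) * even y s)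
          1-q≤1 : 1ℚ - q ≤ 1ℚ
          1-q≤1 = ≤-by {s = q} (solve 1 (λ q → con 1ℚ := con 1ℚ :- q :+ q) refl q) 0≤q
          if-small : 10 ℕ.* (suc k ℕ.* suc k) ℕ.* suc r ℕ.≤ suc n → (1ℚ - q) ^ τ * S ≤ ι 2 * (ι 10 * α * i) ^ suc r * fac (suc r)
          if-small l = begin
            (1ℚ - q) ^ τ * S
              ≤⟨ *-monoʳ (0≤∑< (4 ℕ.+ K) (λ s → 0≤expTail₃^ (suc r) (double s) *⁰ 0≤even 0≤y s)) (^-≤1 τ (0≤- q≤1) 1-q≤1) ⟩
            1ℚ * S
              ≡⟨ *-identityˡ S ⟩
            S
              ≤⟨ small (cast-≤ (suc r) l) K ⟩
            ι 2 * ((ι 10 * α * i) ^ suc r * fac (suc r))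
              ≡⟨ sym (*-assoc (ι 2) ((ι 10 * α * i) ^ suc r) (fac (suc r))) ⟩
            ι 2 * (ι 10 * α * i) ^ suc r * fac (suc r)
              ∎
          if-large : (1ℚ - q) ^ τ * S ≤ (1ℚ - q) ^ τ * (ι 5 * (q₀ * i * χ ^ r) ^ suc r) * fac (suc r)
          if-large = begin
            (1ℚ - q) ^ τ * S
              ≤⟨ *-monoˡ (0≤^ τ (0≤- q≤1)) (large K) ⟩
            (1ℚ - q) ^ τ * (ι 5 * ((q₀ * i * χ ^ r) ^ suc r * fac (suc r)))
              ≡⟨ solve 4 (λ a b c d → a :* (b :* (c :* d)) := a :* (b :* c) :* d) refl
                   ((1ℚ - q) ^ τ) (ι 5) ((q₀ * i * χ ^ r) ^ suc r) (fac (suc r)) ⟩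
            (1ℚ - q) ^ τ * (ι 5 * (q₀ * i * χ ^ r) ^ suc r) * fac (suc r)
              ∎

    -- Here 2401000 = 5 · 10² · 4802: the factor in front of the large regime, the squared threshold
    -- and the bound on q₀^r r².
    C : ℚ
    C = ι 2401000 * (κ * κ * (κ * κ))

    0≤C : 0ℚ ≤ C
    0≤C = 0≤ι 2401000 *⁰ (0≤κ *⁰ 0≤κ) *⁰ 0≤κ *⁰ 0≤κ

    t : ℚ
    t = 1ℚ - i

    0≤t : 0ℚ ≤ t
    0≤t = 0≤- (≤-trans i≤ (from≤ᵇ (1 % 1000) 1ℚ refl))

    t≤1 : t ≤ 1ℚ
    t≤1 = ≤-by {s = i} (solve 1 (λ i → con 1ℚ := con 1ℚ :- i :+ i) refl i) 0≤i

    -- The powers of N and i cancel and leave 2 (10 α)^(r + 1); since k ≥ 19, the ratio 10 α is at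
    -- most 1/2.
    small-term : ∀ r → falling (suc n) (suc r) * (ι 2 * (ι 10 * α * i) ^ suc r) ≤ ι 20 * α * ½ ^ r
    small-term r = begin
      falling (suc n) (suc r) * (ι 2 * (ι 10 * α * i) ^ suc r)
        ≤⟨ *-monoʳ (0≤ι 2 *⁰ 0≤^ (suc r) ((0≤ι 10 *⁰ 0≤α) *⁰ 0≤i)) (≤-trans (falling-bound n (suc r))
             (≤-trans (*-monoˡ (0≤^ (suc r) (0≤ι (suc n))) (^-≤1 (triangle (suc r)) 0≤t t≤1)) (≤-reflexive (*-identityʳ (N ^ suc r))))) ⟩
      N ^ suc r * (ι 2 * (ι 10 * α * i) ^ suc r)
        ≡⟨ trans (solve 3 (λ a b c → a :* (b :* c) := b :* (a :* c)) refl (N ^ suc r) (ι 2) ((ι 10 * α * i) ^ suc r))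
             (cong (ι 2 *_) (trans (sym (^-*-distrib N (ι 10 * α * i) (suc r))) (cong (_^ suc r)
               (trans (solve 3 (λ N a i → N :* (con (ι 10) :* a :* i) := con (ι 10) :* a :* (N :* i)) refl N α i)
                 (trans (cong (ι 10 * α *_) (ι*recip n)) (*-identityʳ (ι 10 * α))))))) ⟩
      ι 2 * (ι 10 * α * (ι 10 * α) ^ r)
        ≤⟨ *-monoˡ (0≤ι 2) (*-monoˡ (0≤ι 10 *⁰ 0≤α) (^-mono r (0≤ι 10 *⁰ 0≤α)
             (≤-trans (*-monoˡ (0≤ι 10) (recip-anti 19≤k)) (from≤ᵇ (ι 10 * recip 19) ½ refl)))) ⟩
      ι 2 * (ι 10 * α * ½ ^ r)
        ≡⟨ solve 2 (λ a h → con (ι 2) :* (con (ι 10) :* a :* h) := con (ι 20) :* a :* h) refl α (½ ^ r) ⟩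
      ι 20 * α * ½ ^ r
        ∎
      where open ≤-Reasoning

    -- As 1.05 is the mean of 1 and 1.1, the product (1 - i)(1 - 1.1 i) is at most (1 - 1.05 i)².
    -- Hence the whole is at most (1 - s)² with s = (1.05 i)².
    base≤1 : t * (1ℚ - q) * (χ * χ) ≤ 1ℚ
    base≤1 = ≤-by {s = 25 % 10000 * (i * i) * (χ * χ) + s * (1ℚ + (1ℚ - s))}
      (solve 1 (λ i → let x = con 1ℚ :+ con (105 % 100) :* i ; s = con (11025 % 10000) :* (i :* i) in
        con 1ℚ := (con 1ℚ :- i) :* (con 1ℚ :- con (11 % 10) :* i) :* (x :* x)
          :+ (con (25 % 10000) :* (i :* i) :* (x :* x) :+ s :* (con 1ℚ :+ (con 1ℚ :- s)))) refl i)
      ((0≤% 25 10000 *⁰ 0≤i *⁰ 0≤i) *⁰ 0≤χ *⁰ 0≤χ +⁰ 0≤s *⁰ (0≤1 +⁰ 0≤- s≤1))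
      where
      s : ℚ
      s = 11025 % 10000 * (i * i)
      0≤s : 0ℚ ≤ s
      0≤s = 0≤% 11025 10000 *⁰ 0≤i *⁰ 0≤i
      s≤1 : s ≤ 1ℚ
      s≤1 = ≤-trans (*-monoˡ (0≤% 11025 10000) (*-mono 0≤i (0≤% 1 1000) i≤ i≤)) (from≤ᵇ (11025 % 10000 * (1 % 1000 * (1 % 1000))) 1ℚ refl)

    -- The factors per pair cancel against χ² by `base≤1` and leave 5 q₀^(r + 1). In this regime r
    -- is at least a fixed fraction of N, so the exponential decay yields a bound of order 1/N²,
    -- enough for summing N terms.
    large-term : ∀ r → N ≤ ι 10 * (κ * κ) * ι (suc r) →
      falling (suc n) (suc r) * ((1ℚ - q) ^ triangle (suc r) * (ι 5 * (q₀ * i * χ ^ r) ^ suc r)) ≤ C * (i * i)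
    large-term r N≤ = begin
      falling (suc n) (suc r) * ((1ℚ - q) ^ τ * (ι 5 * (q₀ * i * χ ^ r) ^ suc r))
        ≤⟨ *-monoʳ (0≤^ τ (0≤- q≤1) *⁰ 0≤ι 5 *⁰ 0≤^ (suc r) ((0≤% 49 50 *⁰ 0≤i) *⁰ 0≤^ r 0≤χ)) (falling-bound n (suc r)) ⟩
      N ^ suc r * t ^ τ * ((1ℚ - q) ^ τ * (ι 5 * (q₀ * i * χ ^ r) ^ suc r))
        ≡⟨ cong (λ z → N ^ suc r * t ^ τ * ((1ℚ - q) ^ τ * (ι 5 * z))) (trans (^-*-distrib (q₀ * i) (χ ^ r) (suc r))
             (cong₂ _*_ (^-*-distrib q₀ i (suc r)) (^-triangle χ r))) ⟩
      N ^ suc r * t ^ τ * ((1ℚ - q) ^ τ * (ι 5 * (q₀ ^ suc r * i ^ suc r * (χ * χ) ^ τ)))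
        ≡⟨ solve 6 (λ N t q c i x → N :* t :* (q :* (con (ι 5) :* (c :* i :* x))) := con (ι 5) :* c :* (N :* i) :* (t :* q :* x)) refl
             (N ^ suc r) (t ^ τ) ((1ℚ - q) ^ τ) (q₀ ^ suc r) (i ^ suc r) ((χ * χ) ^ τ) ⟩
      ι 5 * q₀ ^ suc r * (N ^ suc r * i ^ suc r) * (t ^ τ * (1ℚ - q) ^ τ * (χ * χ) ^ τ)
        ≡⟨ cong₂ (λ a b → ι 5 * q₀ ^ suc r * a * b)
             (trans (sym (^-*-distrib N i (suc r))) (trans (cong (_^ suc r) (ι*recip n)) (1^ (suc r))))
             (trans (cong (_* (χ * χ) ^ τ) (sym (^-*-distrib t (1ℚ - q) τ))) (sym (^-*-distrib (t * (1ℚ - q)) (χ * χ) τ))) ⟩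
      ι 5 * q₀ ^ suc r * 1ℚ * (t * (1ℚ - q) * (χ * χ)) ^ τ
        ≤⟨ *-monoˡ ((0≤ι 5 *⁰ 0≤^ (suc r) (0≤% 49 50)) *⁰ 0≤1) (^-≤1 τ ((0≤t *⁰ 0≤- q≤1) *⁰ 0≤χ *⁰ 0≤χ) base≤1) ⟩
      ι 5 * q₀ ^ suc r * 1ℚ * 1ℚ
        -- A factor 1 = (N i)² is inserted, so that N can be replaced by its bound in terms of r
        -- while i² remains.
        ≡⟨ trans (solve 2 (λ c u → con (ι 5) :* c :* con 1ℚ :* con 1ℚ := con (ι 5) :* c) refl (q₀ ^ suc r) N)
             (sym (trans (cong₂ (λ a b → ι 5 * q₀ ^ suc r * (a * b)) (ι*recip n) (ι*recip n)) (*-identityʳ (ι 5 * q₀ ^ suc r)))) ⟩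
      ι 5 * q₀ ^ suc r * (N * i * (N * i))
        ≡⟨ solve 3 (λ c N i → con (ι 5) :* c :* (N :* i :* (N :* i)) := con (ι 5) :* (i :* i) :* (c :* (N :* N))) refl (q₀ ^ suc r) N i ⟩
      ι 5 * (i * i) * (q₀ ^ suc r * (N * N))
        ≤⟨ *-monoˡ (0≤ι 5 *⁰ 0≤i *⁰ 0≤i) (*-monoˡ (0≤^ (suc r) (0≤% 49 50)) (*-mono (0≤ι (suc n)) (≤-trans (0≤ι (suc n)) N≤) N≤ N≤)) ⟩
      ι 5 * (i * i) * (q₀ ^ suc r * (ι 10 * (κ * κ) * R * (ι 10 * (κ * κ) * R)))
        ≡⟨ solve 4 (λ i c k R → con (ι 5) :* (i :* i) :* (c :* (con (ι 10) :* k :* R :* (con (ι 10) :* k :* R)))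
             := con (ι 500) :* (k :* k) :* (i :* i) :* (c :* (R :* R))) refl i (q₀ ^ suc r) (κ * κ) R ⟩
      ι 500 * (κ * κ * (κ * κ)) * (i * i) * (q₀ ^ suc r * (R * R))
        ≤⟨ *-monoˡ ((0≤ι 500 *⁰ (0≤κ *⁰ 0≤κ) *⁰ 0≤κ *⁰ 0≤κ) *⁰ 0≤i *⁰ 0≤i) (q₀^-bound (suc r)) ⟩
      ι 500 * (κ * κ * (κ * κ)) * (i * i) * ι 4802
        ≡⟨ solve 2 (λ k i → con (ι 500) :* k :* i :* con (ι 4802) := con (ι 2401000) :* k :* i) refl (κ * κ * (κ * κ)) (i * i) ⟩
      C * (i * i)
        ∎
      where
      open ≤-Reasoning
      τ : ℕ
      τ = triangle (suc r)
      R : ℚ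
      R = ι (suc r)

    term-bound : ∀ r → falling (suc n) (suc r) * β (suc r) ≤ ι 20 * α * ½ ^ r + C * (i * i)
    term-bound r = select-elim (λ z → falling (suc n) (suc r) * z ≤ ι 20 * α * ½ ^ r + C * (i * i))
      (10 ℕ.* (suc k ℕ.* suc k) ℕ.* suc r ℕ.≤? suc n)
      (λ _ → ≤-trans (small-term r) (≤-by {s = C * (i * i)} refl (0≤C *⁰ 0≤i *⁰ 0≤i)))
      (λ ¬l → ≤-trans (large-term r (cast-≥ (suc r) ¬l))
        (≤-by {s = ι 20 * α * ½ ^ r} (+-comm (ι 20 * α * ½ ^ r) (C * (i * i))) ((0≤ι 20 *⁰ 0≤α) *⁰ 0≤^ r 0≤½)))

    total-bound : ∑< (suc (suc n)) (λ r → falling (suc n) r * β r) ≤ ι 40 * α + C * i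
    total-bound = begin
      1ℚ * 0ℚ + ∑< (suc n) (λ r → falling (suc n) (suc r) * β (suc r))
        ≡⟨ trans (cong (_+ ∑< (suc n) (λ r → falling (suc n) (suc r) * β (suc r))) (*-zeroʳ 1ℚ)) (+-identityˡ _) ⟩
      ∑< (suc n) (λ r → falling (suc n) (suc r) * β (suc r))
        ≤⟨ ∑<-mono (suc n) term-bound ⟩
      ∑< (suc n) (λ r → ι 20 * α * ½ ^ r + C * (i * i))
        ≡⟨ trans (∑<-+ (suc n) (λ r → ι 20 * α * ½ ^ r) (λ _ → C * (i * i)))
             (cong₂ _+_ (∑<-*ˡ (suc n) (ι 20 * α) (½ ^_)) (∑<-const (suc n) (C * (i * i)))) ⟩
      ι 20 * α * ∑< (suc n) (½ ^_) + N * (C * (i * i))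
        ≤⟨ +-monoˡ-≤ (N * (C * (i * i))) (*-monoˡ (0≤ι 20 *⁰ 0≤α) (∑<-½ (suc n))) ⟩
      ι 20 * α * ι 2 + N * (C * (i * i))
        ≡⟨ trans (solve 4 (λ a N C i → con (ι 20) :* a :* con (ι 2) :+ N :* (C :* (i :* i)) := con (ι 40) :* a :+ C :* i :* (N :* i)) refl α N C i)
             (cong (λ z → ι 40 * α + z) (trans (cong (C * i *_) (ι*recip n)) (*-identityʳ (C * i)))) ⟩
      ι 40 * α + C * i
        ∎
      where open ≤-Reasoning

-- Rigidity obstructions from vertices of small degree

module Flexibility where

  open Rationals using (ι; ι-+; ι-mono; toℚᵘ-/)
  open import Defs using (ℝ; fromℚ; _≃_; SimpleGraph; Adj; _[_]; GloballyRigid)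
  open import Data.Fin.Subset using (Subset; _∈_; inside; outside; ∣_∣)
  open import Data.Rational.Solver using (module +-*-Solver)
  open import Data.Vec using (_∷_; _[_]≔_)
  open import Data.Vec using (here; there)
  open import Data.Vec.Properties.WithK using ([]=-irrelevant)
  open +-*-Solver using (solve; con; _:+_; _:*_; _:-_; :-_; _:=_)

  ι-injective : ∀ {m n} → ι m ≡ ι n → m ≡ n
  ι-injective {m} {n} e = ℤₚ.+-injective (ℤₚ.*-cancelʳ-≡ (ℤ.+ m) (ℤ.+ n) (ℤ.+ 1) (ℚᵘₚ.drop-*≡*
    (ℚᵘₚ.≃-trans (ℚᵘₚ.≃-sym (toℚᵘ-/ (ℤ.+ m) 0)) (ℚᵘₚ.≃-trans (ℚₚ.toℚᵘ-cong e) (toℚᵘ-/ (ℤ.+ n) 0)))))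

  fromℚ-≃ : ∀ {p q} → p ≡ q → fromℚ p ≃ fromℚ q
  fromℚ-≃ {p} refl ε 0<ε = 0 , λ _ _ → ℚₚ.≤-trans (ℚₚ.≤-reflexive (cong ℚ.∣_∣ (ℚₚ.+-inverseʳ p))) (ℚₚ.<⇒≤ 0<ε)

  -- If the distance of p and q were positive, a rational strictly between 0 and that distance would
  -- contradict the equality at that tolerance.
  fromℚ-injective : ∀ {p q} → fromℚ p ≃ fromℚ q → p ≡ q
  fromℚ-injective {p} {q} p≃q = trans (solve 2 (λ p q → p := (p :- q) :+ q) refl p q)
    (trans (cong (ℚ._+ q) (ℚₚ.∣p∣≡0⇒p≡0 (p ℚ.- q) (ℚₚ.≤-antisym ∣p-q∣≤0 (ℚₚ.0≤∣p∣ (p ℚ.- q))))) (ℚₚ.+-identityˡ q))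
    where
    ∣p-q∣≤0 : ℚ.∣ p ℚ.- q ∣ ℚ.≤ 0ℚ
    ∣p-q∣≤0 = ℚₚ.≮⇒≥ λ 0<d → let (ε , 0<ε , ε<d) = ℚₚ.<-dense 0<d ; (N , close) = p≃q ε 0<ε in
      ℚₚ.<-irrefl refl (ℚₚ.<-≤-trans ε<d (close N ℕₚ.≤-refl))

  ∣+∣≡∣-∣ : ∀ {a b} → a ≡ 0ℚ ⊎ b ≡ 0ℚ → ℚ.∣ a ℚ.+ b ∣ ≡ ℚ.∣ a ℚ.- b ∣
  ∣+∣≡∣-∣ {a} {b} (inj₁ refl) = trans (sym (ℚₚ.∣-p∣≡∣p∣ (0ℚ ℚ.+ b)))
    (cong ℚ.∣_∣ (solve 1 (λ b → :- (con 0ℚ :+ b) := con 0ℚ :- b) refl b))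
  ∣+∣≡∣-∣ {a} {b} (inj₂ refl) = refl

  ∣+∣≡∣-∣⁻¹ : ∀ {a b} → ℚ.∣ a ℚ.+ b ∣ ≡ ℚ.∣ a ℚ.- b ∣ → a ≡ 0ℚ ⊎ b ≡ 0ℚ
  ∣+∣≡∣-∣⁻¹ {a} {b} e with ℚₚ.∣p∣≡p∨∣p∣≡-p (a ℚ.+ b) | ℚₚ.∣p∣≡p∨∣p∣≡-p (a ℚ.- b)
  ... | inj₁ p | inj₁ q = inj₂ (same (trans (sym p) (trans e q)))
    where
    same : a ℚ.+ b ≡ a ℚ.- b → b ≡ 0ℚ
    same e = trans (solve 2 (λ a b → b := con ½ :* ((a :+ b) :- (a :- b))) refl a b)
      (trans (cong (λ z → ½ ℚ.* (z ℚ.- (a ℚ.- b))) e)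
        (solve 2 (λ a b → con ½ :* ((a :- b) :- (a :- b)) := con 0ℚ) refl a b))
  ... | inj₂ p | inj₂ q = inj₂ (same (trans (sym p) (trans e q)))
    where
    same : ℚ.- (a ℚ.+ b) ≡ ℚ.- (a ℚ.- b) → b ≡ 0ℚ
    same e = trans (solve 2 (λ a b → b := con ½ :* (:- (a :- b) :- (:- (a :+ b)))) refl a b)
      (trans (cong (λ z → ½ ℚ.* (ℚ.- (a ℚ.- b) ℚ.- z)) e)
        (solve 2 (λ a b → con ½ :* (:- (a :- b) :- (:- (a :- b))) := con 0ℚ) refl a b))
  ... | inj₁ p | inj₂ q = inj₁ (opposite (trans (sym p) (trans e q)))
    where
    opposite : a ℚ.+ b ≡ ℚ.- (a ℚ.- b) → a ≡ 0ℚ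
    opposite e = trans (solve 2 (λ a b → a := con ½ :* ((a :+ b) :+ (a :- b))) refl a b)
      (trans (cong (λ z → ½ ℚ.* (z ℚ.+ (a ℚ.- b))) e)
        (solve 2 (λ a b → con ½ :* (:- (a :- b) :+ (a :- b)) := con 0ℚ) refl a b))
  ... | inj₂ p | inj₁ q = inj₁ (opposite (trans (sym p) (trans e q)))
    where
    opposite : ℚ.- (a ℚ.+ b) ≡ a ℚ.- b → a ≡ 0ℚ
    opposite e = trans (solve 2 (λ a b → a := con ½ :* ((a :+ b) :+ (a :- b))) refl a b)
      (trans (cong (λ z → ½ ℚ.* ((a ℚ.+ b) ℚ.+ z)) (sym e))
        (solve 2 (λ a b → con ½ :* ((a :+ b) :+ (:- (a :+ b))) := con 0ℚ) refl a b))

  5*-+-injective : ∀ a b {s t} → s ℕ.< 5 → t ℕ.< 5 → 5 ℕ.* a ℕ.+ s ≡ 5 ℕ.* b ℕ.+ t → a ≡ b × s ≡ t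
  5*-+-injective zero    zero    s<5 t<5 e = refl , e
  5*-+-injective zero    (suc b) {s} {t} s<5 t<5 e = contradiction
    (ℕₚ.≤-trans (ℕₚ.≤-trans (ℕₚ.m≤m*n 5 (suc b)) (ℕₚ.m≤m+n (5 ℕ.* suc b) t)) (ℕₚ.≤-reflexive (sym e))) (ℕₚ.<⇒≱ s<5)
  5*-+-injective (suc a) zero    {s} {t} s<5 t<5 e = contradiction
    (ℕₚ.≤-trans (ℕₚ.≤-trans (ℕₚ.m≤m*n 5 (suc a)) (ℕₚ.m≤m+n (5 ℕ.* suc a) s)) (ℕₚ.≤-reflexive e)) (ℕₚ.<⇒≱ t<5)
  5*-+-injective (suc a) (suc b) {s} {t} s<5 t<5 e = cong suc (proj₁ smaller) , proj₂ smaller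
    where
    shift : ∀ a s → 5 ℕ.* suc a ℕ.+ s ≡ 5 ℕ.+ (5 ℕ.* a ℕ.+ s)
    shift a s = trans (cong (ℕ._+ s) (ℕₚ.*-suc 5 a)) (ℕₚ.+-assoc 5 (5 ℕ.* a) s)
    smaller : a ≡ b × s ≡ t
    smaller = 5*-+-injective a b s<5 t<5
      (ℕₚ.+-cancelˡ-≡ 5 (5 ℕ.* a ℕ.+ s) (5 ℕ.* b ℕ.+ t) (trans (sym (shift a s)) (trans e (shift b t))))

  -- The embeddings 5π + σ and 5π - σ have the same edge lengths.
  flexible : ∀ {n} (G : SimpleGraph (Fin n)) (V′ : Subset n) (π σ : Fin n → ℕ) → (∀ x → σ x ℕ.≤ 2) →
    (∀ {x y} → x ∈ V′ → y ∈ V′ → Adj G x y → π x ≡ π y ⊎ σ x ≡ σ y) →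
    (∀ {x y} → x ∈ V′ → y ∈ V′ → π x ≡ π y → σ x ≡ σ y → x ≡ y) →
    ∀ {x y} → x ∈ V′ → y ∈ V′ → π x ≢ π y → σ x ≢ σ y → ¬ GloballyRigid (G [ V′ ])
  flexible {n} G V′ π σ σ≤2 edges injective {x₀} {y₀} x₀∈ y₀∈ π≢ σ≢ rigid =
    absurd (∣+∣≡∣-∣⁻¹ (trans (sym (f-distance x₀ y₀)) (trans distances (g-distance x₀ y₀))))
    where
    V : Set
    V = ∃[ x ] x ∈ V′
    p s : Fin n → ℚ
    p x = ι (5 ℕ.* π x)
    s x = ι (σ x)
    f g : V → ℝ
    f (x , _) = fromℚ (p x ℚ.+ s x)
    g (x , _) = fromℚ (p x ℚ.- s x)
    σ<5 : ∀ x → σ x ℕ.< 5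
    σ<5 x = ℕ.s≤s (ℕₚ.≤-trans (σ≤2 x) (ℕₚ.m≤m+n 2 2))
    -- A vertex of the induced subgraph carries a proof of membership; such proofs are unique.
    ≡-vertex : ∀ {x y} {x∈ : x ∈ V′} {y∈ : y ∈ V′} → x ≡ y → (x , x∈) ≡ (y , y∈)
    ≡-vertex {x} refl = cong (x ,_) ([]=-irrelevant _ _)
    f-injective : ∀ {a b} → f a ≃ f b → a ≡ b
    f-injective {x , x∈} {y , y∈} e =
      let (πx≡πy , σx≡σy) = 5*-+-injective (π x) (π y) (σ<5 x) (σ<5 y) (ι-injective
            (trans (ι-+ (5 ℕ.* π x) (σ x)) (trans (fromℚ-injective e) (sym (ι-+ (5 ℕ.* π y) (σ y))))))
      in ≡-vertex (injective x∈ y∈ πx≡πy σx≡σy)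
    g-injective : ∀ {a b} → g a ≃ g b → a ≡ b
    g-injective {x , x∈} {y , y∈} e =
      let (πx≡πy , σy≡σx) = 5*-+-injective (π x) (π y) (σ<5 y) (σ<5 x) (ι-injective
            (trans (ι-+ (5 ℕ.* π x) (σ y)) (trans (move (fromℚ-injective e)) (sym (ι-+ (5 ℕ.* π y) (σ x))))))
      in ≡-vertex (injective x∈ y∈ πx≡πy (sym σy≡σx))
      where
      move : p x ℚ.- s x ≡ p y ℚ.- s y → p x ℚ.+ s y ≡ p y ℚ.+ s x
      move e = trans (solve 3 (λ a b c → a :+ c := (a :- b) :+ (b :+ c)) refl (p x) (s x) (s y))
        (trans (cong (ℚ._+ (s x ℚ.+ s y)) e) (solve 3 (λ a b c → (a :- c) :+ (b :+ c) := a :+ b) refl (p y) (s x) (s y)))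
    f-distance : ∀ x y → ℚ.∣ (p x ℚ.+ s x) ℚ.- (p y ℚ.+ s y) ∣ ≡ ℚ.∣ (p x ℚ.- p y) ℚ.+ (s x ℚ.- s y) ∣
    f-distance x y = cong ℚ.∣_∣ (solve 4 (λ a b c d → (a :+ b) :- (c :+ d) := (a :- c) :+ (b :- d)) refl (p x) (s x) (p y) (s y))
    g-distance : ∀ x y → ℚ.∣ (p x ℚ.- s x) ℚ.- (p y ℚ.- s y) ∣ ≡ ℚ.∣ (p x ℚ.- p y) ℚ.- (s x ℚ.- s y) ∣
    g-distance x y = cong ℚ.∣_∣ (solve 4 (λ a b c d → (a :- b) :- (c :- d) := (a :- c) :- (b :- d)) refl (p x) (s x) (p y) (s y))
    same-length : ∀ a b → Adj (G [ V′ ]) a b → Defs.∣ f a Defs.- f b ∣ ≃ Defs.∣ g a Defs.- g b ∣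
    same-length (x , x∈) (y , y∈) xy = fromℚ-≃ (trans (f-distance x y) (trans (∣+∣≡∣-∣ (vanish (edges x∈ y∈ xy))) (sym (g-distance x y))))
      where
      vanish : π x ≡ π y ⊎ σ x ≡ σ y → p x ℚ.- p y ≡ 0ℚ ⊎ s x ℚ.- s y ≡ 0ℚ
      vanish (inj₁ e) = inj₁ (trans (cong (λ z → ι (5 ℕ.* z) ℚ.- p y) e) (ℚₚ.+-inverseʳ (p y)))
      vanish (inj₂ e) = inj₂ (trans (cong (λ z → ι z ℚ.- s y) e) (ℚₚ.+-inverseʳ (s y)))
    distances : ℚ.∣ (p x₀ ℚ.+ s x₀) ℚ.- (p y₀ ℚ.+ s y₀) ∣ ≡ ℚ.∣ (p x₀ ℚ.- s x₀) ℚ.- (p y₀ ℚ.- s y₀) ∣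
    distances = fromℚ-injective (rigid f g f-injective g-injective same-length (x₀ , x₀∈) (y₀ , y₀∈))
    zero-difference : ∀ a b → ι a ℚ.- ι b ≡ 0ℚ → a ≡ b
    zero-difference a b e = ι-injective (trans (solve 2 (λ a b → a := (a :- b) :+ b) refl (ι a) (ι b))
      (trans (cong (ℚ._+ ι b) e) (ℚₚ.+-identityˡ (ι b))))
    absurd : p x₀ ℚ.- p y₀ ≡ 0ℚ ⊎ s x₀ ℚ.- s y₀ ≡ 0ℚ → ⊥
    absurd (inj₁ e) = π≢ (ℕₚ.*-cancelˡ-≡ (π x₀) (π y₀) 5 (zero-difference (5 ℕ.* π x₀) (5 ℕ.* π y₀) e))
    absurd (inj₂ e) = σ≢ (zero-difference (σ x₀) (σ y₀) e)

  module _ {n : ℕ} (G : SimpleGraph (Fin n)) (V′ : Subset n) where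

    -- The vertex v is reflected in its only neighbour a: it lies at 5a + 1 and at 5a - 1, while
    -- every other x stays at 5x. The distance to the third vertex b changes. An isolated v is
    -- included, with any a.
    leaf-flexible : ∀ {v a b} → v ∈ V′ → b ∈ V′ → b ≢ v → b ≢ a → a ≢ v →
      (∀ {x} → x ∈ V′ → Adj G v x → x ≡ a) → ¬ GloballyRigid (G [ V′ ])
    leaf-flexible {v} {a} {b} v∈ b∈ b≢v b≢a a≢v nbrs =
      flexible G V′ (toℕ ∘ π) σ σ≤2 edges injective v∈ b∈ different-π different-σ
      where
      π : Fin n → Fin n
      π x with x Fin.≟ v
      ... | yes _ = a
      ... | no  _ = x
      σ : Fin n → ℕ
      σ x with x Fin.≟ v
      ... | yes _ = 1
      ... | no  _ = 0
      σ≤2 : ∀ x → σ x ℕ.≤ 2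
      σ≤2 x with x Fin.≟ v
      ... | yes _ = ℕ.s≤s ℕ.z≤n
      ... | no  _ = ℕ.z≤n
      edges : ∀ {x y} → x ∈ V′ → y ∈ V′ → Adj G x y → toℕ (π x) ≡ toℕ (π y) ⊎ σ x ≡ σ y
      edges {x} {y} x∈ y∈ xy with x Fin.≟ v | y Fin.≟ v
      ... | yes _    | yes _    = inj₂ refl
      ... | yes refl | no  _    = inj₁ (cong toℕ (sym (nbrs y∈ xy)))
      ... | no  _    | yes refl = inj₁ (cong toℕ (nbrs x∈ (SimpleGraph.symmetric G xy)))
      ... | no  _    | no  _    = inj₂ refl
      injective : ∀ {x y} → x ∈ V′ → y ∈ V′ → toℕ (π x) ≡ toℕ (π y) → σ x ≡ σ y → x ≡ y
      injective {x} {y} x∈ y∈ πx≡πy σx≡σy with x Fin.≟ v | y Fin.≟ v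
      ... | yes x≡v | yes y≡v = trans x≡v (sym y≡v)
      ... | no  _   | no  _   = Finₚ.toℕ-injective πx≡πy
      different-π : toℕ (π v) ≢ toℕ (π b)
      different-π e with v Fin.≟ v | b Fin.≟ v
      ... | no v≢v | _       = v≢v refl
      ... | yes _  | yes b≡v = b≢v b≡v
      ... | yes _  | no  _   = b≢a (sym (Finₚ.toℕ-injective e))
      different-σ : σ v ≢ σ b
      different-σ e with v Fin.≟ v | b Fin.≟ v
      different-σ e  | no v≢v | _       = v≢v refl
      different-σ e  | yes _  | yes b≡v = b≢v b≡v
      different-σ () | yes _  | no  _

    -- u and v are reflected in their other neighbours a and c; the value of τ separates them if a ≡ c.
    pair-flexible : ∀ {u v a c b} → u ∈ V′ → v ∈ V′ → b ∈ V′ → u ≢ v → a ≢ u → a ≢ v → c ≢ u → c ≢ v →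
      b ≢ u → b ≢ v → b ≢ a →
      (∀ {x} → x ∈ V′ → Adj G u x → x ≡ v ⊎ x ≡ a) → (∀ {x} → x ∈ V′ → Adj G v x → x ≡ u ⊎ x ≡ c) →
      ¬ GloballyRigid (G [ V′ ])
    pair-flexible {u} {v} {a} {c} {b} u∈ v∈ b∈ u≢v a≢u a≢v c≢u c≢v b≢u b≢v b≢a nbrs-u nbrs-v =
      flexible G V′ (toℕ ∘ π) σ σ≤2 edges injective u∈ b∈ different-π different-σ
      where
      π : Fin n → Fin n
      π x with x Fin.≟ u | x Fin.≟ v
      ... | yes _ | _     = a
      ... | no  _ | yes _ = c
      ... | no  _ | no  _ = x
      τ : ℕ
      τ with a Fin.≟ c
      ... | yes _ = 2
      ... | no  _ = 1
      τ≤2 : τ ℕ.≤ 2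
      τ≤2 with a Fin.≟ c
      ... | yes _ = ℕₚ.≤-refl
      ... | no  _ = ℕ.s≤s ℕ.z≤n
      τ≢0 : τ ≢ 0
      τ≢0 e with a Fin.≟ c
      τ≢0 () | yes _
      τ≢0 () | no  _
      τ-separates : a ≡ c → 1 ≢ τ
      τ-separates a≡c e with a Fin.≟ c
      τ-separates a≡c () | yes _
      τ-separates a≡c e  | no a≢c = a≢c a≡c
      τ-joins : a ≡ c ⊎ 1 ≡ τ
      τ-joins with a Fin.≟ c
      ... | yes a≡c = inj₁ a≡c
      ... | no  _   = inj₂ refl
      σ : Fin n → ℕ
      σ x with x Fin.≟ u | x Fin.≟ v
      ... | yes _ | _     = 1
      ... | no  _ | yes _ = τ
      ... | no  _ | no  _ = 0
      σ≤2 : ∀ x → σ x ℕ.≤ 2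
      σ≤2 x with x Fin.≟ u | x Fin.≟ v
      ... | yes _ | _     = ℕ.s≤s ℕ.z≤n
      ... | no  _ | yes _ = τ≤2
      ... | no  _ | no  _ = ℕ.z≤n
      edges : ∀ {x y} → x ∈ V′ → y ∈ V′ → Adj G x y → toℕ (π x) ≡ toℕ (π y) ⊎ σ x ≡ σ y
      edges {x} {y} x∈ y∈ xy with x Fin.≟ u | x Fin.≟ v | y Fin.≟ u | y Fin.≟ v
      ... | yes _    | _        | yes _    | _        = inj₂ refl
      ... | yes _    | _        | no  _    | yes _    = joined τ-joins
        where
        joined : a ≡ c ⊎ 1 ≡ τ → toℕ a ≡ toℕ c ⊎ 1 ≡ τ
        joined (inj₁ a≡c) = inj₁ (cong toℕ a≡c)
        joined (inj₂ 1≡τ) = inj₂ 1≡τ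
      ... | yes refl | _        | no  _    | no y≢v   = inj₁ (cong toℕ (end (nbrs-u y∈ xy)))
        where
        end : y ≡ v ⊎ y ≡ a → a ≡ y
        end (inj₁ y≡v) = contradiction y≡v y≢v
        end (inj₂ y≡a) = sym y≡a
      ... | no  _    | yes _    | yes _    | _        = joined τ-joins
        where
        joined : a ≡ c ⊎ 1 ≡ τ → toℕ c ≡ toℕ a ⊎ τ ≡ 1
        joined (inj₁ a≡c) = inj₁ (cong toℕ (sym a≡c))
        joined (inj₂ 1≡τ) = inj₂ (sym 1≡τ)
      ... | no  _    | yes _    | no  _    | yes _    = inj₂ refl
      ... | no  _    | yes refl | no y≢u   | no  _    = inj₁ (cong toℕ (end (nbrs-v y∈ xy)))
        where
        end : y ≡ u ⊎ y ≡ c → c ≡ y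
        end (inj₁ y≡u) = contradiction y≡u y≢u
        end (inj₂ y≡c) = sym y≡c
      ... | no  _    | no x≢v   | yes refl | _        = inj₁ (cong toℕ (end (nbrs-u x∈ (SimpleGraph.symmetric G xy))))
        where
        end : x ≡ v ⊎ x ≡ a → x ≡ a
        end (inj₁ x≡v) = contradiction x≡v x≢v
        end (inj₂ x≡a) = x≡a
      ... | no x≢u   | no  _    | no  _    | yes refl = inj₁ (cong toℕ (end (nbrs-v x∈ (SimpleGraph.symmetric G xy))))
        where
        end : x ≡ u ⊎ x ≡ c → x ≡ c
        end (inj₁ x≡u) = contradiction x≡u x≢u
        end (inj₂ x≡c) = x≡c
      ... | no  _    | no  _    | no  _    | no  _    = inj₂ refl
      injective : ∀ {x y} → x ∈ V′ → y ∈ V′ → toℕ (π x) ≡ toℕ (π y) → σ x ≡ σ y → x ≡ y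
      injective {x} {y} x∈ y∈ πx≡πy σx≡σy with x Fin.≟ u | x Fin.≟ v | y Fin.≟ u | y Fin.≟ v
      ... | yes x≡u | _       | yes y≡u | _       = trans x≡u (sym y≡u)
      ... | yes _   | _       | no  _   | yes _   = contradiction σx≡σy (τ-separates (Finₚ.toℕ-injective πx≡πy))
      ... | no  _   | yes _   | yes _   | _       = contradiction (sym σx≡σy) (τ-separates (sym (Finₚ.toℕ-injective πx≡πy)))
      ... | no  _   | yes x≡v | no  _   | yes y≡v = trans x≡v (sym y≡v)
      ... | no  _   | yes _   | no  _   | no  _   = contradiction σx≡σy τ≢0
      ... | no  _   | no  _   | no  _   | yes _   = contradiction (sym σx≡σy) τ≢0
      ... | no  _   | no  _   | no  _   | no  _   = Finₚ.toℕ-injective πx≡πy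
      different-π : toℕ (π u) ≢ toℕ (π b)
      different-π e with u Fin.≟ u | b Fin.≟ u | b Fin.≟ v
      ... | no u≢u | _       | _       = u≢u refl
      ... | yes _  | yes b≡u | _       = b≢u b≡u
      ... | yes _  | no  _   | yes b≡v = b≢v b≡v
      ... | yes _  | no  _   | no  _   = b≢a (sym (Finₚ.toℕ-injective e))
      different-σ : σ u ≢ σ b
      different-σ e with u Fin.≟ u | b Fin.≟ u | b Fin.≟ v
      different-σ e  | no u≢u | _       | _       = u≢u refl
      different-σ e  | yes _  | yes b≡u | _       = b≢u b≡u
      different-σ e  | yes _  | no  _   | yes b≡v = b≢v b≡v
      different-σ () | yes _  | no  _   | no  _

  ∣∣-remove : ∀ {n} (p : Subset n) x → ∣ p ∣ ℕ.≤ suc ∣ p [ x ]≔ outside ∣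
  ∣∣-remove (inside  ∷ p) Fin.zero    = ℕₚ.≤-refl
  ∣∣-remove (outside ∷ p) Fin.zero    = ℕₚ.n≤1+n _
  ∣∣-remove (inside  ∷ p) (Fin.suc x) = ℕ.s≤s (∣∣-remove p x)
  ∣∣-remove (outside ∷ p) (Fin.suc x) = ∣∣-remove p x

  ∈-remove : ∀ {n} {p : Subset n} {x y} → y ∈ p [ x ]≔ outside → y ∈ p × y ≢ x
  ∈-remove {p = _ ∷ _} {Fin.zero}  {Fin.suc y} (there y∈) = there y∈ , λ ()
  ∈-remove {p = _ ∷ _} {Fin.suc x} {Fin.zero}  here       = here , λ ()
  ∈-remove {p = _ ∷ _} {Fin.suc x} {Fin.suc y} (there y∈) =
    let (y∈p , y≢x) = ∈-remove y∈ in there y∈p , λ e → y≢x (Finₚ.suc-injective e)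

  ∈-pick : ∀ {n} (p : Subset n) → 1 ℕ.≤ ∣ p ∣ → ∃[ x ] x ∈ p
  ∈-pick (inside  ∷ p) 1≤ = Fin.zero , here
  ∈-pick (outside ∷ p) 1≤ = let (x , x∈) = ∈-pick p 1≤ in Fin.suc x , there x∈

  ∈-pick₄ : ∀ {n} (p : Subset n) → 4 ℕ.≤ ∣ p ∣ → ∀ x y z → ∃[ b ] (b ∈ p × b ≢ x × b ≢ y × b ≢ z)
  ∈-pick₄ p 4≤ x y z =
    let (b , b∈) = ∈-pick (p [ x ]≔ outside [ y ]≔ outside [ z ]≔ outside)
          (drop (drop (drop 4≤ (∣∣-remove p x)) (∣∣-remove (p [ x ]≔ outside) y)) (∣∣-remove (p [ x ]≔ outside [ y ]≔ outside) z))
        (b∈₂ , b≢z) = ∈-remove b∈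
        (b∈₁ , b≢y) = ∈-remove b∈₂
        (b∈p , b≢x) = ∈-remove b∈₁
    in b , b∈p , b≢x , b≢y , b≢z
    where
    drop : ∀ {m i j} → suc m ℕ.≤ i → i ℕ.≤ suc j → m ℕ.≤ j
    drop m<i i≤j = ℕₚ.≤-pred (ℕₚ.≤-trans m<i i≤j)

-- A globally rigid induced subgraph yields a core

module RigidCores where

  open Rationals
  open WordCounting
  open Links
  open Expectation
  open CoreMeans
  open Flexibility
  open import Defs using (graph; SimpleGraph; Adj; _[_]; GloballyRigid; EdgeList; pairs)
  open import Data.Fin.Subset as Subset using (Subset; ∣_∣)
  open import Data.Fin.Subset.Properties using (_∈?_)
  open import Data.List.Membership.Propositional using (_∈_)
  open import Data.List.Membership.Propositional.Properties using (∈-filter⁺; ∈-filter⁻; ∈-allFin; ∈-cartesianProduct⁺; ∈-++⁺ˡ; ∈-++⁺ʳ; ∈-map⁺)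
  open import Data.List.Relation.Unary.Any using (here; there)

  total : ∀ {A : Set} → List A → (A → ℕ) → ℕ
  total []       f = 0
  total (x ∷ xs) f = f x ℕ.+ total xs f

  indicator : ∀ {A : Set} → Dec A → ℕ
  indicator (yes _) = 1
  indicator (no  _) = 0

  module _ {A : Set} {P : A → Set} (P? : Decidable P) where

    length-filter : ∀ xs → length (filter P? xs) ≡ total xs (indicator ∘ P?)
    length-filter []       = refl
    length-filter (x ∷ xs) with P? x
    ... | yes _ = cong suc (length-filter xs)
    ... | no  _ = length-filter xs

    total-filter : ∀ xs f → total xs f ≡ total (filter P? xs) f ℕ.+ total (filter (¬? ∘ P?) xs) f
    total-filter []       f = refl
    total-filter (x ∷ xs) f with P? x
    ... | yes _ = trans (cong (f x ℕ.+_) (total-filter xs f)) (sym (ℕₚ.+-assoc (f x) _ _))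
    ... | no  _ = trans (cong (f x ℕ.+_) (total-filter xs f))
      (trans (sym (ℕₚ.+-assoc (f x) a b)) (trans (cong (ℕ._+ b) (ℕₚ.+-comm (f x) a)) (ℕₚ.+-assoc a (f x) b)))
      where
      a = total (filter P? xs) f
      b = total (filter (¬? ∘ P?) xs) f

    filter-∈-splits : ∀ xs → (filter P? xs , filter (¬? ∘ P?) xs) ∈ splits xs
    filter-∈-splits []       = here refl
    filter-∈-splits (x ∷ xs) with P? x
    ... | yes _ = ∈-++⁺ˡ (∈-map⁺ (λ (us , vs) → x ∷ us , vs) (filter-∈-splits xs))
    ... | no  _ = ∈-++⁺ʳ (map (λ (us , vs) → x ∷ us , vs) (splits xs)) (∈-map⁺ (λ (us , vs) → us , x ∷ vs) (filter-∈-splits xs))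

  pairsOf-∈ : ∀ {A : Set} {xs : List A} {x y} → x ∈ xs → y ∈ xs → x ≢ y → (x , y) ∈ pairsOf xs ⊎ (y , x) ∈ pairsOf xs
  pairsOf-∈ (here refl) (here refl) x≢y = contradiction refl x≢y
  pairsOf-∈ (here refl) (there y∈) x≢y = inj₁ (∈-++⁺ˡ (∈-map⁺ (_ ,_) y∈))
  pairsOf-∈ (there x∈) (here refl) x≢y = inj₂ (∈-++⁺ˡ (∈-map⁺ (_ ,_) x∈))
  pairsOf-∈ {xs = z ∷ xs} (there x∈) (there y∈) x≢y with pairsOf-∈ x∈ y∈ x≢y
  ... | inj₁ p = inj₁ (∈-++⁺ʳ (map (z ,_) xs) p)
  ... | inj₂ p = inj₂ (∈-++⁺ʳ (map (z ,_) xs) p)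

  ∑-∈ : ∀ {A : Set} {xs : List A} {x} (f : A → ℚ) → (∀ x → 0ℚ ℚ.≤ f x) → x ∈ xs → f x ℚ.≤ ∑ xs f
  ∑-∈ {xs = x ∷ xs} f 0≤f (here refl) = ≤-by refl (0≤∑ xs 0≤f)
  ∑-∈ {xs = y ∷ xs} f 0≤f (there x∈) = ℚₚ.≤-trans (∑-∈ f 0≤f x∈) (≤-by (ℚₚ.+-comm (f y) (∑ xs f)) (0≤f y))

  module _ {n : ℕ} where

    V : Set
    V = Fin n

    -- The orientation in which the pair is listed in `pairs`.
    edge : V → V → V × V
    edge i j with i Fin.<? j
    ... | yes _ = i , j
    ... | no  _ = j , i

    edge-injective : ∀ {a b c d} → edge a b ≡ edge c d → (a ≡ c × b ≡ d) ⊎ (a ≡ d × b ≡ c)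
    edge-injective {a} {b} {c} {d} e with a Fin.<? b | c Fin.<? d | e
    ... | yes _ | yes _ | refl = inj₁ (refl , refl)
    ... | yes _ | no  _ | refl = inj₂ (refl , refl)
    ... | no  _ | yes _ | refl = inj₂ (refl , refl)
    ... | no  _ | no  _ | refl = inj₁ (refl , refl)

    edge-< : ∀ {i j} → i Fin.< j → edge i j ≡ (i , j)
    edge-< {i} {j} i<j with i Fin.<? j
    ... | yes _  = refl
    ... | no i≮j = contradiction i<j i≮j

    edge-> : ∀ {i j} → j Fin.< i → edge i j ≡ (j , i)
    edge-> {i} {j} j<i with i Fin.<? j
    ... | yes i<j = contradiction i<j (ℕₚ.<-asym j<i)
    ... | no  _   = refl

    edge-comm : ∀ i j → edge i j ≡ edge j i
    edge-comm i j with ℕₚ.<-cmp (toℕ i) (toℕ j)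
    ... | tri< i<j _ _ = trans (edge-< i<j) (sym (edge-> i<j))
    ... | tri≈ _ i≡j _ = cong₂ edge (Finₚ.toℕ-injective i≡j) (sym (Finₚ.toℕ-injective i≡j))
    ... | tri> _ _ j<i = trans (edge-> j<i) (sym (edge-< j<i))

    pairs-unique : Unique (pairs n)
    pairs-unique = Uniqueₚ.filter⁺ _ (Uniqueₚ.cartesianProduct⁺ (Uniqueₚ.allFin⁺ n) (Uniqueₚ.allFin⁺ n))

    edge∈pairs : ∀ {i j} → i ≢ j → edge i j ∈ pairs n
    edge∈pairs {i} {j} i≢j with ℕₚ.<-cmp (toℕ i) (toℕ j)
    ... | tri< i<j _ _ = subst (_∈ pairs n) (sym (edge-< i<j)) (∈-filter⁺ _ (∈-cartesianProduct⁺ (∈-allFin i) (∈-allFin j)) i<j)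
    ... | tri≈ _ i≡j _ = contradiction (Finₚ.toℕ-injective i≡j) i≢j
    ... | tri> _ _ j<i = subst (_∈ pairs n) (sym (edge-> j<i)) (∈-filter⁺ _ (∈-cartesianProduct⁺ (∈-allFin j) (∈-allFin i)) j<i)

    _≟ᴱ_ : DecidableEquality (V × V)
    _≟ᴱ_ = ≡-dec Fin._≟_ Fin._≟_

    open Words {V} Fin._≟_
    open Membership _≟ᴱ_
    open LinkCounting {V} Fin._≟_ _≟ᴱ_ edge
    open Cores {V} Fin._≟_ _≟ᴱ_ edge

    -- `graph` accepts an edge in either orientation, whereas `member (edge u x)` looks for one
    -- only. On sorted lists the two agree.
    Sorted : EdgeList n → Set
    Sorted = All (λ (i , j) → i Fin.< j)

    module _ {es : EdgeList n} (sorted : Sorted es) (V′ : Subset n) where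

      G : SimpleGraph (Fin n)
      G = graph es

      Neighbour : V → V → Set
      Neighbour u x = x Subset.∈ V′ × u ≢ x × member (edge u x) es ≡ true

      neighbour? : ∀ u x → Dec (Neighbour u x)
      neighbour? u x = (x ∈? V′) ×-dec (¬? (u Fin.≟ x)) ×-dec (member (edge u x) es Boolₚ.≟ true)

      hit : V → V → ℕ
      hit u x = indicator (neighbour? u x)

      adj⇒neighbour : ∀ {u x} → x Subset.∈ V′ → Adj G u x → Neighbour u x
      adj⇒neighbour x∈ (u≢x , inj₁ ux∈) = x∈ , u≢x , trans (cong (λ e → member e es) (edge-< (All.lookup sorted ux∈))) (member-∈ ux∈)
      adj⇒neighbour x∈ (u≢x , inj₂ xu∈) = x∈ , u≢x , trans (cong (λ e → member e es) (edge-> (All.lookup sorted xu∈))) (member-∈ xu∈)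

      neighbour-sym : ∀ {u x} → u Subset.∈ V′ → Neighbour u x → Neighbour x u
      neighbour-sym {u} {x} u∈ (_ , u≢x , m) = u∈ , (λ e → u≢x (sym e)) , trans (cong (λ e → member e es) (edge-comm x u)) m

      neighbours : V → List V
      neighbours u = filter (neighbour? u) (allFin n)

      neighbours⁺ : ∀ {u x} → Neighbour u x → x ∈ neighbours u
      neighbours⁺ {u} {x} nb = ∈-filter⁺ (neighbour? u) (∈-allFin x) nb

      neighbours⁻ : ∀ {u x} → x ∈ neighbours u → Neighbour u x
      neighbours⁻ {u} x∈ = proj₂ (∈-filter⁻ (neighbour? u) {xs = allFin n} x∈)

      neighbours-unique : ∀ u → Unique (neighbours u)
      neighbours-unique u = Uniqueₚ.filter⁺ (neighbour? u) (Uniqueₚ.allFin⁺ n)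

      directHits : V → List Link → ℕ
      directHits u []             = 0
      directHits u ((i , j) ∷ ls) = (if member (edge i j) es then occurs u i ℕ.+ occurs u j else 0) ℕ.+ directHits u ls

      directHits-++ : ∀ u ls ms → directHits u (ls ++ ms) ≡ directHits u ls ℕ.+ directHits u ms
      directHits-++ u []             ms = refl
      directHits-++ u ((i , j) ∷ ls) ms = trans (cong (d ℕ.+_) (directHits-++ u ls ms))
        (sym (ℕₚ.+-assoc d (directHits u ls) (directHits u ms)))
        where
        d : ℕ
        d = if member (edge i j) es then occurs u i ℕ.+ occurs u j else 0

      hit-self : ∀ u → hit u u ≡ 0
      hit-self u with neighbour? u u
      ... | yes (_ , u≢u , _) = contradiction refl u≢u
      ... | no  _             = refl

      hit≤ : ∀ u x k → (Neighbour u x → 1 ℕ.≤ k) → hit u x ℕ.≤ k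
      hit≤ u x k f with neighbour? u x
      ... | yes nb = f nb
      ... | no  _  = ℕ.z≤n

      -- Every neighbour x of u within the list forms a pair with u in `pairsOf`, in one order or
      -- the other, and this pair contributes an occurrence of u.
      hits≤directHits : ∀ {u xs} → u ∈ xs → total xs (hit u) ℕ.≤ directHits u (pairsOf xs)
      hits≤directHits {u} {.u ∷ xs} (here refl) = begin
        hit u u ℕ.+ total xs (hit u)          ≡⟨ cong (ℕ._+ total xs (hit u)) (hit-self u) ⟩
        total xs (hit u)                      ≤⟨ row xs ⟩
        directHits u (map (u ,_) xs)          ≤⟨ ℕₚ.m≤m+n _ (directHits u (pairsOf xs)) ⟩
        directHits u (map (u ,_) xs) ℕ.+ directHits u (pairsOf xs) ≡⟨ sym (directHits-++ u (map (u ,_) xs) (pairsOf xs)) ⟩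
        directHits u (pairsOf (u ∷ xs))       ∎
        where
        open ℕₚ.≤-Reasoning
        row : ∀ ys → total ys (hit u) ℕ.≤ directHits u (map (u ,_) ys)
        row []       = ℕ.z≤n
        row (y ∷ ys) = ℕₚ.+-mono-≤ (hit≤ u y _ λ (_ , _ , m) → subst
          (λ b → 1 ℕ.≤ (if b then occurs u u ℕ.+ occurs u y else 0)) (sym m)
          (ℕₚ.≤-trans (ℕₚ.≤-reflexive (sym (occurs-refl u))) (ℕₚ.m≤m+n (occurs u u) (occurs u y)))) (row ys)
      hits≤directHits {u} {x ∷ xs} (there u∈) = begin
        hit u x ℕ.+ total xs (hit u)          ≤⟨ ℕₚ.+-mono-≤ (hit≤ u x _ (row u∈)) (hits≤directHits u∈) ⟩
        directHits u (map (x ,_) xs) ℕ.+ directHits u (pairsOf xs) ≡⟨ sym (directHits-++ u (map (x ,_) xs) (pairsOf xs)) ⟩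
        directHits u (pairsOf (x ∷ xs))       ∎
        where
        open ℕₚ.≤-Reasoning
        row : ∀ {ys} → u ∈ ys → Neighbour u x → 1 ℕ.≤ directHits u (map (x ,_) ys)
        row {y ∷ ys} (here refl) (_ , _ , m) = ℕₚ.≤-trans (subst
          (λ b → 1 ℕ.≤ (if b then occurs u x ℕ.+ occurs u u else 0))
          (sym (trans (cong (λ e → member e es) (edge-comm x u)) m))
          (ℕₚ.≤-trans (ℕₚ.≤-reflexive (sym (occurs-refl u))) (ℕₚ.m≤n+m (occurs u u) (occurs u x))))
          (ℕₚ.m≤m+n _ (directHits u (map (x ,_) ys)))
        row {y ∷ ys} (there u∈) nb = ℕₚ.≤-trans (row u∈ nb) (ℕₚ.m≤n+m _ (if member (edge x y) es then occurs u x ℕ.+ occurs u y else 0))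

      one≤saturated : ∀ {us w} → All (λ u → 3 ℕ.≤ count u w) us → 1ℚ ℚ.≤ saturated us w
      one≤saturated []                    = ℚₚ.≤-refl
      one≤saturated {u ∷ us} {w} (3≤ ∷ 3≤s) = ℚₚ.≤-trans (one≤saturated 3≤s)
        (ℚₚ.≤-trans (ℚₚ.≤-reflexive (sym (ℚₚ.*-identityˡ (saturated us w)))) (*-monoʳ (0≤saturated us w) (atLeast₃-mono 3≤)))

      module _ {us : List V} where

        one≤direct : ∀ ls w → All (λ u → 3 ℕ.≤ directHits u ls ℕ.+ count u w) us → 1ℚ ℚ.≤ direct (saturated us) ls w es
        one≤direct []             w 3≤ = one≤saturated 3≤
        one≤direct ((i , j) ∷ ls) w 3≤ with member (edge i j) es
        ... | true  = one≤direct ls (i ∷ j ∷ w) (All.map (λ {u} 3≤u → ℕₚ.≤-trans 3≤u (ℕₚ.≤-reflexive (regroup u))) 3≤)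
          where
          regroup : ∀ u → occurs u i ℕ.+ occurs u j ℕ.+ directHits u ls ℕ.+ count u w ≡ directHits u ls ℕ.+ count u (i ∷ j ∷ w)
          regroup u = trans (cong (ℕ._+ count u w) (ℕₚ.+-comm (occurs u i ℕ.+ occurs u j) (directHits u ls)))
            (trans (ℕₚ.+-assoc (directHits u ls) (occurs u i ℕ.+ occurs u j) (count u w))
              (cong (directHits u ls ℕ.+_) (ℕₚ.+-assoc (occurs u i) (occurs u j) (count u w))))
        ... | false = one≤direct ls w 3≤

        -- A vertex outside the core either sees no vertex at all or is the middle of a link that
        -- accounts for all its adjacencies to the core.
        Middle : List Link → V → Set
        Middle ls v = (∀ u → hit u v ≡ 0) ⊎ ∃[ i ] ∃[ j ] ((i , j) ∈ ls × member (edge v i) es ≡ true × member (edge v j) es ≡ true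
          × All (λ u → hit u v ℕ.≤ occurs u i ℕ.+ occurs u j) us)

        -- From the overcounting sum the one term is taken in which each outer vertex serves its own
        -- link; the others are nonnegative. The hits of `v` then move from the total into the word,
        -- so the bound 3 persists.
        one≤through : ∀ ls vs w → All (Middle ls) vs →
          All (λ u → 3 ℕ.≤ total vs (hit u) ℕ.+ (directHits u ls ℕ.+ count u w)) us → 1ℚ ℚ.≤ through (saturated us) ls vs w es
        one≤through ls []       w []             3≤ = one≤direct ls w 3≤
        one≤through ls (v ∷ vs) w (inj₁ none ∷ ms) 3≤ = ℚₚ.≤-trans
          (one≤through ls vs w ms (All.map (λ {u} → subst (λ k → 3 ℕ.≤ k ℕ.+ total vs (hit u) ℕ.+ (directHits u ls ℕ.+ count u w)) (none u)) 3≤))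
          (≤-by refl (0≤∑ ls (0≤through-term (saturated us) ls vs (0≤through (saturated us) (0≤saturated us) ls vs) v w es)))
        one≤through ls (v ∷ vs) w (inj₂ (i , j , ij∈ , mi , mj , hit≤ij) ∷ ms) 3≤ = begin
          1ℚ
            ≤⟨ one≤through ls vs (i ∷ j ∷ w) ms (All.zipWith (λ {u} (h , 3≤u) → ℕₚ.≤-trans 3≤u (regroup u h)) (hit≤ij , 3≤)) ⟩
          through (saturated us) ls vs (i ∷ j ∷ w) es
            ≡⟨ sym (cong₂ (λ b c → if b then (if c then through (saturated us) ls vs (i ∷ j ∷ w) es else 0ℚ) else 0ℚ) mi mj) ⟩
          term (i , j)
            ≤⟨ ∑-∈ term (0≤through-term (saturated us) ls vs (0≤through (saturated us) (0≤saturated us) ls vs) v w es) ij∈ ⟩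
          ∑ ls term
            ≤⟨ ≤-by (ℚₚ.+-comm (through (saturated us) ls vs w es) (∑ ls term)) (0≤through (saturated us) (0≤saturated us) ls vs w es) ⟩
          through (saturated us) ls (v ∷ vs) w es
            ∎
          where
          open ℚₚ.≤-Reasoning
          term : Link → ℚ
          term (i , j) = if member (edge v i) es then (if member (edge v j) es then through (saturated us) ls vs (i ∷ j ∷ w) es else 0ℚ) else 0ℚ
          regroup : ∀ u → hit u v ℕ.≤ occurs u i ℕ.+ occurs u j →
            hit u v ℕ.+ total vs (hit u) ℕ.+ (directHits u ls ℕ.+ count u w) ℕ.≤ total vs (hit u) ℕ.+ (directHits u ls ℕ.+ count u (i ∷ j ∷ w))
          regroup u h = ℕₚ.≤-trans (ℕₚ.+-monoˡ-≤ (directHits u ls ℕ.+ count u w) (ℕₚ.+-monoˡ-≤ (total vs (hit u)) h))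
            (ℕₚ.≤-reflexive (identity (occurs u i) (occurs u j) (total vs (hit u)) (directHits u ls) (count u w)))
            where
            open import Data.Nat.Solver using (module +-*-Solver)
            open +-*-Solver using (solve; _:+_; _:=_)
            identity : ∀ a b t d c → a ℕ.+ b ℕ.+ t ℕ.+ (d ℕ.+ c) ≡ t ℕ.+ (d ℕ.+ (a ℕ.+ (b ℕ.+ c)))
            identity = solve 5 (λ a b t d c → a :+ b :+ t :+ (d :+ c) := t :+ (d :+ (a :+ (b :+ c)))) refl

      Rich : V → Set
      Rich v = v Subset.∈ V′ × 3 ℕ.≤ length (neighbours v)

      rich? : Decidable Rich
      rich? v = (v ∈? V′) ×-dec (3 ℕ.≤? length (neighbours v))

      module _ (4≤∣V′∣ : 4 ℕ.≤ ∣ V′ ∣) (rigid : GloballyRigid (G [ V′ ])) where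

        no-leaf : ∀ {v a} → v Subset.∈ V′ → a ≢ v → (∀ {x} → x ∈ neighbours v → x ≡ a) → ⊥
        no-leaf {v} {a} v∈ a≢v only =
          let (b , b∈ , b≢v , b≢a , _) = ∈-pick₄ V′ 4≤∣V′∣ v a a
          in leaf-flexible G V′ v∈ b∈ b≢v b≢a a≢v (λ x∈ vx → only (neighbours⁺ (adj⇒neighbour x∈ vx))) rigid

        no-pair : ∀ {u v a c} → u Subset.∈ V′ → v Subset.∈ V′ → u ≢ v → a ≢ u → a ≢ v → c ≢ u → c ≢ v →
          (∀ {x} → x ∈ neighbours u → x ≡ v ⊎ x ≡ a) → (∀ {x} → x ∈ neighbours v → x ≡ u ⊎ x ≡ c) → ⊥
        no-pair {u} {v} {a} {c} u∈ v∈ u≢v a≢u a≢v c≢u c≢v nbrs-u nbrs-v =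
          let (b , b∈ , b≢u , b≢v , b≢a) = ∈-pick₄ V′ 4≤∣V′∣ u v a
          in pair-flexible G V′ u∈ v∈ b∈ u≢v a≢u a≢v c≢u c≢v b≢u b≢v b≢a
               (λ x∈ ux → nbrs-u (neighbours⁺ (adj⇒neighbour x∈ ux))) (λ x∈ vx → nbrs-v (neighbours⁺ (adj⇒neighbour x∈ vx))) rigid

        two : ∀ {A : Set} {x y z : A} → x ∈ y ∷ z ∷ [] → x ≡ y ⊎ x ≡ z
        two (here e)         = inj₁ e
        two (there (here e)) = inj₂ e

        swap-two : ∀ {A : Set} {x y z : A} → x ∈ y ∷ z ∷ [] → x ≡ z ⊎ x ≡ y
        swap-two (here e)         = inj₂ e
        swap-two (there (here e)) = inj₁ e

        -- The vertex a has v as a neighbour. With no other neighbour it would be a leaf, and with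
        -- exactly one other the adjacent vertices v and a would both have degree 2; both are
        -- flexible.
        rich-neighbour : ∀ {v a c} → v Subset.∈ V′ → Neighbour v a → c ≢ v → c ≢ a →
          (∀ {x} → x ∈ neighbours v → x ≡ a ⊎ x ≡ c) → Rich a
        rich-neighbour {v} {a} {c} v∈ va@(a∈ , v≢a , _) c≢v c≢a only = a∈ , by-neighbours (neighbours a) refl
          where
          v∈N : v ∈ neighbours a
          v∈N = neighbours⁺ (neighbour-sym v∈ va)
          by-neighbours : ∀ xs → neighbours a ≡ xs → 3 ℕ.≤ length (neighbours a)
          by-neighbours []              e with () ← subst (v ∈_) e v∈N
          by-neighbours (x ∷ [])        e = ⊥-elim (no-leaf a∈ (λ x≡a → proj₁ (proj₂ (neighbours⁻ (subst (x ∈_) (sym e) (here refl)))) (sym x≡a))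
            (λ y∈ → one (subst (_ ∈_) e y∈)))
            where
            one : ∀ {A : Set} {x y : A} → x ∈ y ∷ [] → x ≡ y
            one (here e) = e
          by-neighbours (x ∷ y ∷ [])    e = ⊥-elim (case-two (two (subst (v ∈_) e v∈N)))
            where
            x≢a : x ≢ a
            x≢a x≡a = proj₁ (proj₂ (neighbours⁻ (subst (x ∈_) (sym e) (here refl)))) (sym x≡a)
            y≢a : y ≢ a
            y≢a y≡a = proj₁ (proj₂ (neighbours⁻ (subst (y ∈_) (sym e) (there (here refl))))) (sym y≡a)
            x≢y : x ≢ y
            x≢y with (x≢ ∷ _) ∷ _ ← subst Unique e (neighbours-unique a) = x≢
            case-two : v ≡ x ⊎ v ≡ y → ⊥
            case-two (inj₁ v≡x) = no-pair v∈ a∈ v≢a c≢v c≢a (λ y≡v → x≢y (sym (trans y≡v v≡x))) y≢a only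
              (λ z∈ → subst (λ w → _ ≡ w ⊎ _ ≡ y) (sym v≡x) (two (subst (_ ∈_) e z∈)))
            case-two (inj₂ v≡y) = no-pair v∈ a∈ v≢a c≢v c≢a (λ x≡v → x≢y (trans x≡v v≡y)) x≢a only
              (λ z∈ → subst (λ w → _ ≡ w ⊎ _ ≡ x) (sym v≡y) (swap-two (subst (_ ∈_) e z∈)))
          by-neighbours (x ∷ y ∷ z ∷ _) e = subst (λ xs → 3 ℕ.≤ length xs) (sym e) (ℕ.s≤s (ℕ.s≤s (ℕ.s≤s ℕ.z≤n)))

        TwoRich : V → Set
        TwoRich v = ∃[ a ] ∃[ c ] (a ≢ c × Rich a × Rich c × Neighbour v a × Neighbour v c × (∀ {x} → x ∈ neighbours v → x ≡ a ⊎ x ≡ c))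

        classify : ∀ {v} → v Subset.∈ V′ → Rich v ⊎ TwoRich v
        classify {v} v∈ = by-neighbours (neighbours v) refl
          where
          by-neighbours : ∀ xs → neighbours v ≡ xs → Rich v ⊎ TwoRich v
          -- An isolated vertex is treated as a leaf attached to an arbitrary other vertex.
          by-neighbours [] e = ⊥-elim (let (a , _ , a≢v , _) = ∈-pick₄ V′ 4≤∣V′∣ v v v in no-leaf v∈ a≢v (λ x∈ → absurd (subst (_ ∈_) e x∈)))
            where
            absurd : ∀ {A B : Set} {x : A} → x ∈ [] → B
            absurd ()
          by-neighbours (x ∷ []) e = ⊥-elim (no-leaf v∈ (λ x≡v → proj₁ (proj₂ (neighbours⁻ (subst (x ∈_) (sym e) (here refl)))) (sym x≡v))
            (λ y∈ → one (subst (_ ∈_) e y∈)))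
            where
            one : ∀ {A : Set} {x y : A} → x ∈ y ∷ [] → x ≡ y
            one (here e) = e
          by-neighbours (a ∷ c ∷ []) e = inj₂ (a , c , a≢c
            , rich-neighbour v∈ va (λ c≡v → proj₁ (proj₂ vc) (sym c≡v)) (λ c≡a → a≢c (sym c≡a)) only
            , rich-neighbour v∈ vc (λ a≡v → proj₁ (proj₂ va) (sym a≡v)) a≢c (λ x∈ → swap-two (subst (_ ∈_) e x∈))
            , va , vc , only)
            where
            va : Neighbour v a
            va = neighbours⁻ (subst (a ∈_) (sym e) (here refl))
            vc : Neighbour v c
            vc = neighbours⁻ (subst (c ∈_) (sym e) (there (here refl)))
            only : ∀ {x} → x ∈ neighbours v → x ≡ a ⊎ x ≡ c
            only x∈ = two (subst (_ ∈_) e x∈)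
            a≢c : a ≢ c
            a≢c with (a≢ ∷ _) ∷ _ ← subst Unique e (neighbours-unique v) = a≢
          by-neighbours (x ∷ y ∷ z ∷ xs) e = inj₁ (v∈ , subst (λ xs → 3 ℕ.≤ length xs) (sym e) (ℕ.s≤s (ℕ.s≤s (ℕ.s≤s ℕ.z≤n))))

        us vs : List V
        us = filter rich? (allFin n)
        vs = filter (¬? ∘ rich?) (allFin n)

        rich∈us : ∀ {v} → Rich v → v ∈ us
        rich∈us {v} = ∈-filter⁺ rich? (∈-allFin v)

        us-nonempty : ∃[ u ] u ∈ us
        us-nonempty with ∈-pick V′ (ℕₚ.≤-trans (ℕ.s≤s ℕ.z≤n) 4≤∣V′∣)
        ... | v , v∈ with classify v∈
        ...   | inj₁ rich                     = v , rich∈us rich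
        ...   | inj₂ (a , _ , _ , rich-a , _) = a , rich∈us rich-a

        middle : ∀ {v} → ¬ Rich v → Middle {us} (pairsOf us) v
        middle {v} ¬rich = by-membership (v ∈? V′)
          where
          occurrence : ∀ {a c x} → (∀ {x} → x ∈ neighbours v → x ≡ a ⊎ x ≡ c) → x ∈ us → Neighbour x v → x ≡ a ⊎ x ≡ c
          occurrence only x∈us xv = only (neighbours⁺ (neighbour-sym (proj₁ (proj₂ (∈-filter⁻ rich? {xs = allFin n} x∈us))) xv))
          count-it : ∀ {a c u} → u ≡ a ⊎ u ≡ c → 1 ℕ.≤ occurs u a ℕ.+ occurs u c
          count-it {a} {c} (inj₁ refl) = ℕₚ.≤-trans (ℕₚ.≤-reflexive (sym (occurs-refl a))) (ℕₚ.m≤m+n (occurs a a) (occurs a c))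
          count-it {a} {c} (inj₂ refl) = ℕₚ.≤-trans (ℕₚ.≤-reflexive (sym (occurs-refl c))) (ℕₚ.m≤n+m (occurs c c) (occurs c a))
          by-class : Rich v ⊎ TwoRich v → Middle {us} (pairsOf us) v
          by-class (inj₁ rich) = contradiction rich ¬rich
          by-class (inj₂ (a , c , a≢c , rich-a , rich-c , (_ , _ , ma) , (_ , _ , mc) , only)) =
            inj₂ (by-order (pairsOf-∈ (rich∈us rich-a) (rich∈us rich-c) a≢c))
            where
            hits : All (λ u → hit u v ℕ.≤ occurs u a ℕ.+ occurs u c) us
            hits = All.tabulate λ {u} u∈us → hit≤ u v _ λ uv → count-it (occurrence only u∈us uv)
            by-order : (a , c) ∈ pairsOf us ⊎ (c , a) ∈ pairsOf us → ∃[ i ] ∃[ j ] ((i , j) ∈ pairsOf us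
              × member (edge v i) es ≡ true × member (edge v j) es ≡ true × All (λ u → hit u v ℕ.≤ occurs u i ℕ.+ occurs u j) us)
            by-order (inj₁ ac∈) = a , c , ac∈ , ma , mc , hits
            by-order (inj₂ ca∈) = c , a , ca∈ , mc , ma
              , All.map (λ {u} h → subst (hit u v ℕ.≤_) (ℕₚ.+-comm (occurs u a) (occurs u c)) h) hits
          by-membership : Dec (v Subset.∈ V′) → Middle {us} (pairsOf us) v
          by-membership (no v∉)  = inj₁ λ u → ℕₚ.n≤0⇒n≡0 (hit≤ u v 0 λ (v∈ , _) → contradiction v∈ v∉)
          by-membership (yes v∈) = by-class (classify v∈)

        one≤cores : 1ℚ ℚ.≤ cores (allFin n) es
        one≤cores = ℚₚ.≤-trans (one≤core us refl us-nonempty)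
          (∑-∈ (λ s → core s es) (λ s → 0≤core s es) (filter-∈-splits rich? (allFin n)))
          where
          -- Neighbours of u outside the core are covered by links through them, those inside by
          -- direct links.
          enough : All (λ u → 3 ℕ.≤ total vs (hit u) ℕ.+ (directHits u (pairsOf us) ℕ.+ count u [])) us
          enough = All.tabulate λ {u} u∈us → begin
            3                                                         ≤⟨ proj₂ (proj₂ (∈-filter⁻ rich? {xs = allFin n} u∈us)) ⟩
            length (neighbours u)                                     ≡⟨ length-filter (neighbour? u) (allFin n) ⟩
            total (allFin n) (hit u)                                  ≡⟨ total-filter rich? (allFin n) (hit u) ⟩
            total us (hit u) ℕ.+ total vs (hit u)                     ≡⟨ ℕₚ.+-comm (total us (hit u)) (total vs (hit u)) ⟩
            total vs (hit u) ℕ.+ total us (hit u)                     ≤⟨ ℕₚ.+-monoʳ-≤ (total vs (hit u)) (hits≤directHits u∈us) ⟩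
            total vs (hit u) ℕ.+ directHits u (pairsOf us)            ≡⟨ cong (total vs (hit u) ℕ.+_) (sym (ℕₚ.+-identityʳ _)) ⟩
            total vs (hit u) ℕ.+ (directHits u (pairsOf us) ℕ.+ 0)    ∎
            where open ℕₚ.≤-Reasoning
          one≤core : ∀ xs → us ≡ xs → (∃[ u ] u ∈ us) → 1ℚ ℚ.≤ core (us , vs) es
          one≤core []       e (u , u∈) with () ← subst (u ∈_) e u∈
          one≤core (x ∷ xs) e _ = subst (λ zs → 1ℚ ℚ.≤ core (zs , vs) es) (sym e)
            (subst (λ zs → 1ℚ ℚ.≤ through (saturated zs) (pairsOf zs) vs [] es) e
              (one≤through (pairsOf us) vs [] (All.tabulate λ v∈ → middle (proj₂ (∈-filter⁻ (¬? ∘ rich?) {xs = allFin n} v∈))) enough))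

-- Real probabilities, limits and the conclusion

module RandomGraph where

  open Rationals
  open FactorialSeries
  open MomentFunctional
  open WordCounting
  open Expectation
  open CoreMeans
  open Inequalities
  open CoreSeries
  open CoreEstimate
  open Flexibility
  open RigidCores
  open import Defs using (ℝ; seq; fromℚ; fromℕ; 0ℝ; 1ℝ; log; mercator; Dist; ℙ; randomSublist; 𝔾; pairs; graph; EdgeList; GloballyRigid; _⟶_; _[_])
  open import Data.Fin.Subset as Subset using (Subset) renaming (∣_∣ to ∣_∣ₛ)
  open import Data.Rational hiding (truncate)
  open import Data.Rational.Properties hiding (_≟_)
  open import Data.Rational.Solver using (module +-*-Solver)
  open +-*-Solver using (solve; con; _:+_; _:*_; _:-_; :-_; _:=_)

  weight : Bool → ℚ
  weight b = if b then 1ℚ else 0ℚ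

  0≤weight : ∀ b → 0ℚ ≤ weight b
  0≤weight true  = 0≤1
  0≤weight false = 0≤0

  weight≤1 : ∀ b → weight b ≤ 1ℚ
  weight≤1 true  = ≤-refl
  weight≤1 false = 0≤1

  ℙ-seq : ∀ {A : Set} (μ : Dist A) E i → seq (ℙ μ E) i ≡ ∑ μ (λ (a , w) → seq w i * weight (E a))
  ℙ-seq []            E i = refl
  ℙ-seq ((a , w) ∷ μ) E i = cong₂ _+_ (if-weight (E a)) (ℙ-seq μ E i)
    where
    if-weight : ∀ b → seq (if b then w else 0ℝ) i ≡ seq w i * weight b
    if-weight true  = sym (*-identityʳ (seq w i))
    if-weight false = sym (*-zeroʳ (seq w i))

  -- Real arithmetic acts termwise on sequences. Hence the i-th approximation of a probability is
  -- exactly the rational expectation at the i-th approximation of p, even where that lies outside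
  -- [0, 1].
  randomSublist-𝔼 : ∀ {A : Set} p (xs : List A) f i →
    ∑ (randomSublist p xs) (λ (s , w) → seq w i * f s) ≡ 𝔼 (seq p i) xs f
  randomSublist-𝔼 p []       f i = trans (+-identityʳ _) (*-identityˡ (f []))
  randomSublist-𝔼 p (x ∷ xs) f i = begin
    ∑ (map (λ (s , w) → x ∷ s , p Defs.* w) μ ++ map (λ (s , w) → s , (1ℝ Defs.- p) Defs.* w) μ) g
      ≡⟨ ∑-++ (map (λ (s , w) → x ∷ s , p Defs.* w) μ) (map (λ (s , w) → s , (1ℝ Defs.- p) Defs.* w) μ) g ⟩
    ∑ (map (λ (s , w) → x ∷ s , p Defs.* w) μ) g + ∑ (map (λ (s , w) → s , (1ℝ Defs.- p) Defs.* w) μ) g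
      ≡⟨ cong₂ _+_
           (trans (∑-map (λ (s , w) → x ∷ s , p Defs.* w) μ g) (scale (seq p i) (λ s → f (x ∷ s))))
           (trans (∑-map (λ (s , w) → s , (1ℝ Defs.- p) Defs.* w) μ g) (scale (1ℚ - seq p i) f)) ⟩
    𝔼 (seq p i) (x ∷ xs) f
      ∎
    where
    open ≡-Reasoning
    μ = randomSublist p xs
    g : List _ × ℝ → ℚ
    g (s , w) = seq w i * f s
    scale : ∀ c h → ∑ μ (λ (s , w) → c * seq w i * h s) ≡ c * 𝔼 (seq p i) xs h
    scale c h = trans (∑-cong μ λ (s , w) → *-assoc c (seq w i) (h s))
      (trans (∑-*ˡ μ c (λ (s , w) → seq w i * h s)) (cong (c *_) (randomSublist-𝔼 p xs h i)))

  -- One more element costs |p| + |1 - p| ≤ 3 times the previous constant, plus 1 for the changed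
  -- weights. The growth in the length is harmless: n is fixed while the approximations of p
  -- improve.
  lipschitz : ∀ {A : Set} → List A → ℚ
  lipschitz []       = 1ℚ
  lipschitz (x ∷ xs) = ι 3 * lipschitz xs + 1ℚ

  1≤lipschitz : ∀ {A : Set} (xs : List A) → 1ℚ ≤ lipschitz xs
  1≤lipschitz []       = ≤-refl
  1≤lipschitz (x ∷ xs) = ≤-by (+-comm (ι 3 * lipschitz xs) 1ℚ) (0≤ι 3 *⁰ ≤-trans 0≤1 (1≤lipschitz xs))

  𝔼-lipschitz : ∀ {A : Set} (xs : List A) {f : List A → ℚ} → (∀ es → 0ℚ ≤ f es) → (∀ es → f es ≤ 1ℚ) →
    ∀ {p q} → 0ℚ ≤ q → q ≤ 1ℚ → ∣ p ∣ ≤ 1ℚ → ∣ 𝔼 p xs f - 𝔼 q xs f ∣ ≤ lipschitz xs * ∣ p - q ∣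
  𝔼-lipschitz []       {f} 0≤f f≤1 {p} {q} 0≤q q≤1 ∣p∣≤1 = ≤-trans
    (≤-reflexive (cong ∣_∣ (+-inverseʳ (f [])))) (0≤1 *⁰ 0≤∣p∣ (p - q))
  𝔼-lipschitz (x ∷ xs) {f} 0≤f f≤1 {p} {q} 0≤q q≤1 ∣p∣≤1 = begin
    ∣ (p * A + (1ℚ - p) * B) - (q * A′ + (1ℚ - q) * B′) ∣
      ≡⟨ cong ∣_∣ (solve 6 (λ p q A B A′ B′ →
           (p :* A :+ (con 1ℚ :- p) :* B) :- (q :* A′ :+ (con 1ℚ :- q) :* B′)
           := (p :* (A :- A′) :+ (con 1ℚ :- p) :* (B :- B′)) :+ (p :- q) :* (A′ :- B′)) refl p q A B A′ B′) ⟩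
    ∣ (p * (A - A′) + (1ℚ - p) * (B - B′)) + (p - q) * (A′ - B′) ∣
      ≤⟨ ≤-trans (∣p+q∣≤∣p∣+∣q∣ (p * (A - A′) + (1ℚ - p) * (B - B′)) ((p - q) * (A′ - B′)))
           (+-monoˡ-≤ ∣ (p - q) * (A′ - B′) ∣ (∣p+q∣≤∣p∣+∣q∣ (p * (A - A′)) ((1ℚ - p) * (B - B′)))) ⟩
    (∣ p * (A - A′) ∣ + ∣ (1ℚ - p) * (B - B′) ∣) + ∣ (p - q) * (A′ - B′) ∣
      ≡⟨ cong₂ _+_ (cong₂ _+_ (∣p*q∣≡∣p∣*∣q∣ p (A - A′)) (∣p*q∣≡∣p∣*∣q∣ (1ℚ - p) (B - B′))) (∣p*q∣≡∣p∣*∣q∣ (p - q) (A′ - B′)) ⟩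
    (∣ p ∣ * ∣ A - A′ ∣ + ∣ 1ℚ - p ∣ * ∣ B - B′ ∣) + d * ∣ A′ - B′ ∣
      ≤⟨ +-mono-≤ (+-mono-≤
           (*-mono (0≤∣p∣ p) 0≤Kd ∣p∣≤1 (𝔼-lipschitz xs (0≤f ∘ (x ∷_)) (f≤1 ∘ (x ∷_)) 0≤q q≤1 ∣p∣≤1))
           (*-mono (0≤∣p∣ (1ℚ - p)) 0≤Kd (≤-trans (∣p-q∣≤∣p∣+∣q∣ 1ℚ p) (+-monoʳ-≤ 1ℚ ∣p∣≤1)) (𝔼-lipschitz xs 0≤f f≤1 0≤q q≤1 ∣p∣≤1)))
           (*-monoˡ (0≤∣p∣ (p - q)) ∣A′-B′∣≤1) ⟩
    (1ℚ * (lipschitz xs * d) + (1ℚ + 1ℚ) * (lipschitz xs * d)) + d * 1ℚ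
      ≡⟨ solve 2 (λ K d → con 1ℚ :* (K :* d) :+ (con 1ℚ :+ con 1ℚ) :* (K :* d) :+ d :* con 1ℚ := (con (ι 3) :* K :+ con 1ℚ) :* d) refl (lipschitz xs) d ⟩
    lipschitz (x ∷ xs) * d
      ∎
    where
    open ≤-Reasoning
    A B A′ B′ d : ℚ
    A  = 𝔼 p xs (f ∘ (x ∷_))
    B  = 𝔼 p xs f
    A′ = 𝔼 q xs (f ∘ (x ∷_))
    B′ = 𝔼 q xs f
    d  = ∣ p - q ∣
    0≤Kd : 0ℚ ≤ lipschitz xs * d
    0≤Kd = ≤-trans 0≤1 (1≤lipschitz xs) *⁰ 0≤∣p∣ (p - q)
    0≤𝔼 : ∀ {g} → (∀ es → 0ℚ ≤ g es) → 0ℚ ≤ 𝔼 q xs g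
    -- A vacuous predicate turns the restricted monotonicity into the plain one.
    0≤𝔼 {g} 0≤g = subst (_≤ 𝔼 q xs g) (𝔼-const q xs 0ℚ) (𝔼-mono-All 0≤q q≤1 (All.universal {P = λ _ → ℕ} (λ _ → 0) xs) (λ {es} _ → 0≤g es))
    𝔼≤1 : ∀ {g} → (∀ es → g es ≤ 1ℚ) → 𝔼 q xs g ≤ 1ℚ
    𝔼≤1 {g} g≤1 = subst (𝔼 q xs g ≤_) (𝔼-const q xs 1ℚ) (𝔼-mono-All 0≤q q≤1 (All.universal {P = λ _ → ℕ} (λ _ → 0) xs) (λ {es} _ → g≤1 es))
    difference : ∀ {a b} → 0ℚ ≤ b → a ≤ 1ℚ → a - b ≤ 1ℚ
    difference {a} {b} 0≤b a≤1 = ≤-by (solve 2 (λ a b → con 1ℚ := a :- b :+ (b :+ (con 1ℚ :- a))) refl a b) (0≤b +⁰ 0≤- a≤1)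
    ∣A′-B′∣≤1 : ∣ A′ - B′ ∣ ≤ 1ℚ
    ∣A′-B′∣≤1 with ∣p∣≡p∨∣p∣≡-p (A′ - B′)
    ... | inj₁ e = ≤-trans (≤-reflexive e) (difference (0≤𝔼 0≤f) (𝔼≤1 (f≤1 ∘ (x ∷_))))
    ... | inj₂ e = ≤-trans (≤-reflexive (trans e (solve 2 (λ a b → :- (a :- b) := b :- a) refl A′ B′)))
      (difference (0≤𝔼 (0≤f ∘ (x ∷_))) (𝔼≤1 f≤1))

  ≤-ceiling : ∀ p → ∃[ N ] p ≤ ι N
  ≤-ceiling (mkℚ (ℤ.+ m) d c) = m , toℚᵘ-cancel-≤ (ℚᵘₚ.≤-respʳ-≃ (ℚᵘₚ.≃-sym (toℚᵘ-/ (ℤ.+ m) 0))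
    (ℚᵘ.*≤* (ℤₚ.*-monoˡ-≤-nonNeg (ℤ.+ m) (ℤ.+≤+ (ℕ.s≤s ℕ.z≤n)))))
  ≤-ceiling p@(mkℚ ℤ.-[1+ m ] d c) = 0 , <⇒≤ (negative⁻¹ p)

  recip-vanishes : ∀ {C e} → 0ℚ < e → ∃[ N ] (∀ n → N ℕ.≤ n → C * recip n ≤ e)
  recip-vanishes {C} {e} 0<e with inverse 0<e
  ... | d , 0≤d , de≡1 with ≤-ceiling (d * C)
  ...   | N , dC≤N = N , λ n N≤n → begin
    C * recip n
      ≤⟨ *-monoʳ (0≤recip n) (≤-divide (<⇒≤ 0<e) (trans (*-comm e d) de≡1) (≤-trans dC≤N (ι-mono (ℕₚ.m≤n⇒m≤1+n N≤n)))) ⟩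
    e * ι (suc n) * recip n
      ≡⟨ trans (*-assoc e (ι (suc n)) (recip n)) (trans (cong (e *_) (ι*recip n)) (*-identityʳ e)) ⟩
    e
      ∎
    where open ≤-Reasoning

  mercator-≥ : ∀ {r} → 0ℚ ≤ r → ∀ m → r ≤ mercator r (suc m)
  mercator-≥ {r} 0≤r zero    = ≤-reflexive (solve 1 (λ r → r := con 0ℚ :+ con (recip 0) :* (r :* con 1ℚ)) refl r)
  mercator-≥ {r} 0≤r (suc m) = ≤-trans (mercator-≥ 0≤r m) (≤-by refl (0≤recip (suc m) *⁰ 0≤^ (suc (suc m)) 0≤r))

  -- The partial sums of log n are at least their first term 1 - 1/n ≥ 1/2. At tolerance 1/2 the
  -- hypothesis therefore gives 4 ≤ s + 1/2, which fails for s ≤ 3.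
  4≤-size : ∀ k s → fromℕ 8 Defs.* log (2 ℕ.+ k) Defs.≤ fromℕ s → 4 ℕ.≤ s
  4≤-size k s le with 4 ℕ.≤? s
  ... | yes 4≤s = 4≤s
  ... | no  4≰s = contradiction (≤-trans 4≤ (+-monoˡ-≤ ½ (ι-mono (ℕₚ.≤-pred (ℕₚ.≰⇒> 4≰s))))) (toWitness {a? = ¬? (ι 4 ≤? ι 3 + ½)} _)
    where
    r : ℚ
    r = 1ℚ - recip (suc k)
    ½≤r : ½ ≤ r
    ½≤r = +-monoʳ-≤ 1ℚ (neg-antimono-≤ (recip-anti {1} {suc k} (ℕ.s≤s ℕ.z≤n)))
    N : ℕ
    N = proj₁ (le ½ (positive⁻¹ ½))
    4≤ : ι 4 ≤ ι s + ½
    4≤ = ≤-trans (*-monoˡ (0≤ι 8) (≤-trans ½≤r (mercator-≥ (≤-trans 0≤½ ½≤r) N)))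
      (proj₂ (le ½ (positive⁻¹ ½)) (suc N) (ℕₚ.n≤1+n N))

  module Typical (n : ℕ) where

    open Cores {Fin n} Fin._≟_ _≟ᴱ_ edge using (cores; core; 0≤core)

    -- The event must imply the claim for every list of this type, also for lists that never arise
    -- as outcomes, hence `Sorted`. As log 1 = 0 gives no lower bound on the size, n ≥ 2 is demanded
    -- as well.
    NoCores : EdgeList n → Set
    NoCores es = cores (allFin n) es < 1ℚ × Sorted es × 2 ℕ.≤ n

    noCores? : ∀ es → Dec (NoCores es)
    noCores? es = (cores (allFin n) es <? 1ℚ) ×-dec All.all? (λ (i , j) → i Fin.<? j) es ×-dec (2 ℕ.≤? n)

    typical : EdgeList n → Bool
    typical es = isYes (noCores? es)

    0≤cores : ∀ es → 0ℚ ≤ cores (allFin n) es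
    0≤cores es = 0≤∑ (splits (allFin n)) (λ s → 0≤core s es)

    pairs-sorted : Sorted (pairs n)
    pairs-sorted = Allₚ.all-filter (λ (i , j) → i Fin.<? j) (cartesianProduct (allFin n) (allFin n))

    -- The pointwise form of Markov's inequality: failure of the event forces the overcount to be at
    -- least 1.
    atypical≤cores : 2 ℕ.≤ n → ∀ {es} → Sorted es → 1ℚ - weight (typical es) ≤ cores (allFin n) es
    atypical≤cores 2≤n {es} sorted = by-cases (noCores? es)
      where
      by-cases : (d : Dec (NoCores es)) → 1ℚ - weight (isYes d) ≤ cores (allFin n) es
      by-cases (yes _) = 0≤cores es
      by-cases (no ¬c) = ≮⇒≥ λ few → ¬c (few , sorted , 2≤n)

  typical⇒¬rigid : ∀ n es → T (Typical.typical n es) →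
    (V′ : Subset n) → fromℕ 8 Defs.* log n Defs.≤ fromℕ ∣ V′ ∣ₛ → ¬ GloballyRigid (graph es [ V′ ])
  typical⇒¬rigid n es typical V′ large rigid = absurd n es V′ large rigid (toWitness {a? = Typical.noCores? n es} typical)
    where
    absurd : ∀ n es (V′ : Subset n) → fromℕ 8 Defs.* log n Defs.≤ fromℕ ∣ V′ ∣ₛ → GloballyRigid (graph es [ V′ ]) →
      ¬ Typical.NoCores n es
    absurd (suc (suc k)) es V′ large rigid (few , sorted , _) =
      <-irrefl refl (<-≤-trans few (one≤cores sorted V′ (4≤-size k ∣ V′ ∣ₛ large) rigid))
    absurd (suc zero) es V′ large rigid (_ , _ , ℕ.s≤s ())

  atypical-mean : ∀ n k {p} → 1000 ℕ.≤ suc n → 19 ℕ.≤ k → 0ℚ ≤ p → p ≤ 11 % 10 * recip n →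
    𝔼 p (pairs (suc n)) (λ es → 1ℚ - weight (Typical.typical (suc n) es))
      ≤ ι 40 * recip k + ι 2401000 * (ι (suc k) * ι (suc k) * (ι (suc k) * ι (suc k))) * recip n
  atypical-mean n k {p} 1000≤n 19≤k 0≤p p≤q = with-inverse (inverse {1ℚ - E.q} 0<1-q)
    where
    module E = Estimate n k 1000≤n 19≤k
    open Typical (suc n)
    open Cores {Fin (suc n)} Fin._≟_ _≟ᴱ_ edge using (cores; 𝔼-cores)
    0<1-q : 0ℚ < 1ℚ - E.q
    0<1-q = <-≤-trans (positive⁻¹ (9989 % 10000)) (+-monoʳ-≤ 1ℚ (neg-antimono-≤ E.q≤))
    with-inverse : ∃[ w ] (0ℚ ≤ w × w * (1ℚ - E.q) ≡ 1ℚ) →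
      𝔼 p (pairs (suc n)) (λ es → 1ℚ - weight (typical es)) ≤ ι 40 * recip k + E.C * recip n
    with-inverse (w , 0≤w , w[1-q]≡1) = begin
      𝔼 p (pairs (suc n)) (λ es → 1ℚ - weight (typical es))
        ≤⟨ 𝔼-mono-All 0≤p (≤-trans p≤q E.q≤1) pairs-sorted (atypical≤cores (ℕₚ.≤-trans (ℕ.s≤s (ℕ.s≤s ℕ.z≤n)) 1000≤n)) ⟩
      𝔼 p (pairs (suc n)) (cores (allFin (suc n)))
        ≤⟨ 𝔼-cores pairs-unique edge∈pairs edge-injective 0≤p p≤q E.q≤1 (E.0≤q *⁰ 0≤w) q≡ E.β E.0≤β
             (λ r m N r+m → E.cores-bound 0≤w w[1-q]≡1 {r} {m} r+m N) (Uniqueₚ.allFin⁺ (suc n)) (Listₚ.length-tabulate (λ i → i)) ⟩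
      ∑< (suc (suc n)) (λ r → falling (suc n) r * E.β r)
        ≤⟨ E.total-bound ⟩
      ι 40 * recip k + E.C * recip n
        ∎
      where
      open ≤-Reasoning
      q≡ : E.q ≡ (1ℚ - E.q) * (E.q * w)
      q≡ = sym (trans (solve 2 (λ q w → (con 1ℚ :- q) :* (q :* w) := q :* (w :* (con 1ℚ :- q))) refl E.q w)
        (trans (cong (E.q *_) w[1-q]≡1) (*-identityʳ E.q)))

  halves : ∀ e → ½ * e + ½ * e ≡ e
  halves = solve 1 (λ e → con ½ :* e :+ con ½ :* e := e) refl

  0<½* : ∀ {e} → 0ℚ < e → 0ℚ < ½ * e
  0<½* {e} 0<e = positive⁻¹ _ {{pos*pos⇒pos ½ e {{positive 0<e}}}}

  ∣∣≤ : ∀ {p q} → p ≤ q → - p ≤ q → ∣ p ∣ ≤ q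
  ∣∣≤ {p} {q} p≤q -p≤q with ∣p∣≡p∨∣p∣≡-p p
  ... | inj₁ e = subst (_≤ q) (sym e) p≤q
  ... | inj₂ e = subst (_≤ q) (sym e) -p≤q

  -- The rational approximations of a nonnegative real number may be slightly negative.
  clip : ∀ {p η q} → 0ℚ ≤ p + η → η ≤ 1ℚ → p ≤ q → 0ℚ ≤ q → q ≤ 1ℚ → 0ℚ ≤ η →
    ∃[ p⁺ ] (0ℚ ≤ p⁺ × p⁺ ≤ q × ∣ p - p⁺ ∣ ≤ η × ∣ p ∣ ≤ 1ℚ)
  clip {p} {η} {q} 0≤p+η η≤1 p≤q 0≤q q≤1 0≤η with ≤-total 0ℚ p
  ... | inj₁ 0≤p = p , 0≤p , p≤q , ≤-trans (≤-reflexive (cong ∣_∣ (+-inverseʳ p))) 0≤η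
    , ≤-trans (≤-reflexive (0≤p⇒∣p∣≡p 0≤p)) (≤-trans p≤q q≤1)
  ... | inj₂ p≤0 = 0ℚ , 0≤0 , 0≤q , subst (λ z → ∣ z ∣ ≤ η) (sym (+-identityʳ p)) ∣p∣≤η , ≤-trans ∣p∣≤η η≤1
    where
    ∣p∣≤η : ∣ p ∣ ≤ η
    ∣p∣≤η = ∣∣≤ (≤-trans p≤0 0≤η) (0≤-⇒≤ (subst (0ℚ ≤_) (solve 2 (λ p η → p :+ η := η :- (:- p)) refl p η) 0≤p+η))

  tolerance : ∀ {K e} → 1ℚ ≤ K → 0ℚ < e → ∃[ η ] (0ℚ < η × η ≤ 1ℚ × K * η ≤ e)
  tolerance {K} {e} 1≤K 0<e = η , 0<η , p⊓q≤q (e * 1/ K) 1ℚ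
    , ≤-trans (*-monoˡ (≤-trans 0≤1 1≤K) (p⊓q≤p (e * 1/ K) 1ℚ)) (≤-reflexive
        (trans (solve 3 (λ K e d → K :* (e :* d) := e :* (K :* d)) refl K e (1/ K)) (trans (cong (e *_) (*-inverseʳ K)) (*-identityʳ e))))
    where
    instance
      K⁺ : Positive K
      K⁺ = positive (<-≤-trans (positive⁻¹ 1ℚ) 1≤K)
      K≢0 : NonZero K
      K≢0 = pos⇒nonZero K
    η : ℚ
    η = (e * 1/ K) ⊓ 1ℚ
    0<η : 0ℚ < η
    0<η with ⊓-sel (e * 1/ K) 1ℚ
    ... | inj₁ eq = subst (0ℚ <_) (sym eq) (positive⁻¹ _ {{pos*pos⇒pos e {{positive 0<e}} (1/ K) {{1/pos⇒pos K}}}})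
    ... | inj₂ eq = subst (0ℚ <_) (sym eq) (positive⁻¹ 1ℚ)

  -- `e₀` is a margin by which ε is positive. Half of it is kept as the gap that the strict
  -- inequality demands; the other half is shared between the Lipschitz error and the mean, `e`
  -- each.
  module Concentration {A : Set} (L : List A) (E : List A → Bool)
    {p ε : ℝ} {q e₀ e : ℚ} (0≤p : 0ℝ Defs.≤ p) (p<q : p Defs.< fromℚ q) (0≤q : 0ℚ ≤ q) (q≤1 : q ≤ 1ℚ)
    (0<e₀ : 0ℚ < e₀) (N₁ : ℕ) (e₀≤ε : ∀ i → N₁ ℕ.≤ i → 0ℚ + e₀ ≤ seq ε i) (0<e : 0ℚ < e) (e+e : e + e ≡ ½ * e₀)
    (mean : ∀ {r} → 0ℚ ≤ r → r ≤ q → 𝔼 r L (λ es → 1ℚ - weight (E es)) ≤ e)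
    where

    η-exists : ∃[ η ] (0ℚ < η × η ≤ 1ℚ × lipschitz L * η ≤ e)
    η-exists = tolerance (1≤lipschitz L) 0<e
    η : ℚ
    η = proj₁ η-exists
    0<η : 0ℚ < η
    0<η = proj₁ (proj₂ η-exists)
    M₁ M₂ M : ℕ
    M₁ = proj₁ (0≤p η 0<η)
    M₂ = proj₁ (proj₂ (proj₂ p<q))
    M  = M₁ ℕ.⊔ M₂ ℕ.⊔ N₁
    f X : List A → ℚ
    f es = weight (E es)
    X es = 1ℚ - f es
    0≤f : ∀ es → 0ℚ ≤ f es
    0≤f es = 0≤weight (E es)
    f≤1 : ∀ es → f es ≤ 1ℚ
    f≤1 es = weight≤1 (E es)
    bound : ∀ i → M₁ ℕ.≤ i → M₂ ℕ.≤ i → N₁ ℕ.≤ i →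
      ∣ seq (ℙ (randomSublist p L) E) i - 1ℚ ∣ + ½ * e₀ ≤ seq ε i
    bound i M₁≤i M₂≤i N₁≤i = with-clip (clip
        (proj₂ (0≤p η 0<η) i M₁≤i) (proj₁ (proj₂ (proj₂ η-exists)))
        -- The strict inequality for p comes with a rational gap, so its late approximations are at
        -- most q outright and not merely up to an error.
        (≤-trans (≤-by refl (<⇒≤ (proj₁ (proj₂ p<q)))) (proj₂ (proj₂ (proj₂ p<q)) i M₂≤i)) 0≤q q≤1 (<⇒≤ 0<η))
      where
      open ≤-Reasoning
      pᵢ : ℚ
      pᵢ = seq p i
      with-clip : ∃[ p⁺ ] (0ℚ ≤ p⁺ × p⁺ ≤ q × ∣ pᵢ - p⁺ ∣ ≤ η × ∣ pᵢ ∣ ≤ 1ℚ) →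
        ∣ seq (ℙ (randomSublist p L) E) i - 1ℚ ∣ + ½ * e₀ ≤ seq ε i
      with-clip (p⁺ , 0≤p⁺ , p⁺≤q , ∣pᵢ-p⁺∣≤η , ∣pᵢ∣≤1) = begin
        ∣ seq (ℙ (randomSublist p L) E) i - 1ℚ ∣ + ½ * e₀
          ≡⟨ cong (λ z → ∣ z - 1ℚ ∣ + ½ * e₀) (trans (ℙ-seq (randomSublist p L) E i) (randomSublist-𝔼 p L f i)) ⟩
        ∣ 𝔼 pᵢ L f - 1ℚ ∣ + ½ * e₀
          ≡⟨ cong (λ z → ∣ z ∣ + ½ * e₀) split ⟩
        ∣ (𝔼 pᵢ L f - 𝔼 p⁺ L f) - 𝔼 p⁺ L X ∣ + ½ * e₀
          ≤⟨ +-monoˡ-≤ (½ * e₀) (≤-trans (∣p-q∣≤∣p∣+∣q∣ (𝔼 pᵢ L f - 𝔼 p⁺ L f) (𝔼 p⁺ L X)) (+-mono-≤ near small)) ⟩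
        (e + e) + ½ * e₀
          ≡⟨ trans (cong (_+ ½ * e₀) e+e) (halves e₀) ⟩
        e₀
          ≡⟨ sym (+-identityˡ e₀) ⟩
        0ℚ + e₀
          ≤⟨ e₀≤ε i N₁≤i ⟩
        seq ε i
          ∎
        where
        mass : 𝔼 p⁺ L f + 𝔼 p⁺ L X ≡ 1ℚ
        mass = trans (sym (𝔼-+ p⁺ L f X)) (trans
          (𝔼-cong p⁺ L λ es → solve 1 (λ x → x :+ (con 1ℚ :- x) := con 1ℚ) refl (f es)) (𝔼-const p⁺ L 1ℚ))
        split : 𝔼 pᵢ L f - 1ℚ ≡ (𝔼 pᵢ L f - 𝔼 p⁺ L f) - 𝔼 p⁺ L X
        split = trans (cong (λ z → 𝔼 pᵢ L f - z) (sym mass))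
          (solve 3 (λ a b c → a :- (b :+ c) := a :- b :- c) refl (𝔼 pᵢ L f) (𝔼 p⁺ L f) (𝔼 p⁺ L X))
        near : ∣ 𝔼 pᵢ L f - 𝔼 p⁺ L f ∣ ≤ e
        near = ≤-trans (𝔼-lipschitz L 0≤f f≤1 0≤p⁺ (≤-trans p⁺≤q q≤1) ∣pᵢ∣≤1)
          (≤-trans (*-monoˡ (≤-trans 0≤1 (1≤lipschitz L)) ∣pᵢ-p⁺∣≤η) (proj₂ (proj₂ (proj₂ η-exists))))
        0≤X : 0ℚ ≤ 𝔼 p⁺ L X
        0≤X = subst (_≤ 𝔼 p⁺ L X) (𝔼-const p⁺ L 0ℚ) (𝔼-mono-All 0≤p⁺ (≤-trans p⁺≤q q≤1) (All.universal {P = λ _ → ℕ} (λ _ → 0) L) (λ {es} _ → 0≤- (f≤1 es)))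
        small : ∣ 𝔼 p⁺ L X ∣ ≤ e
        small = ≤-trans (≤-reflexive (0≤p⇒∣p∣≡p 0≤X)) (mean 0≤p⁺ p⁺≤q)

    close : Defs.∣ ℙ (randomSublist p L) E Defs.- 1ℝ ∣ Defs.< ε
    close = ½ * e₀ , 0<½* 0<e₀ , M , λ i M≤i → bound i
      (ℕₚ.≤-trans (ℕₚ.≤-trans (ℕₚ.m≤m⊔n M₁ M₂) (ℕₚ.m≤m⊔n (M₁ ℕ.⊔ M₂) N₁)) M≤i)
      (ℕₚ.≤-trans (ℕₚ.≤-trans (ℕₚ.m≤n⊔m M₁ M₂) (ℕₚ.m≤m⊔n (M₁ ℕ.⊔ M₂) N₁)) M≤i)
      (ℕₚ.≤-trans (ℕₚ.m≤n⊔m (M₁ ℕ.⊔ M₂) N₁) M≤i)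

  -- Given ε, first k is fixed to make 40/(k + 1) small, and only then is n taken large, because the
  -- constant in front of 1/n grows like the fourth power of k + 1.
  typical-whp : ∀ (p : ℕ → ℝ) → (∀ n → 0ℝ Defs.≤ p n) →
    (∀ n → p (suc n) Defs.< fromℚ (11 % 10) Defs.* fromℚ (recip n)) →
    (λ n → ℙ (𝔾 n (p n)) (Typical.typical n)) ⟶ 1ℝ
  typical-whp p 0≤p p< ε (e₀ , 0<e₀ , N₁ , e₀≤ε) = with-k (recip-vanishes {ι 40} {½ * e} (0<½* 0<e))
    where
    e : ℚ
    e = ½ * (½ * e₀)
    0<e : 0ℚ < e
    0<e = 0<½* (0<½* 0<e₀)
    Goal : Set
    Goal = ∃[ N ] (∀ n → N ℕ.≤ n → Defs.∣ ℙ (𝔾 n (p n)) (Typical.typical n) Defs.- 1ℝ ∣ Defs.< ε)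
    with-N : ∀ k → 19 ℕ.≤ k → ι 40 * recip k ≤ ½ * e → let C = ι 2401000 * (ι (suc k) * ι (suc k) * (ι (suc k) * ι (suc k))) in
      ∃[ N ] (∀ n → N ℕ.≤ n → C * recip n ≤ ½ * e) → Goal
    with-N k 19≤k k-small (N , n-small) = suc (N ℕ.⊔ 1000) , λ where
      (suc n) (ℕ.s≤s N≤n) → let 1000≤n = ℕₚ.m≤n⇒m≤1+n (ℕₚ.≤-trans (ℕₚ.m≤n⊔m N 1000) N≤n) in
        Concentration.close (pairs (suc n)) (Typical.typical (suc n)) {p (suc n)} {ε} (0≤p (suc n)) (p< n)
          (Estimate.0≤q n k 1000≤n 19≤k) (Estimate.q≤1 n k 1000≤n 19≤k) 0<e₀ N₁ e₀≤ε 0<e (halves (½ * e₀)) λ 0≤q q≤ →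
          ≤-trans (atypical-mean n k 1000≤n 19≤k 0≤q q≤)
            (≤-trans (+-mono-≤ k-small (n-small n (ℕₚ.≤-trans (ℕₚ.m≤m⊔n N 1000) N≤n))) (≤-reflexive (halves e)))
    with-k : ∃[ k ] (∀ n → k ℕ.≤ n → ι 40 * recip n ≤ ½ * e) → Goal
    with-k (k , small) = with-N (k ℕ.⊔ 19) (ℕₚ.m≤n⊔m k 19) (small (k ℕ.⊔ 19) (ℕₚ.m≤m⊔n k 19))
      (recip-vanishes {ι 2401000 * (κ * κ * (κ * κ))} {½ * e} (0<½* 0<e))
      where
      κ : ℚ
      κ = ι (suc (k ℕ.⊔ 19))

open RandomGraph using (module Typical; typical⇒¬rigid; typical-whp)

open import Defs
open import Data.Fin.Subset using (Subset) renaming (∣_∣ to ∣_∣ₛ)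
open import Data.Integer using (+_)
open import Data.Nat using (ℕ; NonZero)
open import Data.Product using (∃-syntax; _×_)
open import Data.Rational using (_/_)
open import Relation.Nullary using (¬_)

theorem1p5 : ∃[ γ ] (0ℝ < γ × (∀ (p : ℕ → ℝ) →
    (∀ n → 0ℝ ≤ p n × p n ≤ 1ℝ) →
    (∀ n → .{{_ : NonZero n}} → p n < fromℚ (+ 11 / 10) * fromℚ (+ 1 / n)) →
    WithHighProbability (λ n → 𝔾 n (p n)) (λ n es →
    (V′ : Subset n) → γ * log n ≤ fromℕ ∣ V′ ∣ₛ → ¬ GloballyRigid (graph es [ V′ ]))))
theorem1p5 = fromℕ 8
  , (ℚ.1ℚ , ℚₚ.positive⁻¹ ℚ.1ℚ , 0 , λ _ _ → toWitness {a? = ℚ.0ℚ ℚ.+ ℚ.1ℚ ℚₚ.≤? (+ 8 / 1)} _)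
  , λ p 0≤p≤1 p< → Typical.typical , typical⇒¬rigid , typical-whp p (λ n → proj₁ (0≤p≤1 n)) (λ n → p< (suc n))
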